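{- Let $E(x)$ denote the number of elite primes $p \le x$. Then $E(x) = O\left(\frac{x}{(\log x)^{3/2}}\right)$ as $x \to \infty$.
   Context: For $n \ge 0$ the $n$-th Fermat number is $F_n = 2^{2^n}+1$. A prime $p$ is called an elite prime if there exists $N$ such that $F_n$ is a quadratic nonresidue modulo $p$ for all $n \ge N$. -}

module Defs where

open import Data.Nat using (ℕ; zero; suc; _+_; _*_; _^_; _≤_; _%_; NonZero)
open import Data.Nat.Primality using (Prime)
open import Data.Product using (∃-syntax; _×_)
open import Data.Empty using (⊥)
open import Data.List using (List)
open import Data.List.Relation.Unary.All using (All)
open import Data.List.Relation.Unary.Unique.Propositional using (Unique)
open import Relation.Binary.PropositionalEquality using (_≡_)
open import Relation.Nullary using (¬_)

F : ℕ → ℕ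
F n = 2 ^ (2 ^ n) + 1

QR : (p : ℕ) → .{{NonZero p}} → ℕ → Set
QR p a = ∃[ y ] ((y * y) % p ≡ a % p)

QNR : (p : ℕ) → .{{NonZero p}} → ℕ → Set
QNR p a = ¬ QR p a

Elite : ℕ → Set
Elite zero = ⊥
Elite (suc q) = Prime (suc q) × ∃[ N ] (∀ n → N ≤ n → QNR (suc q) (F n))

-- l is a duplicate-free list of elite primes p ≤ x.
-- E(x) = the maximal length of such a list.
EliteList : ℕ → List ℕ → Set
EliteList x l = Unique l × All (λ p → p ≤ x × Elite p) l

{-# OPTIONS --safe #-}

-- Let L = log₂ x and choose K with 4^K of order L. If 2^K does not divide p - 1, then n ↦ F n mod p is periodic
-- from n = K on, so for an elite p all of F K, F (K + 1), ... are non-residues, and by reciprocity p satisfies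
-- the conditions (p / F n) = -1 for K ≤ n < 2 K, which are independent and of density 1/2 each. Hence p lies in a
-- union of residue classes of density 2^-K, as it also does when 2^K divides p - 1. All moduli are at most
-- F K ⋯ F (2 K - 1) < 2^(4^K), a small power of x, so Selberg's sieve over these classes saves the
-- further factor L that primes have, and the count is O(x / (2^K L)) = O(x / L^(3/2)).

module Submission where

open import Defs
open import Data.Nat
open import Data.Nat.Properties
open import Data.Nat.DivMod
open import Data.Nat.Divisibility
open import Data.Nat.Primality using (Prime; prime?; ¬prime[1]; euclidsLemma; prime⇒irreducible; prime[2])
open import Data.Nat.Coprimality using (Coprime; 1-coprimeTo; coprime?; coprime-Bézout; coprime-divisor; prime⇒coprime) renaming (sym to coprime-sym)
open import Data.Nat.GCD using (module Bézout)
open import Data.Nat.Logarithm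
open import Data.Nat.Primality.Factorisation using (factorise)
open import Data.Nat.Tactic.RingSolver using (solve-∀)
open import Data.Product using (∃-syntax; ∃₂; _×_; _,_; proj₁; proj₂)
open import Data.Sum using (_⊎_; inj₁; inj₂)
open import Data.Empty using (⊥; ⊥-elim)
open import Data.Fin using (Fin; toℕ; fromℕ<)
open import Data.Fin.Properties using (toℕ<n; toℕ-fromℕ<; toℕ-injective; pigeonhole)
open import Data.Fin.Permutation using (permutation)
open import Data.List using (List; []; _∷_; length)
open import Data.List.Relation.Unary.All as All using (All; []; _∷_)
open import Data.List.Relation.Unary.AllPairs using ([]; _∷_)
open import Data.List.Relation.Unary.Unique.Propositional using (Unique)
open import Relation.Nullary
open import Relation.Nullary.Decidable using (_×-dec_; _→-dec_)
open import Relation.Binary.PropositionalEquality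
open import Relation.Binary.Definitions using (tri<; tri≈; tri>)
open import Function using (_∘_; id; _$_)
open import Algebra.Bundles using (CommutativeMonoid)
open import Algebra.Structures using (IsCommutativeMonoid)
open import Data.Integer using (ℤ; ∣_∣; -[1+_]) renaming (+_ to pos; _+_ to _+ᶻ_; _*_ to _*ᶻ_; _-_ to _-ᶻ_; -_ to -ᶻ_)
import Data.Integer.Properties as ℤₚ
import Data.Integer.Tactic.RingSolver as ℤSolver


-- Finite sums and products

-- The two alternatives for an elite prime are packed into one nonnegative weight, Q [m ≡ 1 mod Q] +
-- ∏ (1 - (m / F n)) with Q = 2^K and K ≤ n < 2 K. It is at least Q at every elite p > 2 and has
-- mean 2, so a sieve bound for its sum over primes, divided by Q, counts the elite primes.
--
-- The sieve needs the mean over the multiples of δ, also when δ shares a factor with some F n.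
-- There the symbol is 0 and its factor is constantly 1, which is again mean one; so the density is
-- 2 / δ for every odd δ and the sieve is the one for plain primes. Even δ would disturb the first
-- term, hence only odd primes are sifted by.
--
-- Mean zero of each symbol comes from (3 / F n) = -1, independence from F 0 ⋯ F (n - 1) = F n - 2,
-- which is coprime to F n. As F n need not be prime, its symbol is defined through parities of
-- floor sums; primality enters only at p.
--
-- Denominators are cleared throughout: Selberg's weights carry the product of the p - 1, harmonic
-- sums carry a factorial, and the final bound is squared to make the exponent 3/2 integral.

module Fold {M : Set} (_∙_ : M → M → M) (ε : M)
            (isCM : IsCommutativeMonoid (_≡_ {A = M}) _∙_ ε) where

  open IsCommutativeMonoid isCM
    using (assoc; identityˡ; identityʳ; comm)

  fold : ℕ → (ℕ → M) → M
  fold zero    f = ε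
  fold (suc n) f = fold n f ∙ f n

  fold-cong : ∀ n {f g : ℕ → M} → (∀ i → i < n → f i ≡ g i) → fold n f ≡ fold n g
  fold-cong zero    f≗g = refl
  fold-cong (suc n) f≗g =
    cong₂ _∙_ (fold-cong n λ i i<n → f≗g i (m<n⇒m<1+n i<n)) (f≗g n (n<1+n n))

  interchange : ∀ a b c d → (a ∙ b) ∙ (c ∙ d) ≡ (a ∙ c) ∙ (b ∙ d)
  interchange a b c d = begin
    (a ∙ b) ∙ (c ∙ d)  ≡⟨ assoc a b (c ∙ d) ⟩
    a ∙ (b ∙ (c ∙ d))  ≡⟨ cong (a ∙_) (sym (assoc b c d)) ⟩
    a ∙ ((b ∙ c) ∙ d)  ≡⟨ cong (λ t → a ∙ (t ∙ d)) (comm b c) ⟩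
    a ∙ ((c ∙ b) ∙ d)  ≡⟨ cong (a ∙_) (assoc c b d) ⟩
    a ∙ (c ∙ (b ∙ d))  ≡⟨ sym (assoc a c (b ∙ d)) ⟩
    (a ∙ c) ∙ (b ∙ d)  ∎
    where open ≡-Reasoning

  fold-∙ : ∀ n (f g : ℕ → M) → fold n (λ i → f i ∙ g i) ≡ fold n f ∙ fold n g
  fold-∙ zero    f g = sym (identityˡ ε)
  fold-∙ (suc n) f g = trans (cong (_∙ (f n ∙ g n)) (fold-∙ n f g)) (interchange _ _ _ _)

  fold-ε : ∀ n → fold n (λ _ → ε) ≡ ε
  fold-ε zero    = refl
  fold-ε (suc n) = trans (identityʳ _) (fold-ε n)

  fold-swap : ∀ m n (f : ℕ → ℕ → M) →
              fold m (λ i → fold n (f i)) ≡ fold n (λ j → fold m (λ i → f i j))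
  fold-swap zero    n f = sym (fold-ε n)
  fold-swap (suc m) n f =
    trans (cong (_∙ fold n (f m)) (fold-swap m n f)) (sym (fold-∙ n _ (f m)))

  fold-+ : ∀ m n (f : ℕ → M) → fold (m + n) f ≡ fold m f ∙ fold n (λ i → f (m + i))
  fold-+ m zero    f rewrite +-identityʳ m = sym (identityʳ _)
  fold-+ m (suc n) f rewrite +-suc m n =
    trans (cong (_∙ f (m + n)) (fold-+ m n f)) (assoc _ _ _)

  fold-front : ∀ n (f : ℕ → M) → fold (suc n) f ≡ f 0 ∙ fold n (f ∘ suc)
  fold-front n f = trans (fold-+ 1 n f) (cong (_∙ fold n (f ∘ suc)) (identityˡ _))

  commutativeMonoid : CommutativeMonoid _ _
  commutativeMonoid = record { isCommutativeMonoid = isCM }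

  open import Algebra.Properties.CommutativeMonoid.Sum commutativeMonoid
    using (sum; sum-permute; sum-cong-≗)

  fold-sum : ∀ n (f : ℕ → M) → fold n f ≡ sum {n} (f ∘ toℕ)
  fold-sum zero    f = refl
  fold-sum (suc n) f = trans (fold-front n f) (cong (f 0 ∙_) (fold-sum n (f ∘ suc)))

  -- Transported to a permutation of `Fin n`. Every change of variables below rests on it: dilations
  -- modulo `n`, Gauss' half system, the pairing x ↦ a / x.
  fold-perm : ∀ n (f : ℕ → M) (σ τ : ℕ → ℕ) →
              (∀ i → i < n → σ i < n) → (∀ i → i < n → τ i < n) →
              (∀ i → i < n → σ (τ i) ≡ i) → (∀ i → i < n → τ (σ i) ≡ i) →
              fold n (f ∘ σ) ≡ fold n f
  fold-perm n f σ τ σ< τ< στ τσ = sym (begin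
    fold n f                       ≡⟨ fold-sum n f ⟩
    sum {n} (f ∘ toℕ)                  ≡⟨ sum-permute {n} {n} (f ∘ toℕ) (permutation σ′ τ′ στ′ τσ′) ⟩
    sum {n} (λ i → f (toℕ (σ′ i))) ≡⟨ sum-cong-≗ {n} (λ i → cong f (toℕ-fromℕ< (σ< (toℕ i) (toℕ<n i)))) ⟩
    sum {n} (λ i → f (σ (toℕ i)))      ≡⟨ fold-sum n (f ∘ σ) ⟨
    fold n (f ∘ σ)                 ∎)
    where
    open ≡-Reasoning
    σ′ τ′ : Fin n → Fin n
    σ′ i = fromℕ< (σ< (toℕ i) (toℕ<n i))
    τ′ i = fromℕ< (τ< (toℕ i) (toℕ<n i))
    στ′ : ∀ i → σ′ (τ′ i) ≡ i
    στ′ i = toℕ-injective (begin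
      toℕ (σ′ (τ′ i))  ≡⟨ toℕ-fromℕ< _ ⟩
      σ (toℕ (τ′ i))   ≡⟨ cong σ (toℕ-fromℕ< _) ⟩
      σ (τ (toℕ i))    ≡⟨ στ (toℕ i) (toℕ<n i) ⟩
      toℕ i            ∎)
    τσ′ : ∀ i → τ′ (σ′ i) ≡ i
    τσ′ i = toℕ-injective (begin
      toℕ (τ′ (σ′ i))  ≡⟨ toℕ-fromℕ< _ ⟩
      τ (toℕ (σ′ i))   ≡⟨ cong τ (toℕ-fromℕ< _) ⟩
      τ (σ (toℕ i))    ≡⟨ τσ (toℕ i) (toℕ<n i) ⟩
      toℕ i            ∎)

open Fold _+_ 0 +-0-isCommutativeMonoid using () renaming
  (fold to ∑; fold-cong to ∑-cong; fold-∙ to ∑-distrib; fold-ε to ∑-zero;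
   fold-swap to ∑-swap; fold-+ to ∑-split; fold-front to ∑-front; fold-perm to ∑-perm)

open Fold _*_ 1 *-1-isCommutativeMonoid using () renaming
  (fold to ∏; fold-cong to ∏-cong; fold-∙ to ∏-distrib; fold-ε to ∏-one; fold-front to ∏-front; fold-perm to ∏-perm)

∑-*ˡ : ∀ n c (f : ℕ → ℕ) → ∑ n (λ i → c * f i) ≡ c * ∑ n f
∑-*ˡ zero    c f = sym (*-zeroʳ c)
∑-*ˡ (suc n) c f = trans (cong (_+ c * f n) (∑-*ˡ n c f)) (sym (*-distribˡ-+ c (∑ n f) (f n)))

∑-const : ∀ n c → ∑ n (λ _ → c) ≡ n * c
∑-const zero    c = refl
∑-const (suc n) c = trans (cong (_+ c) (∑-const n c)) (+-comm (n * c) c)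

∑-mono : ∀ n {f g : ℕ → ℕ} → (∀ i → i < n → f i ≤ g i) → ∑ n f ≤ ∑ n g
∑-mono zero    f≤g = z≤n
∑-mono (suc n) f≤g = +-mono-≤ (∑-mono n λ i i<n → f≤g i (m<n⇒m<1+n i<n)) (f≤g n (n<1+n n))

∑-monoˡ : ∀ {m n} (f : ℕ → ℕ) → m ≤ n → ∑ m f ≤ ∑ n f
∑-monoˡ {m} f m≤n with o , refl ← m≤n⇒∃[o]m+o≡n m≤n =
  ≤-trans (m≤m+n _ _) (≤-reflexive (sym (∑-split m o f)))

term≤∑ : ∀ {m n} (f : ℕ → ℕ) → m < n → f m ≤ ∑ n f
term≤∑ {m} f m<n = ≤-trans (m≤n+m (f m) (∑ m f)) (∑-monoˡ f m<n)

⟦_⟧ : ∀ {a} {A : Set a} → Dec A → ℕ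
⟦ yes _ ⟧ = 1
⟦ no  _ ⟧ = 0

⟦⟧-yes : ∀ {a} {A : Set a} (d : Dec A) → A → ⟦ d ⟧ ≡ 1
⟦⟧-yes (yes _) _ = refl
⟦⟧-yes (no ¬a) a = contradiction a ¬a

⟦⟧-no : ∀ {a} {A : Set a} (d : Dec A) → ¬ A → ⟦ d ⟧ ≡ 0
⟦⟧-no (yes a) ¬a = contradiction a ¬a
⟦⟧-no (no _)  _  = refl

⟦⟧-⇔ : ∀ {a b} {A : Set a} {B : Set b} (d : Dec A) (e : Dec B) → (A → B) → (B → A) → ⟦ d ⟧ ≡ ⟦ e ⟧
⟦⟧-⇔ (yes a) e f g = sym (⟦⟧-yes e (f a))
⟦⟧-⇔ (no ¬a) e f g = sym (⟦⟧-no e (¬a ∘ g))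

⟦⟧≤1 : ∀ {a} {A : Set a} (d : Dec A) → ⟦ d ⟧ ≤ 1
⟦⟧≤1 (yes _) = ≤-refl
⟦⟧≤1 (no _)  = z≤n

-- The induction removes a from the list and zeroes f at a.
unique-∑ : ∀ X (f : ℕ → ℕ) c l → Unique l → All (λ m → m < X × c ≤ f m) l → length l * c ≤ ∑ X f
unique-∑ X f c []      _          _                = z≤n
unique-∑ X f c (a ∷ l) (a∉l ∷ ul) ((a<X , c≤fa) ∷ al) = begin
  c + length l * c               ≤⟨ +-mono-≤ c≤fa (unique-∑ X f′ c l ul (avoid l a∉l al)) ⟩
  f a + ∑ X f′                   ≤⟨ +-monoˡ-≤ _ (≤-trans (≤-reflexive (sym at-a)) (term≤∑ fₐ a<X)) ⟩
  ∑ X fₐ + ∑ X f′                ≡⟨ ∑-distrib X fₐ f′ ⟨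
  ∑ X (λ m → fₐ m + f′ m)        ≡⟨ ∑-cong X (λ m _ → split m) ⟩
  ∑ X f                          ∎
  where
  open ≤-Reasoning
  f′ fₐ : ℕ → ℕ
  f′ m = ⟦ ¬? (a ≟ m) ⟧ * f m
  fₐ m = ⟦ a ≟ m ⟧ * f m
  at-a : fₐ a ≡ f a
  at-a rewrite ⟦⟧-yes (a ≟ a) refl = *-identityˡ (f a)
  split : ∀ m → fₐ m + f′ m ≡ f m
  split m with a ≟ m
  ... | yes _ = trans (+-identityʳ _) (+-identityʳ _)
  ... | no _  = +-identityʳ _
  avoid : ∀ l → All (a ≢_) l → All (λ m → m < X × c ≤ f m) l → All (λ m → m < X × c ≤ f′ m) l
  avoid []      []        []                = []
  avoid (m ∷ l) (a≢m ∷ p) ((m<X , c≤fm) ∷ q) =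
    (m<X , subst (c ≤_) (sym (trans (cong (_* f m) (⟦⟧-yes (¬? (a ≟ m)) a≢m)) (*-identityˡ (f m)))) c≤fm)
    ∷ avoid l p q

-- Periodic functions

module _ (n : ℕ) .{{_ : NonZero n}} where

  %-+-cong : ∀ {a b c d} → a % n ≡ b % n → c % n ≡ d % n → (a + c) % n ≡ (b + d) % n
  %-+-cong {a} {b} {c} {d} p q = begin
    (a + c) % n              ≡⟨ %-distribˡ-+ a c n ⟩
    (a % n + c % n) % n      ≡⟨ cong₂ (λ s t → (s + t) % n) p q ⟩
    (b % n + d % n) % n      ≡⟨ %-distribˡ-+ b d n ⟨
    (b + d) % n              ∎
    where open ≡-Reasoning

  %-*-cong : ∀ {a b c d} → a % n ≡ b % n → c % n ≡ d % n → (a * c) % n ≡ (b * d) % n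
  %-*-cong {a} {b} {c} {d} p q = begin
    (a * c) % n              ≡⟨ %-distribˡ-* a c n ⟩
    (a % n * (c % n)) % n    ≡⟨ cong₂ (λ s t → (s * t) % n) p q ⟩
    (b % n * (d % n)) % n    ≡⟨ %-distribˡ-* b d n ⟨
    (b * d) % n              ∎
    where open ≡-Reasoning

  %-^-cong : ∀ {a b} k → a % n ≡ b % n → a ^ k % n ≡ b ^ k % n
  %-^-cong zero    p = refl
  %-^-cong {a} {b} (suc k) p = %-*-cong {a} {b} p (%-^-cong k p)

  %-+-cancelʳ : ∀ a b c → (a + c) % n ≡ (b + c) % n → a % n ≡ b % n
  %-+-cancelʳ a b c p = begin
    a % n                          ≡⟨ [m+kn]%n≡m%n a c n ⟨
    -- Subtracting `c` is done by adding `c * pred n`, which completes `c` to a multiple of `n`.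
    (a + c * n) % n                ≡⟨ cong (_% n) (regroup a) ⟩
    (a + c + c * pred n) % n       ≡⟨ %-+-cong {a + c} {b + c} p refl ⟩
    (b + c + c * pred n) % n       ≡⟨ cong (_% n) (regroup b) ⟨
    (b + c * n) % n                ≡⟨ [m+kn]%n≡m%n b c n ⟩
    b % n                          ∎
    where
    open ≡-Reasoning
    regroup : ∀ x → x + c * n ≡ x + c + c * pred n
    regroup x = begin
      x + c * n               ≡⟨ cong (λ t → x + c * t) (suc-pred n) ⟨
      x + c * suc (pred n)    ≡⟨ cong (x +_) (*-suc c (pred n)) ⟩
      x + (c + c * pred n)    ≡⟨ +-assoc x c _ ⟨
      x + c + c * pred n      ∎

  %≡⇒∣∸ : ∀ {a b} → a % n ≡ b % n → n ∣ a ∸ b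
  %≡⇒∣∸ {a} {b} p with ≤-total a b
  ... | inj₁ a≤b = subst (n ∣_) (sym (m≤n⇒m∸n≡0 a≤b)) (n ∣0)
  ... | inj₂ b≤a = m%n≡0⇒n∣m (a ∸ b) n (trans
        (%-+-cancelʳ (a ∸ b) 0 b (trans (cong (_% n) (m∸n+n≡m b≤a)) p)) (n∣m⇒m%n≡0 0 n (n ∣0)))

  ∣∸⇒%≡ : ∀ {a b} → b ≤ a → n ∣ a ∸ b → a % n ≡ b % n
  ∣∸⇒%≡ {a} {b} b≤a n∣ = trans (cong (_% n) (sym (m∸n+n≡m b≤a))) (%-remove-+ˡ b n∣)

  <-%-injective : ∀ {a b} → a < n → b < n → a % n ≡ b % n → a ≡ b
  <-%-injective a<n b<n p = trans (sym (m<n⇒m%n≡m a<n)) (trans p (m<n⇒m%n≡m b<n))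

  inverse : ∀ {a} → Coprime a n → ∃[ b ] (a * b) % n ≡ 1 % n
  inverse {a} c with coprime-Bézout c
  ... | Bézout.+- x y eq = x , trans (cong (_% n) (trans (*-comm a x) (sym eq))) ([m+kn]%n≡m%n 1 y n)
  -- Here `x * a` is -1 modulo `n`, so the inverse is -x, written without a sign as `x * (x * a)`.
  ... | Bézout.-+ x y eq = x * (x * a) ,
        %-+-cancelʳ (a * (x * (x * a))) 1 (x * a) (trans lhs (sym rhs))
    where
    lhs : (a * (x * (x * a)) + x * a) % n ≡ 0
    lhs = trans (cong (_% n) (trans (expand a x) (trans (cong (x * a *_) eq) (sym (*-assoc (x * a) y n))))) (m*n%n≡0 (x * a * y) n)
      where
      expand : ∀ a x → a * (x * (x * a)) + x * a ≡ x * a * (1 + x * a)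
      expand = solve-∀
    rhs : (1 + x * a) % n ≡ 0
    rhs = trans (cong (_% n) eq) (m*n%n≡0 y n)

  inverse⇒coprime : ∀ {a b} → (a * b) % n ≡ 1 % n → Coprime a n
  inverse⇒coprime {a} {b} p {d} (d∣a , d∣n) = ∣1⇒≡1 (∣n∣m%n⇒∣m d∣n
    (subst (d ∣_) p (%-presˡ-∣ (∣m⇒∣m*n b d∣a) d∣n)))

Periodic : ℕ → (ℕ → ℕ) → Set
Periodic n f = ∀ m → f (m + n) ≡ f m

periodic-* : ∀ {n f} → Periodic n f → ∀ k m → f (m + k * n) ≡ f m
periodic-* {n} {f} per zero    m = cong f (+-identityʳ m)
periodic-* {n} {f} per (suc k) m = trans (cong f (trans (cong (m +_) (+-comm n (k * n))) (sym (+-assoc m (k * n) n))))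
  (trans (per (m + k * n)) (periodic-* {f = f} per k m))

periodic-% : ∀ {n f} .{{_ : NonZero n}} → Periodic n f → ∀ m → f (m % n) ≡ f m
periodic-% {n} {f} per m = trans (sym (periodic-* {f = f} per (m / n) (m % n))) (cong f (sym (m≡m%n+[m/n]*n m n)))

periodic-cong : ∀ {n f} .{{_ : NonZero n}} → Periodic n f → ∀ {a b} → a % n ≡ b % n → f a ≡ f b
periodic-cong {n} {f} per {a} {b} p =
  trans (sym (periodic-% {f = f} per a)) (trans (cong f p) (periodic-% {f = f} per b))

periodic-multiple : ∀ {n f} → Periodic n f → ∀ a → Periodic n (λ i → f (a * i))
periodic-multiple {n} {f} per a i = trans (cong f (*-distribˡ-+ a i n)) (periodic-* {f = f} per a (a * i))

∑-shift : ∀ n {f} → Periodic n f → ∀ c → ∑ n (λ i → f (c + i)) ≡ ∑ n f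
∑-shift n {f} per zero    = refl
∑-shift n {f} per (suc c) = trans step (∑-shift n {f} per c)
  where
  g : ℕ → ℕ
  g i = f (c + i)
  step : ∑ n (λ i → f (suc c + i)) ≡ ∑ n g
  step = +-cancelˡ-≡ (g 0) _ _ (begin
    g 0 + ∑ n (λ i → f (suc c + i))  ≡⟨ cong (g 0 +_) (∑-cong n λ i _ → cong f (sym (+-suc c i))) ⟩
    g 0 + ∑ n (g ∘ suc)              ≡⟨ ∑-front n g ⟨
    ∑ n g + g n                      ≡⟨ cong (∑ n g +_) (trans (per c) (cong f (sym (+-identityʳ c)))) ⟩
    ∑ n g + g 0                      ≡⟨ +-comm (∑ n g) (g 0) ⟩
    g 0 + ∑ n g                      ∎)
    where open ≡-Reasoning

∑-dilate : ∀ n .{{_ : NonZero n}} {f} → Periodic n f → ∀ {a} → Coprime a n → ∑ n (λ i → f (a * i)) ≡ ∑ n f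
∑-dilate n {f} per {a} cop with b , ab≡1 ← inverse n cop = begin
  ∑ n (λ i → f (a * i))      ≡⟨ ∑-cong n (λ i _ → sym (periodic-% {f = f} per (a * i))) ⟩
  ∑ n (λ i → f (a * i % n))  ≡⟨ ∑-perm n f (λ i → a * i % n) (λ i → b * i % n) (λ i _ → m%n<n (a * i) n)
                                  (λ i _ → m%n<n (b * i) n) (cancel a b ab≡1)
                                  (cancel b a (trans (cong (_% n) (*-comm b a)) ab≡1)) ⟩
  ∑ n f                      ∎
  where
  open ≡-Reasoning
  cancel : ∀ a b → (a * b) % n ≡ 1 % n → ∀ i → i < n → a * (b * i % n) % n ≡ i
  cancel a b ab≡1 i i<n = begin
    a * (b * i % n) % n  ≡⟨ %-*-cong n {a} {a} {b * i % n} {b * i} refl (m%n%n≡m%n (b * i) n) ⟩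
    a * (b * i) % n      ≡⟨ cong (_% n) (sym (*-assoc a b i)) ⟩
    a * b * i % n        ≡⟨ %-*-cong n {a * b} {1} {i} {i} ab≡1 refl ⟩
    1 * i % n            ≡⟨ cong (_% n) (*-identityˡ i) ⟩
    i % n                ≡⟨ m<n⇒m%n≡m i<n ⟩
    i                    ∎

-- With `b` inverse to `a`, `r + a * i` is congruent to `a * (b * r + i)`: a shift inside a
-- dilation, and both permute the residues.
∑-affine : ∀ n .{{_ : NonZero n}} {f} → Periodic n f → ∀ {a} → Coprime a n → ∀ r →
           ∑ n (λ i → f (r + a * i)) ≡ ∑ n f
∑-affine n {f} per {a} cop r with b , ab≡1 ← inverse n cop = begin
  ∑ n (λ i → f (r + a * i))        ≡⟨ ∑-cong n (λ i _ → periodic-cong {f = f} per (move i)) ⟩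
  ∑ n (λ i → f (a * (b * r + i)))  ≡⟨ ∑-shift n {λ i → f (a * i)} (periodic-multiple {f = f} per a) (b * r) ⟩
  ∑ n (λ i → f (a * i))            ≡⟨ ∑-dilate n {f} per cop ⟩
  ∑ n f                            ∎
  where
  open ≡-Reasoning
  move : ∀ i → (r + a * i) % n ≡ (a * (b * r + i)) % n
  move i = begin
    (r + a * i) % n              ≡⟨ cong (λ t → (t + a * i) % n) (*-identityˡ r) ⟨
    (1 * r + a * i) % n          ≡⟨ %-+-cong n {1 * r} {a * b * r} {a * i} {a * i} (%-*-cong n {1} {a * b} {r} {r} (sym ab≡1) refl) refl ⟩
    (a * b * r + a * i) % n      ≡⟨ cong (_% n) (regroup a b r i) ⟩
    (a * (b * r + i)) % n        ∎
    where
    regroup : ∀ a b r i → a * b * r + a * i ≡ a * (b * r + i)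
    regroup = solve-∀

∑-block : ∀ m n f → ∑ (m * n) f ≡ ∑ m (λ i → ∑ n (λ j → f (i * n + j)))
∑-block zero    n f = refl
∑-block (suc m) n f = begin
  ∑ (n + m * n) f                              ≡⟨ cong (λ t → ∑ t f) (+-comm n (m * n)) ⟩
  ∑ (m * n + n) f                              ≡⟨ ∑-split (m * n) n f ⟩
  ∑ (m * n) f + ∑ n (λ j → f (m * n + j))      ≡⟨ cong (_+ ∑ n (λ j → f (m * n + j))) (∑-block m n f) ⟩
  ∑ (suc m) (λ i → ∑ n (λ j → f (i * n + j)))  ∎
  where open ≡-Reasoning

∑-periods : ∀ n {f} → Periodic n f → ∀ k → ∑ (k * n) f ≡ k * ∑ n f
∑-periods n {f} per k = trans (∑-block k n f)
  (trans (∑-cong k (λ i _ → ∑-shift n {f} per (i * n))) (∑-const k (∑ n f)))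

module _ (n : ℕ) .{{_ : NonZero n}} {f : ℕ → ℕ} (per : Periodic n f) (mean : ∑ n f ≡ n) where

  private
    ∑-parts : ∀ Y → ∑ Y f ≡ Y / n * n + ∑ (Y % n) f
    ∑-parts Y = begin
      ∑ Y f                                            ≡⟨ cong (λ t → ∑ t f) (trans (m≡m%n+[m/n]*n Y n) (+-comm (Y % n) _)) ⟩
      ∑ (Y / n * n + Y % n) f                          ≡⟨ ∑-split (Y / n * n) (Y % n) f ⟩
      ∑ (Y / n * n) f + ∑ (Y % n) (λ i → f (Y / n * n + i))
        ≡⟨ cong₂ _+_ (trans (∑-periods n {f} per (Y / n)) (cong (Y / n *_) mean))
                     (∑-cong (Y % n) λ i _ → trans (cong f (+-comm _ i)) (periodic-* {f = f} per (Y / n) i)) ⟩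
      Y / n * n + ∑ (Y % n) f                          ∎
      where open ≡-Reasoning

  -- Complete periods contribute exactly their length, and the incomplete one something between 0
  -- and `n`.
  periodic-∑≤ : ∀ Y → ∑ Y f ≤ Y + n
  periodic-∑≤ Y = begin
    ∑ Y f                      ≡⟨ ∑-parts Y ⟩
    Y / n * n + ∑ (Y % n) f    ≤⟨ +-mono-≤ (m/n*n≤m Y n) (≤-trans (∑-monoˡ f (m%n≤n Y n)) (≤-reflexive mean)) ⟩
    Y + n                      ∎
    where open ≤-Reasoning

  periodic-≤∑ : ∀ Y → Y ≤ ∑ Y f + n
  periodic-≤∑ Y = begin
    Y                                    ≡⟨ m≡m%n+[m/n]*n Y n ⟩
    Y % n + Y / n * n                    ≤⟨ +-mono-≤ (m%n≤n Y n) (m≤m+n (Y / n * n) (∑ (Y % n) f)) ⟩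
    n + (Y / n * n + ∑ (Y % n) f)        ≡⟨ cong (n +_) (∑-parts Y) ⟨
    n + ∑ Y f                            ≡⟨ +-comm n _ ⟩
    ∑ Y f + n                            ∎
    where open ≤-Reasoning

module _ (δ : ℕ) where

  -- The multiple 0 is included, so the value is `X` / `δ` rounded up.
  multiples : ℕ → ℕ
  multiples zero    = 0
  multiples (suc X) = ⟦ δ ∣? X ⟧ + multiples X

  private
    quotient≡ : .{{_ : NonZero δ}} → ∀ {X c} → δ ∣ X → X ≤ δ * c → δ * c < X + δ → δ * c ≡ X
    quotient≡ {c = c} (divides q refl) lo hi = trans (cong (δ *_) (≤-antisym
      (≤-pred (*-cancelˡ-< δ c (suc q) (<-≤-trans hi (≤-reflexive (trans (+-comm (q * δ) δ) (*-comm (suc q) δ))))))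
      (*-cancelˡ-≤ δ (≤-trans (≤-reflexive (*-comm δ q)) lo)))) (*-comm δ q)

  multiples-bounds : .{{_ : NonZero δ}} → ∀ X → X ≤ δ * multiples X × δ * multiples X < X + δ
  multiples-bounds zero = z≤n , subst (_< δ) (sym (*-zeroʳ δ)) (>-nonZero⁻¹ δ)
  multiples-bounds (suc X) with lo , hi ← multiples-bounds X | δ ∣? X
  ... | no δ∤X = ≤∧≢⇒< lo (λ X≡ → δ∤X (subst (δ ∣_) (sym X≡) (m∣m*n _))) , m<n⇒m<1+n hi
  ... | yes δ∣X rewrite *-suc δ (multiples X) | quotient≡ δ∣X lo hi =
    +-monoˡ-≤ X (>-nonZero⁻¹ δ) , s≤s (≤-reflexive (+-comm δ X))

  ∣⇒multiples : .{{_ : NonZero δ}} → ∀ {X} → δ ∣ X → δ * multiples X ≡ X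
  ∣⇒multiples {X} δ∣X = quotient≡ δ∣X (proj₁ (multiples-bounds X)) (proj₂ (multiples-bounds X))

  ∑-multiples : .{{_ : NonZero δ}} → ∀ X (f : ℕ → ℕ) → ∑ X (λ m → ⟦ δ ∣? m ⟧ * f m) ≡ ∑ (multiples X) (λ t → f (δ * t))
  ∑-multiples zero    f = refl
  ∑-multiples (suc X) f with δ ∣? X
  ... | yes δ∣X = cong₂ _+_ (∑-multiples X f) (trans (*-identityˡ (f X)) (cong f (sym (∣⇒multiples δ∣X))))
  ... | no  _   = trans (+-identityʳ _) (∑-multiples X f)

-- Selberg's sieve

open Fold _+ᶻ_ (pos 0) ℤₚ.+-0-isCommutativeMonoid using () renaming
  (fold to ∑ᶻ; fold-cong to ∑ᶻ-cong; fold-∙ to ∑ᶻ-distrib)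

∑ᶻ-*ˡ : ∀ n c (f : ℕ → ℤ) → ∑ᶻ n (λ i → c *ᶻ f i) ≡ c *ᶻ ∑ᶻ n f
∑ᶻ-*ˡ zero    c f = sym (ℤₚ.*-zeroʳ c)
∑ᶻ-*ˡ (suc n) c f = trans (cong (_+ᶻ c *ᶻ f n) (∑ᶻ-*ˡ n c f)) (sym (ℤₚ.*-distribˡ-+ c (∑ᶻ n f) (f n)))

∑ᶻ-cons : ∀ n c (f : ℕ → ℤ) {g s} → ∑ᶻ n g ≡ s → ∑ᶻ n (λ i → c *ᶻ f i +ᶻ g i) ≡ c *ᶻ ∑ᶻ n f +ᶻ s
∑ᶻ-cons n c f {g} refl = trans (∑ᶻ-distrib n (λ i → c *ᶻ f i) g) (cong (_+ᶻ ∑ᶻ n g) (∑ᶻ-*ˡ n c f))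

∑ᶻ-pos : ∀ n (f : ℕ → ℕ) → ∑ᶻ n (λ i → pos (f i)) ≡ pos (∑ n f)
∑ᶻ-pos zero    f = refl
∑ᶻ-pos (suc n) f = cong (_+ᶻ pos (f n)) (∑ᶻ-pos n f)

∣-∣≤ : ∀ a b c → a ≤ b + c → b ≤ a + c → ∣ pos a -ᶻ pos b ∣ ≤ c
∣-∣≤ a b c p q rewrite ℤₚ.m-n≡m⊖n a b with ≤-total a b
... | inj₁ a≤b rewrite ℤₚ.∣⊖∣-≤ a≤b = m≤n+o⇒m∸n≤o b a q
... | inj₂ b≤a rewrite ℤₚ.∣m⊖n∣≡∣n⊖m∣ a b | ℤₚ.∣⊖∣-≤ b≤a = m≤n+o⇒m∸n≤o a b p

≤+∣-∣ : ∀ a b → a ≤ b + ∣ pos a -ᶻ pos b ∣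
≤+∣-∣ a b rewrite ℤₚ.m-n≡m⊖n a b with ≤-total a b
... | inj₁ a≤b = ≤-trans a≤b (m≤m+n b _)
... | inj₂ b≤a rewrite ℤₚ.∣m⊖n∣≡∣n⊖m∣ a b | ℤₚ.∣⊖∣-≤ b≤a = ≤-reflexive (sym (m+[n∸m]≡n b≤a))

∣∣*∣∣ : ∀ i → pos (∣ i ∣ * ∣ i ∣) ≡ i *ᶻ i
∣∣*∣∣ (pos n)       = ℤₚ.pos-* n n
∣∣*∣∣ -[1+ n ]  = refl

OddPrime : ℕ → Set
OddPrime p = Prime p × p ≢ 2

oddPrime? : ∀ p → Dec (OddPrime p)
oddPrime? p = prime? p ×-dec ¬? (p ≟ 2)

oddPrime⇒≥3 : ∀ {n} → OddPrime (suc n) → ∃[ k ] n ≡ suc (suc k)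
oddPrime⇒≥3 {zero}        (pr , _)  = contradiction pr ¬prime[1]
oddPrime⇒≥3 {suc zero}    (_ , ≢2)  = contradiction refl ≢2
oddPrime⇒≥3 {suc (suc k)} _         = k , refl

choose : ∀ {a b} {A : Set a} {B : Set b} → Dec A → B → B → B
choose (yes _) x y = x
choose (no _)  x y = y

choose-elim : ∀ {a b c} {A : Set a} {B : Set b} (C : B → Set c) (d : Dec A) {x y : B} →
              (A → C x) → C y → C (choose d x y)
choose-elim C (yes a) p q = p a
choose-elim C (no _)  p q = q

signum : ℕ → ℕ
signum zero    = 0
signum (suc _) = 1

-- Selberg's weights cleared of denominators: with φ n the product of p - 1 over the odd primes p ≤ n,
-- weight n y m / φ n is the sum over odd squarefree n-smooth d ≤ y of the product over p ∣ d of
-- 1/(p-1) if p ∤ m, and -1 if p ∣ m.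
weight : ℕ → ℕ → ℕ → ℤ
weight zero    y m = pos (signum y)
weight (suc n) y m = choose (oddPrime? (suc n))
  (pos n *ᶻ weight n y m +ᶻ (pos 1 -ᶻ pos (suc n) *ᶻ pos ⟦ suc n ∣? m ⟧) *ᶻ weight n (y / suc n) m)
  (weight n y m)

φ : ℕ → ℕ
φ zero    = 1
φ (suc n) = choose (oddPrime? (suc n)) (n * φ n) (φ n)

-- `gain n y` / `φ n` is the sum of the product of 1/(p-1) over p ∣ d, taken over the same d as in
-- `weight`; that is, of the reciprocals of Euler's totient of d.
gain : ℕ → ℕ → ℕ
gain zero    y = signum y
gain (suc n) y = choose (oddPrime? (suc n)) (n * gain n y + gain n (y / suc n)) (gain n y)

correlation : ℕ → ℕ → ℕ → ℕ
correlation zero    y y′ = signum y * signum y′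
correlation (suc n) y y′ = choose (oddPrime? (suc n))
  (n * (n * correlation n y y′ + correlation n (y / suc n) (y′ / suc n)))
  (correlation n y y′)

-- Each p ∣ d enters with the factor (p+1)/(p-1), obtained from 1 - p [p ∣ m] by adding the absolute
-- values of its coefficients. This controls the error terms.
size : ℕ → ℕ → ℕ
size zero    y = signum y
size (suc n) y = choose (oddPrime? (suc n)) (n * size n y + suc (suc n) * size n (y / suc n)) (size n y)

correlation-diagonal : ∀ n y → correlation n y y ≡ φ n * gain n y
correlation-diagonal zero    zero    = refl
correlation-diagonal zero    (suc y) = refl
correlation-diagonal (suc n) y with oddPrime? (suc n)
... | no _  = correlation-diagonal n y
... | yes _ = trans
  (cong₂ (λ s t → n * (n * s + t)) (correlation-diagonal n y) (correlation-diagonal n (y / suc n)))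
  (regroup n (φ n) (gain n y) (gain n (y / suc n)))
  where
  regroup : ∀ n φ g g′ → n * (n * (φ * g) + φ * g′) ≡ n * φ * (n * g + g′)
  regroup = solve-∀

weight-oddPrime : ∀ n y m → OddPrime (suc n) →
  weight (suc n) y m ≡ pos n *ᶻ weight n y m +ᶻ (pos 1 -ᶻ pos (suc n) *ᶻ pos ⟦ suc n ∣? m ⟧) *ᶻ weight n (y / suc n) m
weight-oddPrime n y m op with oddPrime? (suc n)
... | yes _  = refl
... | no ¬op = contradiction op ¬op

weight-¬oddPrime : ∀ n y m → ¬ OddPrime (suc n) → weight (suc n) y m ≡ weight n y m
weight-¬oddPrime n y m ¬op with oddPrime? (suc n)
... | yes op = contradiction op ¬op
... | no _   = refl

correlation-oddPrime : ∀ n y y′ → OddPrime (suc n) →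
  correlation (suc n) y y′ ≡ n * (n * correlation n y y′ + correlation n (y / suc n) (y′ / suc n))
correlation-oddPrime n y y′ op with oddPrime? (suc n)
... | yes _  = refl
... | no ¬op = contradiction op ¬op

correlation-¬oddPrime : ∀ n y y′ → ¬ OddPrime (suc n) → correlation (suc n) y y′ ≡ correlation n y y′
correlation-¬oddPrime n y y′ ¬op with oddPrime? (suc n)
... | yes op = contradiction op ¬op
... | no _   = refl

size-oddPrime : ∀ n y → OddPrime (suc n) →
  size (suc n) y ≡ n * size n y + suc (suc n) * size n (y / suc n)
size-oddPrime n y op with oddPrime? (suc n)
... | yes _  = refl
... | no ¬op = contradiction op ¬op

size-¬oddPrime : ∀ n y → ¬ OddPrime (suc n) → size (suc n) y ≡ size n y
size-¬oddPrime n y ¬op with oddPrime? (suc n)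
... | yes op = contradiction op ¬op
... | no _   = refl

gain-oddPrime : ∀ n y → OddPrime (suc n) →
  gain (suc n) y ≡ n * gain n y + gain n (y / suc n)
gain-oddPrime n y op with oddPrime? (suc n)
... | yes _  = refl
... | no ¬op = contradiction op ¬op

gain-¬oddPrime : ∀ n y → ¬ OddPrime (suc n) → gain (suc n) y ≡ gain n y
gain-¬oddPrime n y ¬op with oddPrime? (suc n)
... | yes op = contradiction op ¬op
... | no _   = refl

φ-oddPrime : ∀ n → OddPrime (suc n) →
  φ (suc n) ≡ n * φ n
φ-oddPrime n op with oddPrime? (suc n)
... | yes _  = refl
... | no ¬op = contradiction op ¬op

φ-¬oddPrime : ∀ n → ¬ OddPrime (suc n) → φ (suc n) ≡ φ n
φ-¬oddPrime n ¬op with oddPrime? (suc n)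
... | yes op = contradiction op ¬op
... | no _   = refl

Free : ℕ → ℕ → Set
Free n m = ∀ p → p ≤ n → OddPrime p → ¬ p ∣ m

-- All indicators vanish, and the recursion of `weight` becomes that of `gain`. A common large value
-- at all sifted `m` is what lets the second moment bound their number.
weight-free : ∀ n y {m} → Free n m → weight n y m ≡ pos (gain n y)
weight-free zero    y free = refl
weight-free (suc n) y {m} free with oddPrime? (suc n)
... | no _  = weight-free n y (λ p p≤n → free p (m≤n⇒m≤1+n p≤n))
... | yes op rewrite ⟦⟧-no (suc n ∣? m) (free (suc n) ≤-refl op)
                   | weight-free n y (λ p p≤n → free p (m≤n⇒m≤1+n p≤n))
                   | weight-free n (y / suc n) (λ p p≤n → free p (m≤n⇒m≤1+n p≤n)) = begin
  pos n *ᶻ pos (gain n y) +ᶻ (pos 1 -ᶻ pos (suc n) *ᶻ pos 0) *ᶻ pos (gain n (y / suc n))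
    ≡⟨ simplify (pos n) (pos (suc n)) (pos (gain n y)) (pos (gain n (y / suc n))) ⟩
  pos n *ᶻ pos (gain n y) +ᶻ pos (gain n (y / suc n))
    ≡⟨ cong (_+ᶻ pos (gain n (y / suc n))) (ℤₚ.pos-* n (gain n y)) ⟨
  pos (n * gain n y + gain n (y / suc n)) ∎
  where
  open ≡-Reasoning
  simplify : ∀ a P g g′ → a *ᶻ g +ᶻ (pos 1 -ᶻ P *ᶻ pos 0) *ᶻ g′ ≡ a *ᶻ g +ᶻ g′
  simplify = ℤSolver.solve-∀

-- Passing from `p` to `suc p` on the right leaves `n * f * (y * y)` for the second term. Since
-- `y′ * p ≤ y`, this requires p + 1 ≤ p (p - 1), true from p = 3 on; the polynomial in `k` below is
-- the difference of the two sides.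
size≤-step : ∀ k f y {s s′} → let n = suc (suc k); p = suc n; y′ = y / p in
  s ≤ f * (y * y * p) → s′ ≤ f * (y′ * y′ * p) → n * s + suc p * s′ ≤ n * f * (y * y * suc p)
size≤-step k f y {s} {s′} s≤ s′≤ = begin
  n * s + suc p * s′                                      ≤⟨ +-mono-≤ (*-monoʳ-≤ n s≤) (*-monoʳ-≤ (suc p) s′≤) ⟩
  n * (f * (y * y * p)) + suc p * (f * (y′ * y′ * p))     ≤⟨ +-monoʳ-≤ (n * (f * (y * y * p))) (m≤m+n _ ((k * k + 4 * k + 2) * (f * (y′ * y′ * p)))) ⟩
  n * (f * (y * y * p)) + (suc p * (f * (y′ * y′ * p)) + (k * k + 4 * k + 2) * (f * (y′ * y′ * p)))
                                                          ≡⟨ cong (n * (f * (y * y * p)) +_) (expand k f y′) ⟩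
  n * (f * (y * y * p)) + n * f * (y′ * p * (y′ * p))     ≤⟨ +-monoʳ-≤ (n * (f * (y * y * p))) (*-monoʳ-≤ (n * f) (*-mono-≤ (m/n*n≤m y p) (m/n*n≤m y p))) ⟩
  n * (f * (y * y * p)) + n * f * (y * y)                 ≡⟨ collect n f y ⟩
  n * f * (y * y * suc p)                                 ∎
  where
  open ≤-Reasoning
  n p y′ : ℕ
  n  = suc (suc k)
  p  = suc n
  y′ = y / p
  collect : ∀ n f y → n * (f * (y * y * suc n)) + n * f * (y * y) ≡ n * f * (y * y * suc (suc n))
  collect = solve-∀
  expand : ∀ k f z → suc (suc (suc (suc k))) * (f * (z * z * suc (suc (suc k)))) + (k * k + 4 * k + 2) * (f * (z * z * suc (suc (suc k))))
                   ≡ suc (suc k) * f * (z * suc (suc (suc k)) * (z * suc (suc (suc k))))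
  expand = solve-∀

size≤ : ∀ n y → size n y ≤ φ n * (y * y * suc n)
size≤ zero    zero    = z≤n
size≤ zero    (suc y) = s≤s z≤n
size≤ (suc n) y with oddPrime? (suc n) | size≤ n y | size≤ n (y / suc n)
... | no _   | ih | _ = ≤-trans ih (*-monoʳ-≤ (φ n) (*-monoʳ-≤ (y * y) (n≤1+n (suc n))))
... | yes op | ih | ih′ with k , refl ← oddPrime⇒≥3 op = size≤-step k (φ n) y ih ih′

Odd : ℕ → Set
Odd m = ¬ 2 ∣ m

prime∤⇒coprime : ∀ {p m} → Prime p → ¬ p ∣ m → Coprime p m
prime∤⇒coprime pr p∤m (d∣p , d∣m) with prime⇒irreducible pr d∣p
... | inj₁ d≡1  = d≡1
... | inj₂ refl = contradiction d∣m p∤m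

⟦*∣⟧ : ∀ {δ p} m → Coprime p δ → ⟦ δ * p ∣? m ⟧ ≡ ⟦ δ ∣? m ⟧ * ⟦ p ∣? m ⟧
⟦*∣⟧ {δ} {p} m cop with δ ∣? m | p ∣? m
... | no δ∤m  | _ = ⟦⟧-no (δ * p ∣? m) (δ∤m ∘ m*n∣⇒m∣ δ p)
... | yes _   | no p∤m = ⟦⟧-no (δ * p ∣? m) (p∤m ∘ m*n∣⇒n∣ δ p)
... | yes (divides q refl) | yes p∣m = ⟦⟧-yes (δ * p ∣? m)
  (subst (δ * p ∣_) (*-comm δ q) (*-monoʳ-∣ δ (coprime-divisor cop (subst (p ∣_) (*-comm q δ) p∣m))))

-- The two hypotheses say that `h` has total `M` / `δ` over the multiples of `δ`, up to an error
-- `E`, as for the constant weight in the sieve for primes. They are multiplied by `δ` to avoid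
-- fractions.
module Sieve (X M E : ℕ) (h : ℕ → ℕ)
  (upper : ∀ δ .{{_ : NonZero δ}} → Odd δ → δ * ∑ X (λ m → ⟦ δ ∣? m ⟧ * h m) ≤ M + E * δ)
  (lower : ∀ δ .{{_ : NonZero δ}} → Odd δ → M ≤ δ * ∑ X (λ m → ⟦ δ ∣? m ⟧ * h m) + E * δ) where

  twisted : ℕ → (ℕ → ℤ) → ℤ
  twisted δ f = ∑ᶻ X (λ m → pos (⟦ δ ∣? m ⟧ * h m) *ᶻ f m)

  moment : ℕ → ℕ → ℕ → ℕ → ℤ
  moment n δ y y′ = twisted δ (λ m → weight n y m *ᶻ weight n y′ m)

  -- With the factor `δ` the main term no longer depends on `δ`, so the main terms belonging to `δ`
  -- and `δ * p` can cancel in the recursion.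
  error : ℕ → ℕ → ℕ → ℕ → ℤ
  error n δ y y′ = pos δ *ᶻ moment n δ y y′ -ᶻ pos M *ᶻ pos (correlation n y y′)

  module _ {n δ : ℕ} (cop : Coprime (suc n) δ) (f f′ v v′ : ℕ → ℤ) where

    private
      P a : ℤ
      P = pos (suc n)
      a = pos n
      ι : ℕ → ℤ
      ι m = pos ⟦ suc n ∣? m ⟧

      g : ℕ → ℤ
      g m = pos (⟦ δ ∣? m ⟧ * h m)
      g′ : ℕ → ℤ
      g′ m = pos (⟦ δ * suc n ∣? m ⟧ * h m)

      g′≡ : ∀ m → g′ m ≡ ι m *ᶻ g m
      g′≡ m = trans (cong pos (trans (cong (_* h m) (trans (⟦*∣⟧ m cop) (*-comm ⟦ δ ∣? m ⟧ _))) (*-assoc ⟦ suc n ∣? m ⟧ _ _))) (ℤₚ.pos-* ⟦ suc n ∣? m ⟧ _)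

      -- The indicator enters as a number `k ≤ 1`: at 0 and at 1 the claim is a polynomial identity,
      -- which replaces the rule that an indicator equals its square.
      pointwise : ∀ {k} → k ≤ 1 → ∀ θ {θ′} → θ′ ≡ pos k *ᶻ θ → ∀ x x′ y y′ →
        θ *ᶻ ((a *ᶻ x +ᶻ (pos 1 -ᶻ P *ᶻ pos k) *ᶻ y) *ᶻ (a *ᶻ x′ +ᶻ (pos 1 -ᶻ P *ᶻ pos k) *ᶻ y′))
        ≡ a *ᶻ a *ᶻ (θ *ᶻ (x *ᶻ x′)) +ᶻ (a *ᶻ (θ *ᶻ (x *ᶻ y′)) +ᶻ (-ᶻ (a *ᶻ P) *ᶻ (θ′ *ᶻ (x *ᶻ y′))
          +ᶻ (a *ᶻ (θ *ᶻ (y *ᶻ x′)) +ᶻ (-ᶻ (a *ᶻ P) *ᶻ (θ′ *ᶻ (y *ᶻ x′))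
          +ᶻ ((P *ᶻ P -ᶻ pos 2 *ᶻ P) *ᶻ (θ′ *ᶻ (y *ᶻ y′)) +ᶻ θ *ᶻ (y *ᶻ y′))))))
      pointwise {zero} _ θ refl x x′ y y′ = identity a P θ x x′ y y′
        where
        identity : ∀ a P θ x x′ y y′ →
          θ *ᶻ ((a *ᶻ x +ᶻ (pos 1 -ᶻ P *ᶻ pos 0) *ᶻ y) *ᶻ (a *ᶻ x′ +ᶻ (pos 1 -ᶻ P *ᶻ pos 0) *ᶻ y′))
          ≡ a *ᶻ a *ᶻ (θ *ᶻ (x *ᶻ x′)) +ᶻ (a *ᶻ (θ *ᶻ (x *ᶻ y′)) +ᶻ (-ᶻ (a *ᶻ P) *ᶻ (pos 0 *ᶻ θ *ᶻ (x *ᶻ y′))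
            +ᶻ (a *ᶻ (θ *ᶻ (y *ᶻ x′)) +ᶻ (-ᶻ (a *ᶻ P) *ᶻ (pos 0 *ᶻ θ *ᶻ (y *ᶻ x′))
            +ᶻ ((P *ᶻ P -ᶻ pos 2 *ᶻ P) *ᶻ (pos 0 *ᶻ θ *ᶻ (y *ᶻ y′)) +ᶻ θ *ᶻ (y *ᶻ y′))))))
        identity = ℤSolver.solve-∀
      pointwise {suc zero} _ θ refl x x′ y y′ = identity a P θ x x′ y y′
        where
        identity : ∀ a P θ x x′ y y′ →
          θ *ᶻ ((a *ᶻ x +ᶻ (pos 1 -ᶻ P *ᶻ pos 1) *ᶻ y) *ᶻ (a *ᶻ x′ +ᶻ (pos 1 -ᶻ P *ᶻ pos 1) *ᶻ y′))
          ≡ a *ᶻ a *ᶻ (θ *ᶻ (x *ᶻ x′)) +ᶻ (a *ᶻ (θ *ᶻ (x *ᶻ y′)) +ᶻ (-ᶻ (a *ᶻ P) *ᶻ (pos 1 *ᶻ θ *ᶻ (x *ᶻ y′))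
            +ᶻ (a *ᶻ (θ *ᶻ (y *ᶻ x′)) +ᶻ (-ᶻ (a *ᶻ P) *ᶻ (pos 1 *ᶻ θ *ᶻ (y *ᶻ x′))
            +ᶻ ((P *ᶻ P -ᶻ pos 2 *ᶻ P) *ᶻ (pos 1 *ᶻ θ *ᶻ (y *ᶻ y′)) +ᶻ θ *ᶻ (y *ᶻ y′))))))
        identity = ℤSolver.solve-∀
      pointwise {suc (suc _)} (s≤s ()) θ _ x x′ y y′

    twisted-step : twisted δ (λ m → (a *ᶻ f m +ᶻ (pos 1 -ᶻ P *ᶻ ι m) *ᶻ v m) *ᶻ (a *ᶻ f′ m +ᶻ (pos 1 -ᶻ P *ᶻ ι m) *ᶻ v′ m))
      ≡ a *ᶻ a *ᶻ twisted δ (λ m → f m *ᶻ f′ m)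
        +ᶻ (a *ᶻ twisted δ (λ m → f m *ᶻ v′ m) +ᶻ (-ᶻ (a *ᶻ P) *ᶻ twisted (δ * suc n) (λ m → f m *ᶻ v′ m)
        +ᶻ (a *ᶻ twisted δ (λ m → v m *ᶻ f′ m) +ᶻ (-ᶻ (a *ᶻ P) *ᶻ twisted (δ * suc n) (λ m → v m *ᶻ f′ m)
        +ᶻ ((P *ᶻ P -ᶻ pos 2 *ᶻ P) *ᶻ twisted (δ * suc n) (λ m → v m *ᶻ v′ m) +ᶻ twisted δ (λ m → v m *ᶻ v′ m))))))
    twisted-step = trans
      (∑ᶻ-cong X λ m _ → pointwise (⟦⟧≤1 (suc n ∣? m)) (g m) (g′≡ m) (f m) (f′ m) (v m) (v′ m))
      (∑ᶻ-cons X (a *ᶻ a) (λ m → g m *ᶻ (f m *ᶻ f′ m))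
      (∑ᶻ-cons X a (λ m → g m *ᶻ (f m *ᶻ v′ m))
      (∑ᶻ-cons X (-ᶻ (a *ᶻ P)) (λ m → g′ m *ᶻ (f m *ᶻ v′ m))
      (∑ᶻ-cons X a (λ m → g m *ᶻ (v m *ᶻ f′ m))
      (∑ᶻ-cons X (-ᶻ (a *ᶻ P)) (λ m → g′ m *ᶻ (v m *ᶻ f′ m))
      (∑ᶻ-cons X (P *ᶻ P -ᶻ pos 2 *ᶻ P) (λ m → g′ m *ᶻ (v m *ᶻ v′ m)) {λ m → g m *ᶻ (v m *ᶻ v′ m)} refl))))))

  -- 1 - p [p ∣ m] has mean zero and mean square p - 1, so the mixed terms contribute no main term.
  error-step : ∀ n δ y y′ → OddPrime (suc n) → Coprime (suc n) δ → let p = suc n; a = pos n in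
    error (suc n) δ y y′ ≡
      a *ᶻ a *ᶻ error n δ y y′ +ᶻ a *ᶻ error n δ y (y′ / p) +ᶻ -ᶻ a *ᶻ error n (δ * p) y (y′ / p)
      +ᶻ a *ᶻ error n δ (y / p) y′ +ᶻ -ᶻ a *ᶻ error n (δ * p) (y / p) y′
      +ᶻ (a -ᶻ pos 1) *ᶻ error n (δ * p) (y / p) (y′ / p) +ᶻ error n δ (y / p) (y′ / p)
  error-step n δ y y′ op cop = trans
    (cong₂ (λ t c → pos δ *ᶻ t -ᶻ pos M *ᶻ c) moment≡ correlation≡)
    (trans
      (identity (pos δ) (pos n)
        (moment n δ y y′) (moment n δ y (y′ / p)) (moment n (δ * p) y (y′ / p))
        (moment n δ (y / p) y′) (moment n (δ * p) (y / p) y′)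
        (moment n δ (y / p) (y′ / p)) (moment n (δ * p) (y / p) (y′ / p))
        (pos M) (pos (correlation n y y′)) (pos (correlation n y (y′ / p)))
        (pos (correlation n (y / p) y′)) (pos (correlation n (y / p) (y′ / p))))
      (cong (λ d → pos n *ᶻ pos n *ᶻ error n δ y y′ +ᶻ pos n *ᶻ error n δ y (y′ / p)
                +ᶻ -ᶻ pos n *ᶻ (d *ᶻ moment n (δ * p) y (y′ / p) -ᶻ pos M *ᶻ pos (correlation n y (y′ / p)))
                +ᶻ pos n *ᶻ error n δ (y / p) y′
                +ᶻ -ᶻ pos n *ᶻ (d *ᶻ moment n (δ * p) (y / p) y′ -ᶻ pos M *ᶻ pos (correlation n (y / p) y′))
                +ᶻ (pos n -ᶻ pos 1) *ᶻ (d *ᶻ moment n (δ * p) (y / p) (y′ / p) -ᶻ pos M *ᶻ pos (correlation n (y / p) (y′ / p)))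
                +ᶻ error n δ (y / p) (y′ / p))
        (sym (ℤₚ.pos-* δ p))))
    where
    p : ℕ
    p = suc n
    moment≡ = trans
      (∑ᶻ-cong X λ m _ → cong (pos (⟦ δ ∣? m ⟧ * h m) *ᶻ_) (cong₂ _*ᶻ_ (weight-oddPrime n y m op) (weight-oddPrime n y′ m op)))
      (twisted-step cop (weight n y) (weight n y′) (weight n (y / p)) (weight n (y′ / p)))
    correlation≡ : pos (correlation p y y′) ≡ pos n *ᶻ (pos n *ᶻ pos (correlation n y y′) +ᶻ pos (correlation n (y / p) (y′ / p)))
    correlation≡ = trans (cong pos (correlation-oddPrime n y y′ op))
      (trans (ℤₚ.pos-* n _) (cong (λ t → pos n *ᶻ (t +ᶻ pos (correlation n (y / p) (y′ / p)))) (ℤₚ.pos-* n (correlation n y y′))))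
    identity : ∀ d a t₁ t₂ t₃ t₄ t₅ t₆ t₇ m c₁ c₂ c₄ c₆ → let P = pos 1 +ᶻ a in
      d *ᶻ (a *ᶻ a *ᶻ t₁ +ᶻ (a *ᶻ t₂ +ᶻ (-ᶻ (a *ᶻ P) *ᶻ t₃ +ᶻ (a *ᶻ t₄ +ᶻ (-ᶻ (a *ᶻ P) *ᶻ t₅
        +ᶻ ((P *ᶻ P -ᶻ pos 2 *ᶻ P) *ᶻ t₇ +ᶻ t₆)))))) -ᶻ m *ᶻ (a *ᶻ (a *ᶻ c₁ +ᶻ c₆))
      ≡ a *ᶻ a *ᶻ (d *ᶻ t₁ -ᶻ m *ᶻ c₁) +ᶻ a *ᶻ (d *ᶻ t₂ -ᶻ m *ᶻ c₂) +ᶻ -ᶻ a *ᶻ (d *ᶻ P *ᶻ t₃ -ᶻ m *ᶻ c₂)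
        +ᶻ a *ᶻ (d *ᶻ t₄ -ᶻ m *ᶻ c₄) +ᶻ -ᶻ a *ᶻ (d *ᶻ P *ᶻ t₅ -ᶻ m *ᶻ c₄)
        +ᶻ (a -ᶻ pos 1) *ᶻ (d *ᶻ P *ᶻ t₇ -ᶻ m *ᶻ c₆) +ᶻ (d *ᶻ t₆ -ᶻ m *ᶻ c₆)
    identity = ℤSolver.solve-∀

  -- Triangle inequality. The mixed terms fit exactly; `q * q′` has coefficient p^2 + 1 against (p +
  -- 1)^2, which explains the added slack `2 * p`.
  error≤-step : ∀ n d {s s′ q q′} {e₁ e₂ e₃ e₄ e₅ e₆ e₇ : ℤ} → let p = suc n; a = pos n in
    ∣ e₁ ∣ ≤ E * d * (s * s′) → ∣ e₂ ∣ ≤ E * d * (s * q′) → ∣ e₃ ∣ ≤ E * (d * p) * (s * q′) →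
    ∣ e₄ ∣ ≤ E * d * (q * s′) → ∣ e₅ ∣ ≤ E * (d * p) * (q * s′) →
    ∣ e₆ ∣ ≤ E * d * (q * q′) → ∣ e₇ ∣ ≤ E * (d * p) * (q * q′) →
    ∣ a *ᶻ a *ᶻ e₁ +ᶻ a *ᶻ e₂ +ᶻ -ᶻ a *ᶻ e₃ +ᶻ a *ᶻ e₄ +ᶻ -ᶻ a *ᶻ e₅ +ᶻ (a -ᶻ pos 1) *ᶻ e₇ +ᶻ e₆ ∣
      ≤ E * d * ((n * s + suc p * q) * (n * s′ + suc p * q′))
  error≤-step n d {s} {s′} {q} {q′} {e₁} {e₂} {e₃} {e₄} {e₅} {e₆} {e₇} b₁ b₂ b₃ b₄ b₅ b₆ b₇ = begin
    ∣ a *ᶻ a *ᶻ e₁ +ᶻ a *ᶻ e₂ +ᶻ -ᶻ a *ᶻ e₃ +ᶻ a *ᶻ e₄ +ᶻ -ᶻ a *ᶻ e₅ +ᶻ (a -ᶻ pos 1) *ᶻ e₇ +ᶻ e₆ ∣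
      ≤⟨ Bounded.bound $ ∣+∣≤ (∣+∣≤ (∣+∣≤ (∣+∣≤ (∣+∣≤ (∣+∣≤
           (∣*∣≤ {a *ᶻ a} {e₁} (≤-reflexive (ℤₚ.∣i*j∣≡∣i∣*∣j∣ a a)) b₁) (∣*∣≤ {a} {e₂} ≤-refl b₂))
           (∣*∣≤ { -ᶻ a} {e₃} (≤-reflexive (ℤₚ.∣-i∣≡∣i∣ a)) b₃)) (∣*∣≤ {a} {e₄} ≤-refl b₄))
           (∣*∣≤ { -ᶻ a} {e₅} (≤-reflexive (ℤₚ.∣-i∣≡∣i∣ a)) b₅))
           (∣*∣≤ {a -ᶻ pos 1} {e₇} (ℤₚ.∣i-j∣≤∣i∣+∣j∣ a (pos 1)) b₇)) (bounded b₆) ⟩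
    n * n * (E * d * (s * s′)) + n * (E * d * (s * q′)) + n * (E * (d * p) * (s * q′))
      + n * (E * d * (q * s′)) + n * (E * (d * p) * (q * s′)) + (n + 1) * (E * (d * p) * (q * q′)) + E * d * (q * q′)
      ≤⟨ m≤m+n _ (E * d * (2 * p) * (q * q′)) ⟩
    n * n * (E * d * (s * s′)) + n * (E * d * (s * q′)) + n * (E * (d * p) * (s * q′))
      + n * (E * d * (q * s′)) + n * (E * (d * p) * (q * s′)) + (n + 1) * (E * (d * p) * (q * q′)) + E * d * (q * q′)
      + E * d * (2 * p) * (q * q′)
      ≡⟨ identity E d n s s′ q q′ ⟩
    E * d * ((n * s + suc p * q) * (n * s′ + suc p * q′)) ∎
    where
    open ≤-Reasoning
    p : ℕ
    p = suc n
    a : ℤ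
    a = pos n
    record Bounded (i : ℤ) (b : ℕ) : Set where
      eta-equality
      constructor bounded
      field bound : ∣ i ∣ ≤ b
    ∣+∣≤ : ∀ {i j b c} → Bounded i b → Bounded j c → Bounded (i +ᶻ j) (b + c)
    ∣+∣≤ {i} {j} (bounded ib) (bounded jc) = bounded $ ≤-trans (ℤₚ.∣i+j∣≤∣i∣+∣j∣ i j) (+-mono-≤ ib jc)
    ∣*∣≤ : ∀ {i j b c} → ∣ i ∣ ≤ b → ∣ j ∣ ≤ c → Bounded (i *ᶻ j) (b * c)
    ∣*∣≤ {i} {j} ib jc = bounded $ ≤-trans (≤-reflexive (ℤₚ.∣i*j∣≡∣i∣*∣j∣ i j)) (*-mono-≤ ib jc)
    identity : ∀ E d n s s′ q q′ →
      n * n * (E * d * (s * s′)) + n * (E * d * (s * q′)) + n * (E * (d * suc n) * (s * q′))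
      + n * (E * d * (q * s′)) + n * (E * (d * suc n) * (q * s′)) + (n + 1) * (E * (d * suc n) * (q * q′)) + E * d * (q * q′)
      + E * d * (2 * suc n) * (q * q′)
      ≡ E * d * ((n * s + suc (suc n) * q) * (n * s′ + suc (suc n) * q′))
    identity = solve-∀

  -- Induction removing the largest prime. Each step may pass from `δ` to `δ * p`, so the claim is
  -- made for all odd `δ` free of the primes that remain; with none left it is the hypothesis on
  -- `h`.
  error≤ : ∀ n δ .{{_ : NonZero δ}} → Odd δ → Free n δ → ∀ y y′ → ∣ error n δ y y′ ∣ ≤ E * δ * (size n y * size n y′)
  error≤ zero    δ odd free y y′ = base
    where
    S = ∑ X (λ m → ⟦ δ ∣? m ⟧ * h m)
    c = signum y * signum y′
    base : ∣ error zero δ y y′ ∣ ≤ E * δ * c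
    base = begin
      ∣ error zero δ y y′ ∣
        ≡⟨ cong ∣_∣ (cong₂ _-ᶻ_ (trans (cong (pos δ *ᶻ_) moment₀) (trans (sym (ℤₚ.pos-* δ (c * S))) (cong pos (swap δ c S)))) (trans (sym (ℤₚ.pos-* M c)) (cong pos (*-comm M c)))) ⟩
      ∣ pos (c * (δ * S)) -ᶻ pos (c * M) ∣
        ≤⟨ ∣-∣≤ (c * (δ * S)) (c * M) (E * δ * c)
             (≤-trans (*-monoʳ-≤ c (upper δ odd)) (≤-reflexive (dist c M (E * δ))))
             (≤-trans (*-monoʳ-≤ c (lower δ odd)) (≤-reflexive (dist c (δ * S) (E * δ)))) ⟩
      E * δ * c ∎
      where
      open ≤-Reasoning
      swap : ∀ a b c → a * (b * c) ≡ b * (a * c)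
      swap = solve-∀
      dist : ∀ c a b → c * (a + b) ≡ c * a + b * c
      dist = solve-∀
      moment₀ : moment zero δ y y′ ≡ pos (c * S)
      moment₀ = trans (∑ᶻ-cong X (λ m _ → trans (cong (pos (⟦ δ ∣? m ⟧ * h m) *ᶻ_) (sym (ℤₚ.pos-* (signum y) (signum y′))))
                         (trans (ℤₚ.*-comm (pos (⟦ δ ∣? m ⟧ * h m)) (pos c)) (sym (ℤₚ.pos-* c (⟦ δ ∣? m ⟧ * h m))))))
                (trans (∑ᶻ-pos X (λ m → c * (⟦ δ ∣? m ⟧ * h m))) (cong pos (∑-*ˡ X c (λ m → ⟦ δ ∣? m ⟧ * h m))))
  error≤ (suc n) δ odd free y y′ = by-cases (oddPrime? (suc n))
    where
    p = suc n
    Q = λ y y′ → ∣ error (suc n) δ y y′ ∣ ≤ E * δ * (size (suc n) y * size (suc n) y′)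
    free′ : Free n δ
    free′ q q≤n = free q (m≤n⇒m≤1+n q≤n)
    by-cases : Dec (OddPrime (suc n)) → Q y y′
    by-cases (no ¬op) = subst₂ (λ e t → ∣ e ∣ ≤ E * δ * t)
      (sym (cong₂ (λ t c → pos δ *ᶻ t -ᶻ pos M *ᶻ pos c)
        (∑ᶻ-cong X λ m _ → cong (pos (⟦ δ ∣? m ⟧ * h m) *ᶻ_) (cong₂ _*ᶻ_ (weight-¬oddPrime n y m ¬op) (weight-¬oddPrime n y′ m ¬op)))
        (correlation-¬oddPrime n y y′ ¬op)))
      (sym (cong₂ _*_ (size-¬oddPrime n y ¬op) (size-¬oddPrime n y′ ¬op)))
      (error≤ n δ odd free′ y y′)
    by-cases (yes op) = subst₂ (λ e t → ∣ e ∣ ≤ E * δ * t)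
          (sym (error-step n δ y y′ op (prime∤⇒coprime (proj₁ op) (free p ≤-refl op))))
          (sym (cong₂ _*_ (size-oddPrime n y op) (size-oddPrime n y′ op)))
          (error≤-step n δ {size n y} {size n y′} {size n (y / p)} {size n (y′ / p)}
            {error n δ y y′} {error n δ y (y′ / p)} {error n (δ * p) y (y′ / p)} {error n δ (y / p) y′}
            {error n (δ * p) (y / p) y′} {error n δ (y / p) (y′ / p)} {error n (δ * p) (y / p) (y′ / p)}
            (error≤ n δ odd free′ y y′) (error≤ n δ odd free′ y (y′ / p)) (error≤ n (δ * p) {{nz}} odd-δp free-δp y (y′ / p))
            (error≤ n δ odd free′ (y / p) y′) (error≤ n (δ * p) {{nz}} odd-δp free-δp (y / p) y′)
            (error≤ n δ odd free′ (y / p) (y′ / p)) (error≤ n (δ * p) {{nz}} odd-δp free-δp (y / p) (y′ / p)))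
      where
      nz : NonZero (δ * p)
      nz = m*n≢0 δ p
      odd-δp : Odd (δ * p)
      odd-δp 2∣δp with euclidsLemma δ p prime[2] 2∣δp
      ... | inj₁ 2∣δ = odd 2∣δ
      ... | inj₂ 2∣p with prime⇒irreducible (proj₁ op) 2∣p
      ... | inj₁ ()
      ... | inj₂ 2≡p = proj₂ op (sym 2≡p)
      free-δp : Free n (δ * p)
      free-δp q q≤n oq q∣δp with euclidsLemma δ p (proj₁ oq) q∣δp
      ... | inj₁ q∣δ = free′ q q≤n oq q∣δ
      ... | inj₂ q∣p with prime⇒irreducible (proj₁ op) q∣p
      ... | inj₁ refl = ¬prime[1] (proj₁ oq)
      ... | inj₂ refl = <-irrefl refl q≤n

  second-moment : ∀ n y → ∑ X (λ m → h m * (∣ weight n y m ∣ * ∣ weight n y m ∣)) ≤ M * (φ n * gain n y) + E * (size n y * size n y)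
  second-moment n y = begin
    S                        ≤⟨ ≤+∣-∣ S (M * correlation n y y) ⟩
    M * correlation n y y + ∣ pos S -ᶻ pos (M * correlation n y y) ∣
                             ≤⟨ +-mono-≤ (≤-reflexive (cong (M *_) (correlation-diagonal n y)))
                                  (subst₂ (λ e t → ∣ e ∣ ≤ t * (size n y * size n y)) error≡ (*-identityʳ E) (error≤ n 1 odd₁ free₁ y y)) ⟩
    M * (φ n * gain n y) + E * (size n y * size n y) ∎
    where
    open ≤-Reasoning
    S = ∑ X (λ m → h m * (∣ weight n y m ∣ * ∣ weight n y m ∣))
    odd₁ : Odd 1
    odd₁ (divides zero ())
    odd₁ (divides (suc q) ())
    free₁ : Free n 1
    free₁ q _ oq q∣1 = ¬prime[1] (subst Prime (∣1⇒≡1 q∣1) (proj₁ oq))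
    moment₁ : moment n 1 y y ≡ pos S
    moment₁ = trans (∑ᶻ-cong X (λ m _ → trans (cong₂ _*ᶻ_ (cong pos (trans (cong (_* h m) (⟦⟧-yes (1 ∣? m) (1∣ m))) (*-identityˡ (h m))))
        (sym (∣∣*∣∣ (weight n y m)))) (sym (ℤₚ.pos-* (h m) _)))) (∑ᶻ-pos X _)
    error≡ : error n 1 y y ≡ pos S -ᶻ pos (M * correlation n y y)
    error≡ = cong₂ _-ᶻ_ (trans (ℤₚ.*-identityˡ (moment n 1 y y)) moment₁) (sym (ℤₚ.pos-* M (correlation n y y)))

-- Harmonic sums over smooth numbers

-- Oddness is built in, to match the sifting primes. The bound `q < suc m` excludes no divisor of a
-- positive `m` and makes the condition decidable.
Smooth : ℕ → ℕ → Set
Smooth n m = 0 < m × (∀ {q} → q < suc m → q ∣ m → Prime q → q ≢ 2 × q ≤ n)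

smooth? : ∀ n m → Dec (Smooth n m)
smooth? n m = (0 <? m) ×-dec
  allUpTo? (λ q → (q ∣? m) →-dec (prime? q →-dec (¬? (q ≟ 2) ×-dec (q ≤? n)))) (suc m)

smooth-pred : ∀ {n m} → ¬ (OddPrime (suc n) × suc n ∣ m) → Smooth (suc n) m → Smooth n m
smooth-pred ¬div (0<m , sm) = 0<m , λ q<1+m q∣m pq → let q≢2 , q≤1+n = sm q<1+m q∣m pq in
  q≢2 , ≤-pred (≤∧≢⇒< q≤1+n λ { refl → ¬div ((pq , q≢2) , q∣m) })

smooth-∣ : ∀ {n m k} → 0 < k → k ∣ m → Smooth n m → Smooth n k
smooth-∣ {m = suc _} 0<k k∣m (_ , sm) = 0<k , λ q<1+k q∣k →
  sm (<-≤-trans q<1+k (s≤s (∣⇒≤ k∣m))) (∣-trans q∣k k∣m)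

smooth-odd : ∀ {n m} → 0 < m → m ≤ n → Odd m → Smooth n m
smooth-odd 0<m m≤n odd = 0<m , λ q<1+m q∣m pq → (λ { refl → odd q∣m }) , ≤-trans (≤-pred q<1+m) m≤n

smooth-0 : ∀ {m} → Smooth 0 m → m ≡ 1
smooth-0 {suc m} (_ , sm) with factorise (suc m)
... | record { factors = [] ; isFactorisation = eq } = eq
... | record { factors = q ∷ qs ; isFactorisation = eq ; factorsPrime = pq ∷ _ }
  with sm {q} (s≤s (∣⇒≤ (subst (q ∣_) (sym eq) (m∣m*n _)))) (subst (q ∣_) (sym eq) (m∣m*n _)) pq
... | _ , z≤n = contradiction pq λ ()

m≤n⇒m≤o : ∀ m n {o} .{{_ : NonZero n}} → n * m ≤ o → m ≤ o / n
m≤n⇒m≤o m n {o} nm≤o = ≤-trans (≤-reflexive (sym (m*n/n≡m m n))) (/-monoˡ-≤ n (≤-trans (≤-reflexive (*-comm m n)) nm≤o))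

-- u m stands for U / m, so that the partial sums below are those of the harmonic series over smooth numbers.
module Harmonic (N U : ℕ) (u : ℕ → ℕ) (mu≡U : ∀ m → 0 < m → m ≤ N → m * u m ≡ U) where

  term : ℕ → ℕ → ℕ
  term n m = ⟦ smooth? n m ⟧ * u m

  harmonic : ℕ → ℕ → ℕ
  harmonic n y = ∑ (suc y) (term n)

  term-mono : ∀ {n n′ m} → (Smooth n m → Smooth n′ m) → term n m ≤ term n′ m
  term-mono {n} {n′} {m} f with smooth? n m
  ... | no _   = z≤n
  ... | yes sm = ≤-reflexive (cong (_* u m) (sym (⟦⟧-yes (smooth? n′ m) (f sm))))

  term-multiple : ∀ p n t .{{_ : NonZero p}} → p * t ≤ N → p * term n (p * t) ≤ term n t
  term-multiple p n t pt≤N with smooth? n (p * t)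
  ... | no _ = subst (_≤ term n t) (sym (*-zeroʳ p)) z≤n
  ... | yes sm = ≤-reflexive (begin
    p * (1 * u (p * t))     ≡⟨ cong (p *_) (*-identityˡ _) ⟩
    p * u (p * t)           ≡⟨ *-cancelˡ-≡ _ _ t {{nz}} scaled ⟩
    u t                     ≡⟨ *-identityˡ (u t) ⟨
    1 * u t                 ≡⟨ cong (_* u t) (⟦⟧-yes (smooth? n t) (smooth-∣ 0<t (n∣m*n p) sm)) ⟨
    ⟦ smooth? n t ⟧ * u t   ∎)
    where
    open ≡-Reasoning
    0<t : 0 < t
    0<t = n≢0⇒n>0 λ { refl → <-irrefl (sym (*-zeroʳ p)) (proj₁ sm) }
    nz : NonZero t
    nz = >-nonZero 0<t
    scaled : t * (p * u (p * t)) ≡ t * u t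
    scaled = begin
      t * (p * u (p * t))   ≡⟨ *-assoc t p _ ⟨
      t * p * u (p * t)     ≡⟨ cong (_* u (p * t)) (*-comm t p) ⟩
      p * t * u (p * t)     ≡⟨ mu≡U (p * t) (proj₁ sm) pt≤N ⟩
      U                     ≡⟨ mu≡U t 0<t (≤-trans (m≤n*m t p) pt≤N) ⟨
      t * u t               ∎

  harmonic-mono : ∀ n {y y′} → y ≤ y′ → harmonic n y ≤ harmonic n y′
  harmonic-mono n y≤y′ = ∑-monoˡ (term n) (s≤s y≤y′)

  -- A number counted on the left is either prime to p, hence already `n`-smooth, or p t with t up
  -- to `y / p` again smooth.
  sieve-prime : ∀ n y → OddPrime (suc n) → y ≤ N → let p = suc n in
    p * harmonic p y ≤ p * harmonic n y + harmonic p (y / p)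
  sieve-prime n y op y≤N = begin
    p * harmonic p y                                                ≤⟨ *-monoʳ-≤ p (∑-mono (suc y) split) ⟩
    p * ∑ (suc y) (λ m → term n m + ⟦ p ∣? m ⟧ * term p m)          ≡⟨ cong (p *_) (∑-distrib (suc y) (term n) _) ⟩
    p * (harmonic n y + ∑ (suc y) (λ m → ⟦ p ∣? m ⟧ * term p m))    ≡⟨ *-distribˡ-+ p (harmonic n y) _ ⟩
    p * harmonic n y + p * ∑ (suc y) (λ m → ⟦ p ∣? m ⟧ * term p m)  ≤⟨ +-monoʳ-≤ (p * harmonic n y) divisible ⟩
    p * harmonic n y + harmonic p (y / p)                           ∎
    where
    open ≤-Reasoning
    p c : ℕ
    p = suc n
    c = multiples p (suc y)
    split : ∀ m → m < suc y → term p m ≤ term n m + ⟦ p ∣? m ⟧ * term p m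
    split m _ with p ∣? m
    ... | yes p∣m = ≤-trans (≤-reflexive (sym (*-identityˡ (term p m)))) (m≤n+m _ (term n m))
    ... | no p∤m  = ≤-trans (term-mono {p} {n} (smooth-pred (p∤m ∘ proj₂))) (m≤m+n _ _)
    below : ∀ t → t < c → p * t ≤ y
    below t t<c = ≤-pred (+-cancelˡ-< p _ _ (begin-strict
      p + p * t    ≡⟨ *-suc p t ⟨
      p * suc t    ≤⟨ *-monoʳ-≤ p t<c ⟩
      p * c        <⟨ proj₂ (multiples-bounds p (suc y)) ⟩
      suc y + p    ≡⟨ +-comm (suc y) p ⟩
      p + suc y    ∎))
    c≤ : c ≤ suc (y / p)
    c≤ = ≮⇒≥ λ 1+y/p<c → <-irrefl refl (m≤n⇒m≤o (suc (y / p)) p (below (suc (y / p)) 1+y/p<c))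
    divisible : p * ∑ (suc y) (λ m → ⟦ p ∣? m ⟧ * term p m) ≤ harmonic p (y / p)
    divisible = begin
      p * ∑ (suc y) (λ m → ⟦ p ∣? m ⟧ * term p m)  ≡⟨ cong (p *_) (∑-multiples p (suc y) (term p)) ⟩
      p * ∑ c (λ t → term p (p * t))               ≡⟨ ∑-*ˡ c p _ ⟨
      ∑ c (λ t → p * term p (p * t))               ≤⟨ ∑-mono c (λ t t<c → term-multiple p p t (≤-trans (below t t<c) y≤N)) ⟩
      ∑ c (term p)                                 ≤⟨ ∑-monoˡ (term p) c≤ ⟩
      harmonic p (y / p)                           ∎

  -- The factor 1/(p-1) is the geometric series of the powers of 1/p. It is summed by using
  -- `sieve-prime` once more at `y / p` and bounding `harmonic p (y / p / p)` by
  -- `harmonic p (y / p)`.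
  harmonic-oddPrime : ∀ n y → OddPrime (suc n) → y ≤ N →
    n * harmonic (suc n) y ≤ n * harmonic n y + harmonic n (y / suc n)
  harmonic-oddPrime n y op y≤N = *-cancelˡ-≤ p (begin
    p * (n * harmonic p y)                              ≡⟨ swap p n _ ⟩
    n * (p * harmonic p y)                              ≤⟨ *-monoʳ-≤ n (sieve-prime n y op y≤N) ⟩
    n * (p * harmonic n y + harmonic p (y / p))         ≡⟨ *-distribˡ-+ n _ _ ⟩
    n * (p * harmonic n y) + n * harmonic p (y / p)     ≤⟨ +-mono-≤ (≤-reflexive (swap n p _)) absorbed ⟩
    p * (n * harmonic n y) + p * harmonic n (y / p)     ≡⟨ *-distribˡ-+ p (n * harmonic n y) _ ⟨
    p * (n * harmonic n y + harmonic n (y / p))         ∎)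
    where
    open ≤-Reasoning
    p : ℕ
    p = suc n
    swap : ∀ a b c → a * (b * c) ≡ b * (a * c)
    swap = solve-∀
    absorbed : n * harmonic p (y / p) ≤ p * harmonic n (y / p)
    absorbed = +-cancelˡ-≤ (harmonic p (y / p)) _ _ (begin
      p * harmonic p (y / p)                                  ≤⟨ sieve-prime n (y / p) op (≤-trans (m/n≤m y p) y≤N) ⟩
      p * harmonic n (y / p) + harmonic p (y / p / p)         ≤⟨ +-monoʳ-≤ (p * harmonic n (y / p)) (harmonic-mono p (m/n≤m (y / p) p)) ⟩
      p * harmonic n (y / p) + harmonic p (y / p)             ≡⟨ +-comm (p * harmonic n (y / p)) _ ⟩
      harmonic p (y / p) + p * harmonic n (y / p)             ∎)

  harmonic-0 : 0 < N → ∀ y → harmonic 0 y ≤ U * signum y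
  harmonic-0 0<N zero    = z≤n
  harmonic-0 0<N (suc y) = begin
    ∑ (suc (suc y)) (term 0)                          ≡⟨ ∑-front (suc y) (term 0) ⟩
    0 + ∑ (suc y) (term 0 ∘ suc)                      ≡⟨ ∑-front y (term 0 ∘ suc) ⟩
    term 0 1 + ∑ y (term 0 ∘ suc ∘ suc)               ≡⟨ cong (term 0 1 +_) (∑-cong y λ i _ →
                                                           cong (_* u (2 + i)) (⟦⟧-no (smooth? 0 (2 + i)) λ sm → contradiction (smooth-0 sm) λ ())) ⟩
    term 0 1 + ∑ y (λ _ → 0)                          ≡⟨ cong (term 0 1 +_) (∑-zero y) ⟩
    term 0 1 + 0                                      ≡⟨ +-identityʳ _ ⟩
    term 0 1                                          ≤⟨ *-monoˡ-≤ (u 1) (⟦⟧≤1 (smooth? 0 1)) ⟩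
    1 * u 1                                           ≡⟨ mu≡U 1 z<s 0<N ⟩
    U                                                 ≡⟨ *-identityʳ U ⟨
    U * 1                                             ∎
    where open ≤-Reasoning

  -- The classical bound behind Selberg's sieve: 1 over the totient of d is the sum of 1/m over all
  -- m with the same prime factors as d, and every m ≤ y occurs because its squarefree kernel is at
  -- most y. Here it is proved prime by prime.
  gain≥harmonic : 0 < N → ∀ n y → y ≤ N → φ n * harmonic n y ≤ U * gain n y
  gain≥harmonic 0<N zero    y y≤N = ≤-trans (≤-reflexive (*-identityˡ _)) (harmonic-0 0<N y)
  gain≥harmonic 0<N (suc n) y y≤N = by-cases (oddPrime? (suc n))
    where
    open ≤-Reasoning
    p : ℕ
    p = suc n
    by-cases : Dec (OddPrime p) → φ p * harmonic p y ≤ U * gain p y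
    by-cases (no ¬op) = begin
      φ p * harmonic p y    ≤⟨ *-mono-≤ (≤-reflexive (φ-¬oddPrime n ¬op)) (∑-mono (suc y) λ m _ → term-mono {p} {n} {m} (smooth-pred (¬op ∘ proj₁))) ⟩
      φ n * harmonic n y    ≤⟨ gain≥harmonic 0<N n y y≤N ⟩
      U * gain n y          ≡⟨ cong (U *_) (gain-¬oddPrime n y ¬op) ⟨
      U * gain p y          ∎
    by-cases (yes op) = begin
      φ p * harmonic p y                                       ≡⟨ cong (_* harmonic p y) (φ-oddPrime n op) ⟩
      n * φ n * harmonic p y                                   ≡⟨ reorder n (φ n) _ ⟩
      φ n * (n * harmonic p y)                                 ≤⟨ *-monoʳ-≤ (φ n) (harmonic-oddPrime n y op y≤N) ⟩
      φ n * (n * harmonic n y + harmonic n (y / p))            ≡⟨ distribute n (φ n) (harmonic n y) _ ⟩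
      n * (φ n * harmonic n y) + φ n * harmonic n (y / p)      ≤⟨ +-mono-≤ (*-monoʳ-≤ n (gain≥harmonic 0<N n y y≤N))
                                                                   (gain≥harmonic 0<N n (y / p) (≤-trans (m/n≤m y p) y≤N)) ⟩
      n * (U * gain n y) + U * gain n (y / p)                  ≡⟨ distribute n U (gain n y) _ ⟨
      U * (n * gain n y + gain n (y / p))                      ≡⟨ cong (U *_) (gain-oddPrime n y op) ⟨
      U * gain p y                                             ∎
      where
      reorder : ∀ n f h → n * f * h ≡ f * (n * h)
      reorder = solve-∀
      distribute : ∀ n f g h → f * (n * g + h) ≡ n * (f * g) + f * h
      distribute = solve-∀

  -- Oresme's argument: the terms from `K + 1` to `2 * K` add up to at least half of `U`.
  double-interval : ∀ s → 2 ^ s ≤ N → U * s ≤ 2 * ∑ (2 ^ s) (u ∘ suc)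
  double-interval zero    _   = ≤-trans (≤-reflexive (*-zeroʳ U)) z≤n
  double-interval (suc s) K≤N = begin
    U * suc s                                                ≡⟨ *-suc U s ⟩
    U + U * s                                                ≤⟨ +-mono-≤ upper-half (double-interval s (≤-trans (m≤m+n K _) K≤N)) ⟩
    2 * ∑ K (λ i → u (suc (K + i))) + 2 * ∑ K (u ∘ suc)      ≡⟨ *-distribˡ-+ 2 (∑ K (λ i → u (suc (K + i)))) _ ⟨
    2 * (∑ K (λ i → u (suc (K + i))) + ∑ K (u ∘ suc))        ≡⟨ cong (2 *_) (+-comm (∑ K (λ i → u (suc (K + i)))) _) ⟩
    2 * (∑ K (u ∘ suc) + ∑ K (λ i → u (suc (K + i))))        ≡⟨ cong (2 *_) (∑-split K K (u ∘ suc)) ⟨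
    2 * ∑ (K + K) (u ∘ suc)                                  ≡⟨ cong (λ t → 2 * ∑ (K + t) (u ∘ suc)) (+-identityʳ K) ⟨
    2 * ∑ (2 ^ suc s) (u ∘ suc)                              ∎
    where
    open ≤-Reasoning
    K : ℕ
    K = 2 ^ s
    instance
      K≢0 : NonZero K
      K≢0 = m^n≢0 2 s
    upper-half : U ≤ 2 * ∑ K (λ i → u (suc (K + i)))
    upper-half = *-cancelˡ-≤ K (begin
      K * U                                              ≡⟨ ∑-const K U ⟨
      ∑ K (λ _ → U)                                      ≤⟨ ∑-mono K (λ i i<K → ≤-trans
                                                              (≤-reflexive (sym (mu≡U (suc (K + i)) z<s (≤-trans (+-monoʳ-< K i<K) (≤-trans (≤-reflexive (cong (K +_) (sym (+-identityʳ K)))) K≤N)))))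
                                                              (*-monoˡ-≤ (u (suc (K + i))) (≤-trans (+-monoʳ-< K i<K) (≤-reflexive (cong (K +_) (sym (+-identityʳ K))))))) ⟩
      ∑ K (λ i → 2 * K * u (suc (K + i)))                ≡⟨ ∑-*ˡ K (2 * K) (λ i → u (suc (K + i))) ⟩
      2 * K * ∑ K (λ i → u (suc (K + i)))                ≡⟨ cong (_* ∑ K (λ i → u (suc (K + i)))) (*-comm 2 K) ⟩
      K * 2 * ∑ K (λ i → u (suc (K + i)))                ≡⟨ *-assoc K 2 _ ⟩
      K * (2 * ∑ K (λ i → u (suc (K + i))))              ∎)

  -- Restricting to odd numbers costs a factor 2: `suc i` is compared with the odd number 2 i + 1,
  -- which is at most 2 (i + 1).
  odd-half : ∀ K → K * 2 ≤ N → ∑ K (u ∘ suc) ≤ 2 * harmonic (K * 2) (K * 2)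
  odd-half K 2K≤N = begin
    ∑ K (u ∘ suc)                                             ≤⟨ ∑-mono K pairwise ⟩
    ∑ K (λ i → 2 * ∑ 2 (λ j → term (K * 2) (i * 2 + j)))      ≡⟨ ∑-*ˡ K 2 _ ⟩
    2 * ∑ K (λ i → ∑ 2 (λ j → term (K * 2) (i * 2 + j)))      ≡⟨ cong (2 *_) (∑-block K 2 (term (K * 2))) ⟨
    2 * ∑ (K * 2) (term (K * 2))                              ≤⟨ *-monoʳ-≤ 2 (∑-monoˡ (term (K * 2)) (n≤1+n (K * 2))) ⟩
    2 * harmonic (K * 2) (K * 2)                              ∎
    where
    open ≤-Reasoning
    pairwise : ∀ i → i < K → u (suc i) ≤ 2 * ∑ 2 (λ j → term (K * 2) (i * 2 + j))
    pairwise i i<K = begin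
      u (suc i)                                       ≤⟨ *-cancelˡ-≤ {u (suc i)} {2 * u m} (suc i) scaled ⟩
      2 * u m                                         ≡⟨ cong (2 *_) (trans (cong (_* u m) (⟦⟧-yes (smooth? (K * 2) m) (smooth-odd 0<m m≤ odd))) (*-identityˡ (u m))) ⟨
      2 * term (K * 2) m                              ≤⟨ *-monoʳ-≤ 2 (m≤n+m (term (K * 2) m) (term (K * 2) (i * 2 + 0))) ⟩
      2 * ∑ 2 (λ j → term (K * 2) (i * 2 + j))        ∎
      where
      m : ℕ
      m = i * 2 + 1
      0<m : 0 < m
      0<m = m≤n+m 1 (i * 2)
      m≤ : m ≤ K * 2
      m≤ = ≤-trans (≤-reflexive (+-comm (i * 2) 1)) (≤-trans (n≤1+n _) (*-monoˡ-≤ 2 i<K))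
      odd : Odd m
      odd 2∣m with ∣1⇒≡1 (∣m+n∣m⇒∣n 2∣m (n∣m*n i))
      ... | ()
      scaled : suc i * u (suc i) ≤ suc i * (2 * u m)
      scaled = begin
        suc i * u (suc i)      ≡⟨ mu≡U (suc i) z<s (≤-trans i<K (≤-trans (m≤m*n K 2) 2K≤N)) ⟩
        U                      ≡⟨ mu≡U m 0<m (≤-trans m≤ 2K≤N) ⟨
        m * u m                ≤⟨ *-monoˡ-≤ (u m) (≤-trans (≤-reflexive (+-comm (i * 2) 1)) (n≤1+n _)) ⟩
        suc i * 2 * u m        ≡⟨ *-assoc (suc i) 2 (u m) ⟩
        suc i * (2 * u m)      ∎

-- `z !` serves as common multiple of all m ≤ z. One factor 2 is lost in `double-interval`, the
-- other in `odd-half`.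
gain-large : ∀ s → φ (2 ^ suc s) * s ≤ 4 * gain (2 ^ suc s) (2 ^ suc s)
gain-large s = *-cancelˡ-≤ (z !) {{z !≢0}} (begin
  z ! * (φ z * s)                  ≡⟨ swap (z !) (φ z) s ⟩
  φ z * (z ! * s)                  ≤⟨ *-monoʳ-≤ (φ z) (double-interval s (m≤m+n K _)) ⟩
  φ z * (2 * ∑ K (u ∘ suc))        ≤⟨ *-monoʳ-≤ (φ z) (*-monoʳ-≤ 2 (odd-half K (≤-reflexive (*-comm K 2)))) ⟩
  φ z * (2 * (2 * harmonic (K * 2) (K * 2)))    ≡⟨ cong (λ t → φ z * (2 * (2 * harmonic t t))) (*-comm K 2) ⟩
  φ z * (2 * (2 * harmonic z z))   ≡⟨ four (φ z) (harmonic z z) ⟩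
  4 * (φ z * harmonic z z)         ≤⟨ *-monoʳ-≤ 4 (gain≥harmonic (m^n>0 2 (suc s)) z z ≤-refl) ⟩
  4 * (z ! * gain z z)             ≡⟨ swap 4 (z !) (gain z z) ⟩
  z ! * (4 * gain z z)             ∎)
  where
  open ≤-Reasoning
  z K : ℕ
  z = 2 ^ suc s
  K = 2 ^ s
  swap : ∀ a b c → a * (b * c) ≡ b * (a * c)
  swap = solve-∀
  four : ∀ a b → a * (2 * (2 * b)) ≡ 4 * (a * b)
  four = solve-∀
  u : ℕ → ℕ
  u zero    = 0
  u (suc m) = z ! / suc m
  mu≡U : ∀ m → 0 < m → m ≤ z → m * u m ≡ z !
  mu≡U (suc m) _ m≤z = m*[n/m]≡n (∣-trans (m∣m*n (m !)) (m≤n⇒m!∣n! m≤z))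
  open Harmonic z (z !) u mu≡U

-- The sieve inequality

φ>0 : ∀ n → 0 < φ n
φ>0 zero    = z<s
φ>0 (suc n) with oddPrime? (suc n)
... | no _   = φ>0 n
... | yes op with k , refl ← oddPrime⇒≥3 op = *-mono-≤ {1} {suc (suc k)} (s≤s z≤n) (φ>0 n)

∑-initial : ∀ X z → ∑ X (λ m → ⟦ m ≤? z ⟧) ≤ suc z
∑-initial X z with ≤-total X (suc z)
... | inj₁ X≤ = ≤-trans (∑-mono X λ m _ → ⟦⟧≤1 (m ≤? z)) (≤-trans (≤-reflexive (trans (∑-const X 1) (*-identityʳ X))) X≤)
... | inj₂ z<X with o , refl ← m≤n⇒∃[o]m+o≡n z<X = begin
  ∑ (suc z + o) (λ m → ⟦ m ≤? z ⟧)                                     ≡⟨ ∑-split (suc z) o _ ⟩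
  ∑ (suc z) (λ m → ⟦ m ≤? z ⟧) + ∑ o (λ i → ⟦ suc z + i ≤? z ⟧)        ≤⟨ +-mono-≤ (∑-mono (suc z) λ m _ → ⟦⟧≤1 (m ≤? z))
                                                                         (≤-reflexive (∑-cong o λ i _ → ⟦⟧-no (suc z + i ≤? z) (<⇒≱ (m≤m+n (suc z) i)))) ⟩
  ∑ (suc z) (λ _ → 1) + ∑ o (λ _ → 0)                                  ≡⟨ cong₂ _+_ (trans (∑-const (suc z) 1) (*-identityʳ (suc z))) (∑-zero o) ⟩
  suc z + 0                                                            ≡⟨ +-identityʳ (suc z) ⟩
  suc z                                                                ∎
  where open ≤-Reasoning

module Conclusion (X M E : ℕ) (h : ℕ → ℕ)
  (upper : ∀ δ .{{_ : NonZero δ}} → Odd δ → δ * ∑ X (λ m → ⟦ δ ∣? m ⟧ * h m) ≤ M + E * δ)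
  (lower : ∀ δ .{{_ : NonZero δ}} → Odd δ → M ≤ δ * ∑ X (λ m → ⟦ δ ∣? m ⟧ * h m) + E * δ) where

  open Sieve X M E h upper lower

  -- An entry free of the sifting primes contributes at least K G^2 to the second moment, which is
  -- about M Φ G. Hence the count is about M Φ / (K G), and Φ / G is at most 4 / s.
  sieve-bound : ∀ s K l → 4 ≤ s → let z = 2 ^ suc s; c = z * z * suc z in
    Unique l → All (λ m → m < X × (m ≤ z ⊎ (K ≤ h m × Free z m))) l →
    (length l ∸ suc z) * K * s ≤ 4 * (M + E * (c * c))
  sieve-bound s K l 4≤s unique all = *-cancelˡ-≤ Φ {{>-nonZero (φ>0 z)}} (begin
    Φ * (n * K * s)                ≡⟨ reorder Φ n K s ⟩
    n * K * (Φ * s)                ≤⟨ *-monoʳ-≤ (n * K) (gain-large s) ⟩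
    n * K * (4 * G)                ≡⟨ reorder′ n K G ⟩
    4 * (n * (K * G))              ≤⟨ *-monoʳ-≤ 4 bound ⟩
    4 * (Φ * (M + E * (c * c)))    ≡⟨ reorder″ Φ (M + E * (c * c)) ⟩
    Φ * (4 * (M + E * (c * c)))    ∎)
    where
    open ≤-Reasoning
    z c n Φ G : ℕ
    z = 2 ^ suc s
    c = z * z * suc z
    n = length l ∸ suc z
    Φ = φ z
    G = gain z z
    reorder : ∀ Φ n K s → Φ * (n * K * s) ≡ n * K * (Φ * s)
    reorder = solve-∀
    reorder′ : ∀ n K G → n * K * (4 * G) ≡ 4 * (n * (K * G))
    reorder′ = solve-∀
    reorder″ : ∀ a b → 4 * (a * b) ≡ a * (4 * b)
    reorder″ = solve-∀
    -- This is where `4 ≤ s` enters: it allows trading Φ^2 in the error for Φ G, so that a factor G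
    -- cancels from the whole bound.
    Φ≤G : Φ ≤ G
    Φ≤G = *-cancelˡ-≤ 4 (≤-trans (≤-reflexive (*-comm 4 Φ)) (≤-trans (*-monoʳ-≤ Φ 4≤s) (gain-large s)))
    instance
      G≢0 : NonZero G
      G≢0 = >-nonZero (<-≤-trans (φ>0 z) Φ≤G)
    w f : ℕ → ℕ
    w m = ∣ weight z z m ∣ * ∣ weight z z m ∣
    -- The second summand pays for entries up to `z`, among which are the sifting primes themselves;
    -- in total it costs `suc z` entries.
    f m = h m * w m + K * (G * G) * ⟦ m ≤? z ⟧
    large : ∀ {m} → m < X × (m ≤ z ⊎ (K ≤ h m × Free z m)) → m < X × K * (G * G) ≤ f m
    large {m} (m<X , inj₁ m≤z) = m<X , ≤-trans
      (≤-reflexive (sym (trans (cong (K * (G * G) *_) (⟦⟧-yes (m ≤? z) m≤z)) (*-identityʳ (K * (G * G)))))) (m≤n+m _ (h m * w m))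
    large {m} (m<X , inj₂ (K≤h , free)) = m<X , ≤-trans
      (*-mono-≤ K≤h (≤-reflexive (sym (cong (λ i → ∣ i ∣ * ∣ i ∣) (weight-free z z free))))) (m≤m+n _ _)
    size-bound : size z z * size z z ≤ Φ * G * (c * c)
    size-bound = begin
      size z z * size z z        ≤⟨ *-mono-≤ (size≤ z z) (size≤ z z) ⟩
      Φ * c * (Φ * c)            ≡⟨ square Φ c ⟩
      Φ * Φ * (c * c)            ≤⟨ *-monoˡ-≤ (c * c) (*-monoʳ-≤ Φ Φ≤G) ⟩
      Φ * G * (c * c)            ∎
      where
      square : ∀ a b → a * b * (a * b) ≡ a * a * (b * b)
      square = solve-∀
    total : length l * (K * (G * G)) ≤ Φ * G * (M + E * (c * c)) + suc z * (K * (G * G))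
    total = begin
      length l * (K * (G * G))                                     ≤⟨ unique-∑ X f (K * (G * G)) l unique (All.map large all) ⟩
      ∑ X f                                                        ≡⟨ ∑-distrib X (λ m → h m * w m) _ ⟩
      ∑ X (λ m → h m * w m) + ∑ X (λ m → K * (G * G) * ⟦ m ≤? z ⟧)   ≡⟨ cong (∑ X (λ m → h m * w m) +_) (∑-*ˡ X (K * (G * G)) _) ⟩
      ∑ X (λ m → h m * w m) + K * (G * G) * ∑ X (λ m → ⟦ m ≤? z ⟧)   ≤⟨ +-mono-≤ (second-moment z z) (*-monoʳ-≤ (K * (G * G)) (∑-initial X z)) ⟩
      M * (Φ * G) + E * (size z z * size z z) + K * (G * G) * suc z  ≤⟨ +-monoˡ-≤ _ (+-monoʳ-≤ (M * (Φ * G)) (*-monoʳ-≤ E size-bound)) ⟩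
      M * (Φ * G) + E * (Φ * G * (c * c)) + K * (G * G) * suc z      ≡⟨ collect M Φ G E (c * c) K (suc z) ⟩
      Φ * G * (M + E * (c * c)) + suc z * (K * (G * G))              ∎
      where
      collect : ∀ M Φ G E c K z → M * (Φ * G) + E * (Φ * G * c) + K * (G * G) * z ≡ Φ * G * (M + E * c) + z * (K * (G * G))
      collect = solve-∀
    bound : n * (K * G) ≤ Φ * (M + E * (c * c))
    bound = *-cancelˡ-≤ G (begin
      G * (n * (K * G))                                                ≡⟨ regroup G n K ⟩
      n * (K * (G * G))                                                ≡⟨ *-distribʳ-∸ (K * (G * G)) (length l) (suc z) ⟩
      length l * (K * (G * G)) ∸ suc z * (K * (G * G))                 ≤⟨ ∸-monoˡ-≤ (suc z * (K * (G * G))) total ⟩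
      Φ * G * (M + E * (c * c)) + suc z * (K * (G * G)) ∸ suc z * (K * (G * G))  ≡⟨ m+n∸n≡m _ (suc z * (K * (G * G))) ⟩
      Φ * G * (M + E * (c * c))                                        ≡⟨ regroup′ Φ G (M + E * (c * c)) ⟩
      G * (Φ * (M + E * (c * c)))                                      ∎)
      where
      regroup : ∀ G n K → G * (n * (K * G)) ≡ n * (K * (G * G))
      regroup = solve-∀
      regroup′ : ∀ a b c → a * b * c ≡ b * (a * c)
      regroup′ = solve-∀

-- Quadratic reciprocity by counting lattice points

infix 4 _≡₂_
_≡₂_ : ℕ → ℕ → Set
a ≡₂ b = a % 2 ≡ b % 2

∑-≡₂ : ∀ n {f g : ℕ → ℕ} → (∀ i → i < n → f i ≡₂ g i) → ∑ n f ≡₂ ∑ n g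
∑-≡₂ zero    p = refl
∑-≡₂ (suc n) {f} {g} p = %-+-cong 2 {∑ n f} {∑ n g} (∑-≡₂ n λ i i<n → p i (m<n⇒m<1+n i<n)) (p n (n<1+n n))

+-double : ∀ a b → a + (b + b) ≡₂ a
+-double a b = trans (cong (λ t → (a + t) % 2) (double b)) ([m+kn]%n≡m%n a b 2)
  where
  double : ∀ b → b + b ≡ b * 2
  double = solve-∀

≡₂-move : ∀ {a b c} → a ≡₂ b + c → a + b ≡₂ c
≡₂-move {a} {b} {c} p = trans (%-+-cong 2 {a} {b + c} {b} {b} p refl)
  (trans (cong (_% 2) (regroup b c)) (+-double c b))
  where
  regroup : ∀ b c → b + c + b ≡ c + (b + b)
  regroup = solve-∀

count-below : ∀ H q → q ≤ H → ∑ H (λ y → ⟦ suc y ≤? q ⟧) ≡ q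
count-below H q q≤H with o , refl ← m≤n⇒∃[o]m+o≡n q≤H = begin
  ∑ (q + o) (λ y → ⟦ suc y ≤? q ⟧)                                   ≡⟨ ∑-split q o _ ⟩
  ∑ q (λ y → ⟦ suc y ≤? q ⟧) + ∑ o (λ i → ⟦ suc (q + i) ≤? q ⟧)      ≡⟨ cong₂ _+_
    (∑-cong q λ y y<q → ⟦⟧-yes (suc y ≤? q) y<q) (∑-cong o λ i _ → ⟦⟧-no (suc (q + i) ≤? q) (<⇒≱ (s≤s (m≤m+n q i)))) ⟩
  ∑ q (λ _ → 1) + ∑ o (λ _ → 0)                                      ≡⟨ cong₂ _+_ (trans (∑-const q 1) (*-identityʳ q)) (∑-zero o) ⟩
  q + 0                                                              ≡⟨ +-identityʳ q ⟩
  q                                                                  ∎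
  where open ≡-Reasoning

floor-count : ∀ H N n .{{_ : NonZero n}} → N / n ≤ H → ∑ H (λ y → ⟦ n * suc y ≤? N ⟧) ≡ N / n
floor-count H N n q≤H = trans
  (∑-cong H λ y _ → ⟦⟧-⇔ (n * suc y ≤? N) (suc y ≤? N / n) (λ p → subst (_≤ N / n) (m*n/n≡m (suc y) n) (/-monoˡ-≤ n (≤-trans (≤-reflexive (*-comm (suc y) n)) p)))
    (λ p → ≤-trans (*-monoʳ-≤ n p) (≤-trans (≤-reflexive (*-comm n (N / n))) (m/n*n≤m N n))))
  (count-below H (N / n) q≤H)

floor-sum : ℕ → ℕ → ℕ
floor-sum h m = ∑ h (λ j → m * suc j / suc (h + h))

half-bound : ∀ h h′ {x} → x < h → suc (h′ + h′) * suc x < suc h′ * suc (h + h)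
half-bound h h′ {x} x<h = begin-strict
  suc (h′ + h′) * suc x                    ≤⟨ *-monoʳ-≤ (suc (h′ + h′)) x<h ⟩
  suc (h′ + h′) * h                        <⟨ m<m+n _ {suc (h + h′)} z<s ⟩
  suc (h′ + h′) * h + suc (h + h′)         ≡⟨ identity h h′ ⟩
  suc h′ * suc (h + h)                     ∎
  where
  open ≤-Reasoning
  identity : ∀ h h′ → suc (h′ + h′) * h + suc (h + h′) ≡ suc h′ * suc (h + h)
  identity = solve-∀

-- The floor sums count the points of an `h` by `h′` rectangle on the two sides of its diagonal, and
-- coprimality keeps all points off it. Neither modulus need be prime, as one of them will be a
-- Fermat number.
reciprocity : ∀ h h′ → Coprime (suc (h + h)) (suc (h′ + h′)) →
  floor-sum h (suc (h′ + h′)) + floor-sum h′ (suc (h + h)) ≡ h * h′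
reciprocity h h′ cop = begin
  floor-sum h n′ + floor-sum h′ n
    ≡⟨ cong₂ _+_ (as-count h h′) (as-count h′ h) ⟩
  ∑ h (λ x → ∑ h′ (λ y → ⟦ n * suc y ≤? n′ * suc x ⟧)) + ∑ h′ (λ y → ∑ h (λ x → ⟦ n′ * suc x ≤? n * suc y ⟧))
    ≡⟨ cong (∑ h (λ x → ∑ h′ (λ y → ⟦ n * suc y ≤? n′ * suc x ⟧)) +_) (∑-swap h′ h _) ⟩
  ∑ h (λ x → ∑ h′ (λ y → ⟦ n * suc y ≤? n′ * suc x ⟧)) + ∑ h (λ x → ∑ h′ (λ y → ⟦ n′ * suc x ≤? n * suc y ⟧))
    ≡⟨ ∑-distrib h _ _ ⟨
  ∑ h (λ x → ∑ h′ (λ y → ⟦ n * suc y ≤? n′ * suc x ⟧) + ∑ h′ (λ y → ⟦ n′ * suc x ≤? n * suc y ⟧))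
    ≡⟨ ∑-cong h (λ x x<h → trans (sym (∑-distrib h′ _ _)) (trans (∑-cong h′ λ y _ → exactly-one x y x<h) (trans (∑-const h′ 1) (*-identityʳ h′)))) ⟩
  ∑ h (λ _ → h′)
    ≡⟨ ∑-const h h′ ⟩
  h * h′ ∎
  where
  open ≡-Reasoning
  n n′ : ℕ
  n  = suc (h + h)
  n′ = suc (h′ + h′)
  as-count : ∀ h h′ → floor-sum h (suc (h′ + h′)) ≡ ∑ h (λ x → ∑ h′ (λ y → ⟦ suc (h + h) * suc y ≤? suc (h′ + h′) * suc x ⟧))
  as-count h h′ = ∑-cong h λ x x<h → sym (floor-count h′ (suc (h′ + h′) * suc x) (suc (h + h)) (≤-pred (m<n*o⇒m/o<n (half-bound h h′ x<h))))
  exactly-one : ∀ x y → x < h → ⟦ n * suc y ≤? n′ * suc x ⟧ + ⟦ n′ * suc x ≤? n * suc y ⟧ ≡ 1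
  exactly-one x y x<h with <-cmp (n * suc y) (n′ * suc x)
  ... | tri< lt _ _ = cong₂ _+_ (⟦⟧-yes (n * suc y ≤? n′ * suc x) (<⇒≤ lt)) (⟦⟧-no (n′ * suc x ≤? n * suc y) (<⇒≱ lt))
  ... | tri> _ _ gt = cong₂ _+_ (⟦⟧-no (n * suc y ≤? n′ * suc x) (<⇒≱ gt)) (⟦⟧-yes (n′ * suc x ≤? n * suc y) (<⇒≤ gt))
  ... | tri≈ _ eq _ = contradiction (∣⇒≤ (coprime-divisor cop (subst (n ∣_) eq (m∣m*n (suc y))))) (<⇒≱ (s≤s (≤-trans x<h (m≤m+n h h))))

-- Half systems and the parity of floor sums

module HalfSystem (h : ℕ) where

  n : ℕ
  n = suc (h + h)

  -- The distance from `x` to the nearest multiple of `n`: the one number in 0, ..., `h` congruent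
  -- to x or to -x.
  norm : ℕ → ℕ
  norm x = choose (x % n ≤? h) (x % n) (n ∸ x % n)

  norm-small : ∀ x → x % n ≤ h → norm x ≡ x % n
  norm-small x r≤h with x % n ≤? h
  ... | yes _  = refl
  ... | no r≰h = contradiction r≤h r≰h

  norm-large : ∀ x → h < x % n → norm x ≡ n ∸ x % n
  norm-large x h<r with x % n ≤? h
  ... | yes r≤h = contradiction r≤h (<⇒≱ h<r)
  ... | no _    = refl

  norm≤ : ∀ x → norm x ≤ h
  norm≤ x with x % n ≤? h
  ... | yes r≤h = r≤h
  ... | no r≰h  = m≤n+o⇒m∸n≤o (n) (x % n) (+-monoˡ-≤ h (≰⇒> r≰h))

  norm-cases : ∀ x → x % n ≡ norm x % n ⊎ (x + norm x) % n ≡ 0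
  norm-cases x with x % n ≤? h
  ... | yes _ = inj₁ (sym (m%n%n≡m%n x n))
  ... | no _  = inj₂ (trans (%-+-cong n {x} {x % n} (sym (m%n%n≡m%n x n)) refl)
                       (trans (cong (_% n) (m+[n∸m]≡n (m%n≤n x n))) (n%n≡0 n)))

  norm-unique : ∀ x y → y ≤ h → x % n ≡ y % n ⊎ (x + y) % n ≡ 0 → norm x ≡ y
  norm-unique x y y≤h (inj₁ p) = trans (norm-small x (subst (_≤ h) (sym x≡y) y≤h)) x≡y
    where
    x≡y : x % n ≡ y
    x≡y = trans p (m<n⇒m%n≡m (s≤s (≤-trans y≤h (m≤m+n h h))))
  norm-unique x zero y≤h (inj₂ p) = trans (norm-small x (subst (_≤ h) (sym x≡0) z≤n)) x≡0
    where
    x≡0 : x % n ≡ 0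
    x≡0 = trans (cong (_% n) (sym (+-identityʳ x))) p
  norm-unique x (suc y) y≤h (inj₂ p) = trans (norm-large x (subst (h <_) (sym x≡) h<)) (trans (cong (n ∸_) x≡) (m∸[m∸n]≡n y≤n))
    where
    y≤n : suc y ≤ n
    y≤n = ≤-trans y≤h (≤-trans (m≤m+n h h) (n≤1+n _))
    h< : h < n ∸ suc y
    h< = m+n≤o⇒m≤o∸n (suc h) (s≤s (+-monoʳ-≤ h y≤h))
    x≡ : x % n ≡ n ∸ suc y
    x≡ = trans (%-+-cancelʳ n x (n ∸ suc y) (suc y) (trans p (sym (trans (cong (_% n) (m∸n+n≡m y≤n)) (n%n≡0 n)))))
           (m<n⇒m%n≡m (s≤s (m∸n≤m (h + h) y)))

  module _ {a : ℕ} (cop : Coprime a n) where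

    norm-inverse : ∀ {b} → (b * a) % n ≡ 1 % n → ∀ x → x ≤ h → norm (b * norm (a * x)) ≡ x
    norm-inverse {b} ba≡1 x x≤h = norm-unique (b * norm (a * x)) x x≤h (go (norm-cases (a * x)))
      where
      bax : (b * (a * x)) % n ≡ x % n
      bax = trans (cong (_% n) (sym (*-assoc b a x))) (trans (%-*-cong n {b * a} {1} {x} {x} ba≡1 refl) (cong (_% n) (*-identityˡ x)))
      go : (a * x) % n ≡ norm (a * x) % n ⊎ (a * x + norm (a * x)) % n ≡ 0 →
           (b * norm (a * x)) % n ≡ x % n ⊎ (b * norm (a * x) + x) % n ≡ 0
      go (inj₁ p) = inj₁ (trans (%-*-cong n {b} {b} {norm (a * x)} {a * x} refl (sym p)) bax)
      go (inj₂ p) = inj₂ (trans (%-+-cong n {b * norm (a * x)} {b * norm (a * x)} {x} {b * (a * x)} refl (sym bax))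
        (trans (cong (_% n) (regroup b (norm (a * x)) (a * x)))
        (trans (%-*-cong n {b} {b} {a * x + norm (a * x)} {0} refl p) (cong (_% n) (*-zeroʳ b)))))
        where
        regroup : ∀ b s t → b * s + b * t ≡ b * (t + s)
        regroup = solve-∀

    norm>0 : ∀ x → 0 < x → x ≤ h → 0 < norm (a * x)
    norm>0 x 0<x x≤h with b , ab≡1 ← inverse n cop = n≢0⇒n>0 λ norm≡0 → >⇒≢ 0<x
      (trans (sym (norm-inverse {b} (trans (cong (_% n) (*-comm b a)) ab≡1) x x≤h))
             (trans (cong (λ t → norm (b * t)) norm≡0) (cong norm (*-zeroʳ b))))

  suc-pred-norm : ∀ {a} → Coprime a n → ∀ j → j < h → suc (pred (norm (a * suc j))) ≡ norm (a * suc j)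
  suc-pred-norm cop j j<h = suc-pred _ {{>-nonZero (norm>0 cop (suc j) z<s j<h)}}

  module Permute {a : ℕ} (cop : Coprime a n) where

    private
      b : ℕ
      b = proj₁ (inverse n cop)
      ab≡1 : (a * b) % n ≡ 1 % n
      ab≡1 = proj₂ (inverse n cop)
      ba≡1 : (b * a) % n ≡ 1 % n
      ba≡1 = trans (cong (_% n) (*-comm b a)) ab≡1
      cop′ : Coprime b n
      cop′ = inverse⇒coprime n {b} {a} ba≡1

    σ τ : ℕ → ℕ
    σ j = pred (norm (a * suc j))
    τ j = pred (norm (b * suc j))

    σ< : ∀ j → j < h → σ j < h
    σ< j j<h = subst (_≤ h) (sym (suc-pred-norm cop j j<h)) (norm≤ (a * suc j))
    τ< : ∀ j → j < h → τ j < h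
    τ< j j<h = subst (_≤ h) (sym (suc-pred-norm cop′ j j<h)) (norm≤ (b * suc j))
    στ : ∀ j → j < h → σ (τ j) ≡ j
    στ j j<h = cong pred (trans (cong (λ t → norm (a * t)) (suc-pred-norm cop′ j j<h)) (norm-inverse cop′ {a} ab≡1 (suc j) j<h))
    τσ : ∀ j → j < h → τ (σ j) ≡ j
    τσ j j<h = cong pred (trans (cong (λ t → norm (b * t)) (suc-pred-norm cop j j<h)) (norm-inverse cop {b} ba≡1 (suc j) j<h))

    -- Multiplication by a unit followed by `norm` permutes 1, ..., `h`; the inverse unit undoes it.
    ∑-norm : ∀ (f : ℕ → ℕ) → ∑ h (λ j → f (norm (a * suc j))) ≡ ∑ h (f ∘ suc)
    ∑-norm f = trans (∑-cong h λ j j<h → cong f (sym (suc-pred-norm cop j j<h))) (∑-perm h (f ∘ suc) σ τ σ< τ< στ τσ)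

    ∏-norm : ∀ (f : ℕ → ℕ) → ∏ h (λ j → f (norm (a * suc j))) ≡ ∏ h (f ∘ suc)
    ∏-norm f = trans (∏-cong h λ j j<h → cong f (sym (suc-pred-norm cop j j<h))) (∏-perm h (f ∘ suc) σ τ σ< τ< στ τσ)

  negatives : ℕ → ℕ
  negatives a = ∑ h (λ j → ⟦ suc h ≤? a * suc j % n ⟧)

  residue-parity : ∀ x → x % n ≡₂ norm x + ⟦ suc h ≤? x % n ⟧
  residue-parity x with suc h ≤? x % n
  ... | no h≮r  = cong (_% 2) (trans (sym (norm-small x (≮⇒≥ h≮r))) (sym (+-identityʳ (norm x))))
  ... | yes h<r = sym (begin
    (norm x + 1) % 2                          ≡⟨ +-double (norm x + 1) (x % n) ⟨
    (norm x + 1 + (x % n + x % n)) % 2        ≡⟨ cong (_% 2) (regroup (norm x) (x % n)) ⟩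
    (x % n + (norm x + x % n) + 1) % 2        ≡⟨ cong (λ t → (x % n + t + 1) % 2) (trans (cong (_+ x % n) (norm-large x h<r)) (m∸n+n≡m (m%n≤n x n))) ⟩
    (x % n + suc (h + h) + 1) % 2             ≡⟨ cong (_% 2) (regroup′ (x % n) h) ⟩
    (x % n + (suc h + suc h)) % 2             ≡⟨ +-double (x % n) (suc h) ⟩
    x % n % 2                                 ∎)
    where
    open ≡-Reasoning
    regroup : ∀ s t → s + 1 + (t + t) ≡ t + (s + t) + 1
    regroup = solve-∀
    regroup′ : ∀ t h → t + suc (h + h) + 1 ≡ t + (suc h + suc h)
    regroup′ = solve-∀

  -- Eisenstein's argument: divide `a * suc j` by `n` with remainder and reduce modulo 2, where `a`
  -- and `n` are 1. Summed over j, the norms are a rearrangement of 1, ..., `h` and cancel against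
  -- the left side.
  negatives≡floor-sum : ∀ {a} → Coprime a n → a ≡₂ 1 → negatives a ≡₂ floor-sum h a
  negatives≡floor-sum {a} cop a-odd = trans (sym (+-double (negatives a) (∑ h suc))) (trans
    (cong (_% 2) (regroup (negatives a) (∑ h suc)))
    (≡₂-move {∑ h suc} {∑ h suc + negatives a} {floor-sum h a} summed))
    where
    regroup : ∀ s t → s + (t + t) ≡ t + (t + s)
    regroup = solve-∀
    pointwise : ∀ j → j < h → suc j ≡₂ norm (a * suc j) + ⟦ suc h ≤? a * suc j % n ⟧ + a * suc j / n
    pointwise j _ = begin
      suc j % 2                              ≡⟨ cong (_% 2) (*-identityˡ (suc j)) ⟨
      1 * suc j % 2                          ≡⟨ %-*-cong 2 {1} {a} {suc j} {suc j} (sym a-odd) refl ⟩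
      a * suc j % 2                          ≡⟨ cong (_% 2) (m≡m%n+[m/n]*n (a * suc j) n) ⟩
      (a * suc j % n + a * suc j / n * n) % 2
        ≡⟨ %-+-cong 2 {a * suc j % n} {norm (a * suc j) + ⟦ suc h ≤? a * suc j % n ⟧} {a * suc j / n * n} {a * suc j / n}
             (residue-parity (a * suc j))
             (trans (cong (_% 2) (regroup′ (a * suc j / n) h)) (+-double (a * suc j / n) (a * suc j / n * h))) ⟩
      (norm (a * suc j) + ⟦ suc h ≤? a * suc j % n ⟧ + a * suc j / n) % 2 ∎
      where
      open ≡-Reasoning
      regroup′ : ∀ q h → q * suc (h + h) ≡ q + (q * h + q * h)
      regroup′ = solve-∀
    summed : ∑ h suc ≡₂ ∑ h suc + negatives a + floor-sum h a
    summed = trans (∑-≡₂ h pointwise) (cong (_% 2) (trans (∑-distrib h _ _) (cong (_+ floor-sum h a)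
      (trans (∑-distrib h _ _) (cong (_+ negatives a) (Permute.∑-norm cop id))))))

  -- Since a r / n is not an integer, the two quotients add up to a - 1, which is even.
  floor-reflect : ∀ a r → a ≡₂ 1 → r ≤ n → ¬ n ∣ a * r → a * (n ∸ r) / n ≡₂ a * r / n
  floor-reflect a r a-odd r≤n n∤ar = %-+-cancelʳ 2 Q q (suc q) (begin
    (Q + suc q) % 2        ≡⟨ cong (_% 2) Q+q ⟩
    a % 2                  ≡⟨ a-odd ⟩
    1 % 2                  ≡⟨ +-double 1 q ⟨
    (1 + (q + q)) % 2      ≡⟨ cong (_% 2) (sym (+-suc q q)) ⟩
    (q + suc q) % 2        ∎)
    where
    open ≡-Reasoning
    q ρ Q : ℕ
    q = a * r / n
    ρ = a * r % n
    Q = a * (n ∸ r) / n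
    0<ρ : 0 < ρ
    0<ρ = n≢0⇒n>0 λ ρ≡0 → n∤ar (m%n≡0⇒n∣m (a * r) n ρ≡0)
    q<a : suc q * n ≤ a * n
    q<a = *-monoˡ-≤ n (m<n*o⇒m/o<n {a * r} {a} {n} (≤∧≢⇒< (*-monoʳ-≤ a r≤n) λ eq → n∤ar (subst (n ∣_) (sym eq) (n∣m*n a))))
    value : a * (n ∸ r) ≡ (n ∸ ρ) + (a ∸ suc q) * n
    value = +-cancelʳ-≡ (a * r) _ _ (begin
      a * (n ∸ r) + a * r                                  ≡⟨ *-distribˡ-+ a (n ∸ r) r ⟨
      a * (n ∸ r + r)                                      ≡⟨ cong (a *_) (m∸n+n≡m r≤n) ⟩
      a * n                                                ≡⟨ m∸n+n≡m q<a ⟨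
      a * n ∸ suc q * n + suc q * n                        ≡⟨ cong (_+ suc q * n) (sym (*-distribʳ-∸ n a (suc q))) ⟩
      (a ∸ suc q) * n + (n + q * n)                        ≡⟨ cong (λ t → (a ∸ suc q) * n + (t + q * n)) (sym (m∸n+n≡m (m%n≤n (a * r) n))) ⟩
      (a ∸ suc q) * n + (n ∸ ρ + ρ + q * n)                ≡⟨ regroup ((a ∸ suc q) * n) (n ∸ ρ) ρ (q * n) ⟩
      n ∸ ρ + (a ∸ suc q) * n + (ρ + q * n)                ≡⟨ cong (n ∸ ρ + (a ∸ suc q) * n +_) (m≡m%n+[m/n]*n (a * r) n) ⟨
      n ∸ ρ + (a ∸ suc q) * n + a * r                      ∎)
      where
      regroup : ∀ a b c d → a + (b + c + d) ≡ b + a + (c + d)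
      regroup = solve-∀
    Q≡ : Q ≡ a ∸ suc q
    Q≡ = begin
      Q                                            ≡⟨ cong (_/ n) value ⟩
      (n ∸ ρ + (a ∸ suc q) * n) / n                ≡⟨ +-distrib-/-∣ʳ (n ∸ ρ) (n∣m*n (a ∸ suc q)) ⟩
      (n ∸ ρ) / n + (a ∸ suc q) * n / n            ≡⟨ cong₂ _+_ (m<n⇒m/n≡0 (∸-monoʳ-< {n} 0<ρ (m%n≤n (a * r) n))) (m*n/n≡m (a ∸ suc q) n) ⟩
      a ∸ suc q                                    ∎
    Q+q : Q + suc q ≡ a
    Q+q = trans (cong (_+ suc q) Q≡) (m∸n+n≡m (*-cancelʳ-≤ (suc q) a n q<a))

  -- Multiplicativity of the Jacobi symbol, for composite `n` and possibly even `m`. In m j = r + q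
  -- n the part a q has the parity of q and gives the first sum; `floor-reflect` replaces r by its
  -- norm, and the norms run through 1, ..., `h`.
  floor-sum-* : ∀ {a m} → a ≡₂ 1 → Coprime a n → Coprime m n → floor-sum h (a * m) ≡₂ floor-sum h m + floor-sum h a
  floor-sum-* {a} {m} a-odd copᵃ copᵐ = trans (∑-≡₂ h pointwise)
    (cong (_% 2) (trans (∑-distrib h _ _) (cong (floor-sum h m +_) (Permute.∑-norm copᵐ (λ y → a * y / n)))))
    where
    open ≡-Reasoning
    pointwise : ∀ j → j < h → a * m * suc j / n ≡₂ m * suc j / n + a * norm (m * suc j) / n
    pointwise j j<h = begin
      a * m * suc j / n % 2                     ≡⟨ cong (λ t → t / n % 2) expand ⟩
      (a * r + a * q * n) / n % 2               ≡⟨ cong (_% 2) (trans (+-distrib-/-∣ʳ (a * r) (n∣m*n (a * q))) (cong (a * r / n +_) (m*n/n≡m (a * q) n))) ⟩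
      (a * r / n + a * q) % 2                   ≡⟨ %-+-cong 2 {a * r / n} {a * norm x / n} {a * q} {q} folded
                                                     (trans (%-*-cong 2 {a} {1} {q} {q} a-odd refl) (cong (_% 2) (*-identityˡ q))) ⟩
      (a * norm x / n + q) % 2                  ≡⟨ cong (_% 2) (+-comm (a * norm x / n) q) ⟩
      (q + a * norm x / n) % 2                  ∎
      where
      x r q : ℕ
      x = m * suc j
      r = x % n
      q = x / n
      expand : a * m * suc j ≡ a * r + a * q * n
      expand = trans (*-assoc a m (suc j)) (trans (cong (a *_) (m≡m%n+[m/n]*n x n)) (trans (*-distribˡ-+ a r (q * n)) (cong (a * r +_) (sym (*-assoc a q n)))))
      n∤ : ¬ n ∣ a * r
      n∤ n∣ar = <⇒≱ (s≤s (≤-trans j<h (m≤m+n h h))) (∣⇒≤ (coprime-divisor (coprime-sym copᵐ)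
        (m%n≡0⇒n∣m x n (trans (sym (m%n%n≡m%n x n)) (n∣m⇒m%n≡0 r n (coprime-divisor (coprime-sym copᵃ) n∣ar))))))
      folded : a * r / n ≡₂ a * norm x / n
      folded with r ≤? h
      ... | yes _ = refl
      ... | no _  = sym (floor-reflect a r a-odd (m%n≤n x n) n∤)

-- Gauss' lemma and Wilson's theorem

∏-%-cong : ∀ n .{{_ : NonZero n}} m {f g : ℕ → ℕ} → (∀ i → i < m → f i % n ≡ g i % n) → ∏ m f % n ≡ ∏ m g % n
∏-%-cong n zero    p = refl
∏-%-cong n (suc m) {f} {g} p = %-*-cong n {∏ m f} {∏ m g} {f m} {g m} (∏-%-cong n m λ i i<m → p i (m<n⇒m<1+n i<m)) (p m (n<1+n m))

∏-^ : ∀ m c (f : ℕ → ℕ) → ∏ m (λ i → c ^ f i) ≡ c ^ ∑ m f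
∏-^ zero    c f = refl
∏-^ (suc m) c f = trans (cong (_* c ^ f m) (∏-^ m c f)) (sym (^-distribˡ-+-* c (∑ m f) (f m)))

choose-yes : ∀ {a b} {A : Set a} {B : Set b} (d : Dec A) {x y : B} → A → choose d x y ≡ x
choose-yes (yes _) _ = refl
choose-yes (no ¬a) a = contradiction a ¬a

choose-no : ∀ {a b} {A : Set a} {B : Set b} (d : Dec A) {x y : B} → ¬ A → choose d x y ≡ y
choose-no (yes a) ¬a = contradiction a ¬a
choose-no (no _)  _  = refl

∏-const : ∀ m c → ∏ m (λ _ → c) ≡ c ^ m
∏-const zero    c = refl
∏-const (suc m) c = trans (cong (_* c) (∏-const m c)) (*-comm (c ^ m) c)

coprime-* : ∀ {a b n} → Coprime a n → Coprime b n → Coprime (a * b) n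
coprime-* {a} {b} ca cb (d∣ab , d∣n) = cb (coprime-divisor (λ (e∣d , e∣a) → ca (e∣a , ∣-trans e∣d d∣n)) d∣ab , d∣n)

coprime-∏ : ∀ m n (f : ℕ → ℕ) → (∀ i → i < m → Coprime (f i) n) → Coprime (∏ m f) n
coprime-∏ zero    n f cop (d∣1 , _) = ∣1⇒≡1 d∣1
coprime-∏ (suc m) n f cop = coprime-* (coprime-∏ m n f λ i i<m → cop i (m<n⇒m<1+n i<m)) (cop m (n<1+n m))

%-*-cancelʳ : ∀ n .{{_ : NonZero n}} a b w → Coprime w n → (a * w) % n ≡ (b * w) % n → a % n ≡ b % n
%-*-cancelʳ n a b w cop p with v , wv≡1 ← inverse n cop = trans (sym (undo a)) (trans (%-*-cong n {a * w} {b * w} {v} {v} p refl) (undo b))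
  where
  undo : ∀ a → (a * w * v) % n ≡ a % n
  undo a = trans (cong (_% n) (*-assoc a w v)) (trans (%-*-cong n {a} {a} {w * v} {1} refl wv≡1) (cong (_% n) (*-identityʳ a)))

-- Files the factor `x` according to its position relative to its partner `y`, so that a product
-- over all x can be regrouped into pairs.
trichotomy-∏ : ∀ x y → x ≡ x ^ ⟦ x <? y ⟧ * x ^ ⟦ y <? x ⟧ * choose (x ≟ y) x 1
trichotomy-∏ x y with x <? y | y <? x | x ≟ y
... | yes x<y | yes y<x | _       = contradiction y<x (<⇒≯ x<y)
... | yes x<y | no _    | yes x≡y = contradiction x≡y (<⇒≢ x<y)
... | yes _   | no _    | no _    = identity x
  where
  identity : ∀ x → x ≡ x * 1 * 1 * 1
  identity = solve-∀
... | no _    | yes y<x | yes x≡y = contradiction (sym x≡y) (<⇒≢ y<x)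
... | no _    | yes _   | no _    = identity x
  where
  identity : ∀ x → x ≡ 1 * (x * 1) * 1
  identity = solve-∀
... | no _    | no _    | yes _   = identity x
  where
  identity : ∀ x → x ≡ 1 * 1 * x
  identity = solve-∀
... | no x≮y  | no y≮x  | no x≢y  = contradiction (≤-antisym (≮⇒≥ y≮x) (≮⇒≥ x≮y)) x≢y

^-dec : ∀ n .{{_ : NonZero n}} {A : Set} (d : Dec A) {x y a} → (y * x) % n ≡ a % n → (x ^ ⟦ d ⟧ * y ^ ⟦ d ⟧) % n ≡ a ^ ⟦ d ⟧ % n
^-dec n (no _)  p = refl
^-dec n (yes _) {x} {y} {a} p = trans (cong (_% n) (identity x y)) (trans p (cong (_% n) (sym (*-identityʳ a))))
  where
  identity : ∀ x y → x * 1 * (y * 1) ≡ y * x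
  identity = solve-∀

module Legendre (h : ℕ) (prime : Prime (suc (h + h))) where

  open HalfSystem h

  0<h : 0 < h
  0<h = n≢0⇒n>0 λ { refl → ¬prime[1] prime }

  small⇒coprime : ∀ {x} → 0 < x → x < n → Coprime x n
  small⇒coprime 0<x x<n = coprime-sym (prime⇒coprime prime {{>-nonZero 0<x}} x<n)

  ∤⇒coprime : ∀ {a} → ¬ n ∣ a → Coprime a n
  ∤⇒coprime n∤a = coprime-sym (prime∤⇒coprime prime n∤a)

  n-1 : ℕ
  n-1 = h + h

  minus-one : ∀ x y → (x + y) % n ≡ 0 → x % n ≡ (n-1 * y) % n
  minus-one x y p = %-+-cancelʳ n x (n-1 * y) y (trans p (sym (trans (cong (_% n) (trans (+-comm (n-1 * y) y) (*-comm n y))) (m*n%n≡0 y n))))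

  gauss : ∀ {a} → Coprime a n → a ^ h % n ≡ n-1 ^ negatives a % n
  gauss {a} cop = %-*-cancelʳ n (a ^ h) (n-1 ^ negatives a) (∏ h suc)
    (coprime-∏ h n suc λ i i<h → small⇒coprime z<s (s≤s (≤-trans i<h (m≤m+n h h)))) (begin
    (a ^ h * ∏ h suc) % n                                     ≡⟨ cong (λ t → (t * ∏ h suc) % n) (∏-const h a) ⟨
    (∏ h (λ _ → a) * ∏ h suc) % n                             ≡⟨ cong (_% n) (∏-distrib h (λ _ → a) suc) ⟨
    ∏ h (λ j → a * suc j) % n                                 ≡⟨ ∏-%-cong n h (λ j _ → signed (a * suc j)) ⟩
    ∏ h (λ j → n-1 ^ ⟦ suc h ≤? a * suc j % n ⟧ * norm (a * suc j)) % n
                                                              ≡⟨ cong (_% n) (∏-distrib h (λ j → n-1 ^ ⟦ suc h ≤? a * suc j % n ⟧) _) ⟩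
    (∏ h (λ j → n-1 ^ ⟦ suc h ≤? a * suc j % n ⟧) * ∏ h (λ j → norm (a * suc j))) % n
                                                              ≡⟨ cong₂ (λ s t → (s * t) % n) (∏-^ h n-1 _) (Permute.∏-norm cop id) ⟩
    (n-1 ^ negatives a * ∏ h suc) % n                         ∎)
    where
    open ≡-Reasoning
    signed : ∀ x → x % n ≡ (n-1 ^ ⟦ suc h ≤? x % n ⟧ * norm x) % n
    signed x with suc h ≤? x % n
    ... | no h≮r  = sym (trans (cong (_% n) (trans (*-identityˡ (norm x)) (norm-small x (≮⇒≥ h≮r)))) (m%n%n≡m%n x n))
    ... | yes h<r = trans (minus-one x (norm x) (trans (%-+-cong n {x} {x % n} (sym (m%n%n≡m%n x n)) refl)
                      (trans (cong (_% n) (trans (cong (x % n +_) (norm-large x h<r)) (m+[n∸m]≡n (m%n≤n x n)))) (n%n≡0 n))))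
                      (cong (λ t → (t * norm x) % n) (sym (*-identityʳ n-1)))

  n-1-even : ∀ k → n-1 ^ (k * 2) % n ≡ 1 % n
  n-1-even zero    = refl
  n-1-even (suc k) = trans (cong (_% n) (sym (*-assoc n-1 n-1 (n-1 ^ (k * 2)))))
    (trans (%-*-cong n {n-1 * n-1} {1} {n-1 ^ (k * 2)} {1} square (n-1-even k)) refl)
    where
    square : (n-1 * n-1) % n ≡ 1 % n
    square = sym (minus-one 1 n-1 (n%n≡0 n))

  -- The square of Gauss' lemma, in which the sign cancels.
  fermat : ∀ {a} → Coprime a n → a ^ (h + h) % n ≡ 1 % n
  fermat {a} cop = begin
    a ^ (h + h) % n                          ≡⟨ cong (_% n) (^-distribˡ-+-* a h h) ⟩
    (a ^ h * a ^ h) % n                      ≡⟨ %-*-cong n {a ^ h} {n-1 ^ γ} {a ^ h} {n-1 ^ γ} (gauss cop) (gauss cop) ⟩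
    (n-1 ^ γ * n-1 ^ γ) % n                  ≡⟨ cong (_% n) (trans (sym (^-distribˡ-+-* n-1 γ γ)) (cong (n-1 ^_) (double γ))) ⟩
    n-1 ^ (γ * 2) % n                        ≡⟨ n-1-even γ ⟩
    1 % n                                    ∎
    where
    open ≡-Reasoning
    γ : ℕ
    γ = negatives a
    double : ∀ γ → γ + γ ≡ γ * 2
    double = solve-∀

  -- The involution x ↦ a / x, with the inverse supplied by Fermat's little theorem.
  module Pairing (a : ℕ) (cop : Coprime a n) where

    partner : ℕ → ℕ
    partner x = a * x ^ pred (h + h) % n

    partner< : ∀ x → partner x < n
    partner< x = m%n<n (a * x ^ pred (h + h)) n

    partner-* : ∀ {x} → 0 < x → x < n → (partner x * x) % n ≡ a % n
    partner-* {x} 0<x x<n = begin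
      (partner x * x) % n                  ≡⟨ %-*-cong n {partner x} {a * x ^ pred (h + h)} {x} {x} (m%n%n≡m%n (a * x ^ pred (h + h)) n) refl ⟩
      (a * x ^ pred (h + h) * x) % n       ≡⟨ cong (_% n) (trans (*-assoc a _ x) (cong (a *_) (*-comm (x ^ pred (h + h)) x))) ⟩
      (a * x ^ suc (pred (h + h))) % n     ≡⟨ cong (λ t → (a * x ^ t) % n) (suc-pred (h + h) {{>-nonZero (≤-trans 0<h (m≤m+n h h))}}) ⟩
      (a * x ^ (h + h)) % n                ≡⟨ %-*-cong n {a} {a} {x ^ (h + h)} {1} refl (fermat (small⇒coprime 0<x x<n)) ⟩
      (a * 1) % n                          ≡⟨ cong (_% n) (*-identityʳ a) ⟩
      a % n                                ∎
      where open ≡-Reasoning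

    partner>0 : ∀ {x} → 0 < x → x < n → 0 < partner x
    partner>0 {x} 0<x x<n = n≢0⇒n>0 λ px≡0 → contradiction
      (cop {n} (m%n≡0⇒n∣m a n (trans (sym (partner-* 0<x x<n)) (cong (λ t → (t * x) % n) px≡0)) , ∣-refl))
      (>⇒≢ (s≤s (≤-trans 0<h (m≤m+n h h))))

    partner-involutive : ∀ {x} → 0 < x → x < n → partner (partner x) ≡ x
    partner-involutive {x} 0<x x<n = <-%-injective n (partner< (partner x)) x<n
      (%-*-cancelʳ n (partner (partner x)) x (partner x) (small⇒coprime (partner>0 0<x x<n) (partner< x))
        (trans (partner-* (partner>0 0<x x<n) (partner< x)) (sym (trans (cong (_% n) (*-comm x (partner x))) (partner-* 0<x x<n)))))

    private
      σ : ℕ → ℕ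
      σ i = pred (partner (suc i))
      suc-σ : ∀ i → i < n-1 → suc (σ i) ≡ partner (suc i)
      suc-σ i i< = suc-pred _ {{>-nonZero (partner>0 z<s (s≤s i<))}}
      σ< : ∀ i → i < n-1 → σ i < n-1
      σ< i i< = ≤-pred (subst (_< n) (sym (suc-σ i i<)) (partner< (suc i)))
      σσ : ∀ i → i < n-1 → σ (σ i) ≡ i
      σσ i i< = cong pred (trans (cong partner (suc-σ i i<)) (partner-involutive z<s (s≤s i<)))

    ∏-partner : ∀ (f : ℕ → ℕ) → ∏ n-1 (λ i → f (partner (suc i))) ≡ ∏ n-1 (f ∘ suc)
    ∏-partner f = trans (∏-cong n-1 λ i i< → cong f (sym (suc-σ i i<))) (∏-perm n-1 (f ∘ suc) σ σ σ< σ< σσ σσ)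

    ∑-partner : ∀ (f : ℕ → ℕ) → ∑ n-1 (λ i → f (partner (suc i))) ≡ ∑ n-1 (f ∘ suc)
    ∑-partner f = trans (∑-cong n-1 λ i i< → cong f (sym (suc-σ i i<))) (∑-perm n-1 (f ∘ suc) σ σ σ< σ< σσ σσ)

    up down : ℕ → ℕ
    up x   = ⟦ x <? partner x ⟧
    down x = ⟦ partner x <? x ⟧

    fixed : ℕ → ℕ
    fixed x = choose (x ≟ partner x) x 1

    down-partner : ∀ i → i < n-1 → down (partner (suc i)) ≡ up (suc i)
    down-partner i i< = cong (λ t → ⟦ t <? partner (suc i) ⟧) (partner-involutive z<s (s≤s i<))

    -- Dirichlet's evaluation of (n - 1)!: every pair of distinct partners multiplies to `a` and is
    -- counted at its smaller member. Taking `a` = 1 gives Wilson's theorem, a nonresidue gives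
    -- Euler's criterion.
    pairing : ∏ n-1 suc % n ≡ (a ^ ∑ n-1 (up ∘ suc) * ∏ n-1 (fixed ∘ suc)) % n
    pairing = begin
      ∏ n-1 suc % n
        ≡⟨ cong (_% n) (trans (∏-cong n-1 λ i _ → split (suc i)) (trans (∏-distrib n-1 _ _) (cong (_* ∏ n-1 (fixed ∘ suc)) (∏-distrib n-1 _ _)))) ⟩
      (∏ n-1 (λ i → suc i ^ up (suc i)) * ∏ n-1 (λ i → suc i ^ down (suc i)) * ∏ n-1 (fixed ∘ suc)) % n
        ≡⟨ cong (λ t → (∏ n-1 (λ i → suc i ^ up (suc i)) * t * ∏ n-1 (fixed ∘ suc)) % n)
             (trans (sym (∏-partner (λ x → x ^ down x))) (∏-cong n-1 λ i i< → cong (partner (suc i) ^_) (down-partner i i<))) ⟩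
      (∏ n-1 (λ i → suc i ^ up (suc i)) * ∏ n-1 (λ i → partner (suc i) ^ up (suc i)) * ∏ n-1 (fixed ∘ suc)) % n
        ≡⟨ cong (λ t → (t * ∏ n-1 (fixed ∘ suc)) % n) (sym (∏-distrib n-1 (λ i → suc i ^ up (suc i)) _)) ⟩
      (∏ n-1 (λ i → suc i ^ up (suc i) * partner (suc i) ^ up (suc i)) * ∏ n-1 (fixed ∘ suc)) % n
        ≡⟨ %-*-cong n {∏ n-1 (λ i → suc i ^ up (suc i) * partner (suc i) ^ up (suc i))} {∏ n-1 (λ i → a ^ up (suc i))}
             (∏-%-cong n n-1 λ i i< → merge i i<) refl ⟩
      (∏ n-1 (λ i → a ^ up (suc i)) * ∏ n-1 (fixed ∘ suc)) % n
        ≡⟨ cong (λ t → (t * ∏ n-1 (fixed ∘ suc)) % n) (∏-^ n-1 a (up ∘ suc)) ⟩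
      (a ^ ∑ n-1 (up ∘ suc) * ∏ n-1 (fixed ∘ suc)) % n ∎
      where
      open ≡-Reasoning
      split : ∀ x → x ≡ x ^ up x * x ^ down x * fixed x
      split x = trichotomy-∏ x (partner x)
      merge : ∀ i → i < n-1 → (suc i ^ up (suc i) * partner (suc i) ^ up (suc i)) % n ≡ a ^ up (suc i) % n
      merge i i< = ^-dec n (suc i <? partner (suc i)) (partner-* z<s (s≤s i<))

  square≡1⇒ : ∀ {x} → 0 < x → x < n → (x * x) % n ≡ 1 % n → x ≡ 1 ⊎ x ≡ n-1
  square≡1⇒ {suc x} _ x<n x²≡1 = cases (euclidsLemma x (2 + x) prime n∣)
    where
    factor : ∀ x → x + x * suc x ≡ x * suc (suc x)
    factor = solve-∀
    n∣ : n ∣ x * (2 + x)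
    n∣ = subst (n ∣_) (factor x) (%≡⇒∣∸ n {suc x * suc x} {1} x²≡1)
    cases : (n ∣ x) ⊎ (n ∣ 2 + x) → suc x ≡ 1 ⊎ suc x ≡ n-1
    cases (inj₂ n∣2+x) = inj₂ (≤-antisym (≤-pred x<n) (≤-pred (∣⇒≤ n∣2+x)))
    cases (inj₁ n∣x) = inj₁ (cong suc (multiple-zero x n∣x (<-trans (n<1+n x) x<n)))
      where
      multiple-zero : ∀ x → n ∣ x → x < n → x ≡ 0
      multiple-zero zero    _   _   = refl
      multiple-zero (suc x) n∣x x<n = contradiction (∣⇒≤ n∣x) (<⇒≱ x<n)

  module Wilson where

    open Pairing 1 (1-coprimeTo n)
    m : ℕ
    m = pred (pred n-1)
    fixed-cases : ∀ {x} → 0 < x → x < n → partner x ≡ x → x ≡ 1 ⊎ x ≡ n-1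
    fixed-cases {x} 0<x x<n px≡x = square≡1⇒ 0<x x<n (trans (cong (λ t → (t * x) % n) (sym px≡x)) (partner-* 0<x x<n))
    trivial : ∀ x → x ≢ partner x → fixed x ≡ 1
    trivial x ne = choose-elim (_≡ 1) (x ≟ partner x) (λ eq → contradiction eq ne) refl
    n-1≡ : suc (suc m) ≡ n-1
    n-1≡ = helper n-1 (+-mono-≤ 0<h 0<h)
      where
      helper : ∀ k → 2 ≤ k → suc (suc (pred (pred k))) ≡ k
      helper (suc (suc k)) _ = refl
      helper (suc zero) (s≤s ())
    square≡1 : (n-1 * n-1) % n ≡ 1 % n
    square≡1 = sym (minus-one 1 n-1 (n%n≡0 n))
    0<n-1 : 0 < n-1
    0<n-1 = ≤-trans 0<h (m≤m+n h h)
    partner-top : partner n-1 ≡ n-1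
    partner-top = <-%-injective n (partner< n-1) (n<1+n n-1)
      (%-*-cancelʳ n (partner n-1) n-1 n-1 (small⇒coprime 0<n-1 (n<1+n n-1)) (trans (partner-* 0<n-1 (n<1+n n-1)) (sym square≡1)))
    fixed-top : fixed n-1 ≡ n-1
    fixed-top = choose-yes (n-1 ≟ partner n-1) (sym partner-top)
    fixed-points : ∏ n-1 (fixed ∘ suc) ≡ n-1
    -- The factors at 1 and at `n-1` are split off from the `m` between them; `fixed 1` equals 1 in
    -- either branch.
    fixed-points = trans (cong (λ t → ∏ t (fixed ∘ suc)) (sym n-1≡)) (trans
      (cong₂ _*_ (trans (∏-front m (fixed ∘ suc)) (cong₂ _*_ (choose-elim (_≡ 1) (1 ≟ partner 1) (λ _ → refl) refl)
        (trans (∏-cong m λ i i<m → trivial (2 + i) (middle i i<m)) (∏-one m))))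
        (trans (cong fixed n-1≡) fixed-top)) (*-identityˡ n-1))
      where
      middle : ∀ i → i < m → 2 + i ≢ partner (2 + i)
      middle i i<m eq = excluded (fixed-cases {2 + i} z<s (s≤s (≤-trans (s≤s i<m) (≤-trans (n≤1+n _) (≤-reflexive n-1≡)))) (sym eq))
        where
        excluded : 2 + i ≡ 1 ⊎ 2 + i ≡ n-1 → ⊥
        excluded (inj₁ ())
        excluded (inj₂ 2+i≡) = <-irrefl (trans 2+i≡ (sym n-1≡)) (s≤s (s≤s i<m))

  wilson : ∏ n-1 suc % n ≡ n-1 % n
  wilson = trans pairing (cong (_% n) (trans (cong (_* ∏ n-1 (fixed ∘ suc)) (^-zeroˡ (∑ n-1 (up ∘ suc)))) (trans (*-identityˡ (∏ n-1 (fixed ∘ suc))) Wilson.fixed-points)))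
    where open Pairing 1 (1-coprimeTo n)

  -- No x is its own partner, so (n - 1)! is a^h. By Wilson this is -1, and by Gauss' lemma it is -1
  -- to the power `negatives a`.
  nonresidue⇒negatives-odd : ∀ {a} → Coprime a n → (∀ y → (y * y) % n ≢ a % n) → negatives a ≡₂ 1
  nonresidue⇒negatives-odd {a} cop nonres = by-parity (negatives a % 2) refl (m%n<n (negatives a) 2)
    where
    open Pairing a cop
    open ≡-Reasoning
    moved : ∀ i → i < n-1 → suc i ≢ partner (suc i)
    moved i i< x≡px = nonres (suc i) (trans (cong (λ t → (t * suc i) % n) x≡px) (partner-* z<s (s≤s i<)))
    fixed≡1 : ∏ n-1 (fixed ∘ suc) ≡ 1
    fixed≡1 = trans (∏-cong n-1 λ i i< → choose-no (suc i ≟ partner (suc i)) (moved i i<)) (∏-one n-1)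
    up-or-down : ∀ i → i < n-1 → up (suc i) + down (suc i) ≡ 1
    up-or-down i i< = dichotomy (suc i) (partner (suc i)) (moved i i<)
      where
      dichotomy : ∀ x y → x ≢ y → ⟦ x <? y ⟧ + ⟦ y <? x ⟧ ≡ 1
      dichotomy x y x≢y with <-cmp x y
      ... | tri< lt _ gt = cong₂ _+_ (⟦⟧-yes (x <? y) lt) (⟦⟧-no (y <? x) gt)
      ... | tri≈ _ x≡y _ = contradiction x≡y x≢y
      ... | tri> lt _ gt = cong₂ _+_ (⟦⟧-no (x <? y) lt) (⟦⟧-yes (y <? x) gt)
    ups : ∑ n-1 (up ∘ suc) ≡ h
    ups = *-cancelˡ-≡ (∑ n-1 (up ∘ suc)) h 2 (begin
      2 * ∑ n-1 (up ∘ suc)                          ≡⟨ cong (∑ n-1 (up ∘ suc) +_) (+-identityʳ _) ⟩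
      ∑ n-1 (up ∘ suc) + ∑ n-1 (up ∘ suc)           ≡⟨ cong (∑ n-1 (up ∘ suc) +_) (trans (∑-cong n-1 λ i i< → sym (down-partner i i<)) (∑-partner down)) ⟩
      ∑ n-1 (up ∘ suc) + ∑ n-1 (down ∘ suc)         ≡⟨ ∑-distrib n-1 (up ∘ suc) (down ∘ suc) ⟨
      ∑ n-1 (λ i → up (suc i) + down (suc i))       ≡⟨ ∑-cong n-1 up-or-down ⟩
      ∑ n-1 (λ _ → 1)                               ≡⟨ trans (∑-const n-1 1) (*-identityʳ n-1) ⟩
      h + h                                         ≡⟨ cong (h +_) (+-identityʳ h) ⟨
      2 * h                                         ∎)
    euler : n-1 % n ≡ n-1 ^ negatives a % n
    euler = begin
      n-1 % n                                                      ≡⟨ wilson ⟨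
      ∏ n-1 suc % n                                                ≡⟨ pairing ⟩
      (a ^ ∑ n-1 (up ∘ suc) * ∏ n-1 (fixed ∘ suc)) % n             ≡⟨ cong₂ (λ s t → (a ^ s * t) % n) ups fixed≡1 ⟩
      (a ^ h * 1) % n                                              ≡⟨ cong (_% n) (*-identityʳ (a ^ h)) ⟩
      a ^ h % n                                                    ≡⟨ gauss cop ⟩
      n-1 ^ negatives a % n                                        ∎
    by-parity : ∀ r → negatives a % 2 ≡ r → r < 2 → negatives a ≡₂ 1
    by-parity 1 eq _ = eq
    by-parity (suc (suc _)) eq (s≤s (s≤s ()))
    by-parity 0 eq _ = contradiction 1≡n-1 (<⇒≢ (+-mono-≤ 0<h 0<h))
      where
      1≡n-1 : 1 ≡ n-1
      1≡n-1 = <-%-injective n (s≤s (≤-trans 0<h (m≤m+n h h))) (n<1+n n-1) (sym (trans euler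
        (trans (cong (λ t → n-1 ^ t % n) (trans (m≡m%n+[m/n]*n (negatives a) 2) (cong (_+ negatives a / 2 * 2) eq))) (n-1-even (negatives a / 2)))))

  nonresidue⇒floor-sum-odd : ∀ {a} → Coprime a n → a ≡₂ 1 → (∀ y → (y * y) % n ≢ a % n) → floor-sum h a ≡₂ 1
  nonresidue⇒floor-sum-odd cop odd nonres = trans (sym (negatives≡floor-sum cop odd)) (nonresidue⇒negatives-odd cop nonres)

-- The Jacobi symbol modulo Fermat numbers

-- F (2 + k) = 48 c + 17 with c = cofactor k, and period k = F (2 + k) - 2 is the product of the smaller Fermat numbers.
cofactor : ℕ → ℕ
cofactor zero    = 0
cofactor (suc k) = let c = cofactor k in 48 * c * c + 32 * c + 5

half modulus period : ℕ → ℕ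
half k    = 24 * cofactor k + 8
modulus k = suc (half k + half k)
period k  = 48 * cofactor k + 15

power-form : ∀ k → 2 ^ (2 ^ (2 + k)) ≡ suc (period k)
power-form zero    = refl
power-form (suc k) = begin
  2 ^ (2 * 2 ^ (2 + k))                      ≡⟨ cong (2 ^_) (*-comm 2 (2 ^ (2 + k))) ⟩
  2 ^ (2 ^ (2 + k) * 2)                      ≡⟨ ^-*-assoc 2 (2 ^ (2 + k)) 2 ⟨
  (2 ^ (2 ^ (2 + k))) ^ 2                    ≡⟨ cong (_^ 2) (power-form k) ⟩
  (suc (48 * cofactor k + 15)) ^ 2           ≡⟨ identity (cofactor k) ⟩
  suc (48 * cofactor (suc k) + 15)           ∎
  where
  open ≡-Reasoning
  identity : ∀ c → suc (48 * c + 15) * (suc (48 * c + 15) * 1) ≡ suc (48 * (48 * c * c + 32 * c + 5) + 15)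
  identity = solve-∀

F-form : ∀ k → F (2 + k) ≡ modulus k
F-form k = trans (cong (_+ 1) (power-form k)) (identity (cofactor k))
  where
  identity : ∀ c → suc (48 * c + 15) + 1 ≡ suc (24 * c + 8 + (24 * c + 8))
  identity = solve-∀

period-suc : ∀ k → period (suc k) ≡ modulus k * period k
period-suc k = identity (cofactor k)
  where
  identity : ∀ c → 48 * (48 * c * c + 32 * c + 5) + 15 ≡ suc (24 * c + 8 + (24 * c + 8)) * (48 * c + 15)
  identity = solve-∀

period-coprime : ∀ k → Coprime (period k) (modulus k)
period-coprime k {d} (d∣P , d∣N) = ∣1⇒≡1 (∣m+n∣m⇒∣n (subst (d ∣_) (split (cofactor k)) (∣n⇒∣m*n (24 * cofactor k + 8) d∣2)) d∣P)
  where
  next : ∀ c → suc (24 * c + 8 + (24 * c + 8)) ≡ 48 * c + 15 + 2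
  next = solve-∀
  d∣2 : d ∣ 2
  d∣2 = ∣m+n∣m⇒∣n (subst (d ∣_) (next (cofactor k)) d∣N) d∣P
  split : ∀ c → (24 * c + 8) * 2 ≡ 48 * c + 15 + 1
  split = solve-∀

3-coprime : ∀ k → Coprime 3 (modulus k)
3-coprime k {d} (d∣3 , d∣N) = ∣1⇒≡1 (∣m+n∣m⇒∣n (subst (d ∣_) (split (cofactor k)) (∣n⇒∣m*n (16 * cofactor k + 6) d∣3)) d∣N)
  where
  split : ∀ c → (16 * c + 6) * 3 ≡ suc (24 * c + 8 + (24 * c + 8)) + 1
  split = solve-∀

-- Reciprocity with `h′` = 1: `half k` is even, and the opposite floor sum is the single quotient of
-- 48 c + 17 by 3, the odd number 16 c + 5.
floor-sum-3 : ∀ k → floor-sum (half k) 3 ≡₂ 1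
floor-sum-3 k = begin
  floor-sum (half k) 3 % 2                     ≡⟨ ≡₂-move {floor-sum (half k) 3 + (16 * c + 5)} {16 * c + 5} {floor-sum (half k) 3}
                                                    (cong (_% 2) (+-comm (floor-sum (half k) 3) (16 * c + 5))) ⟨
  (floor-sum (half k) 3 + (16 * c + 5) + (16 * c + 5)) % 2
    ≡⟨ cong (λ t → (t + (16 * c + 5)) % 2) (trans (cong (floor-sum (half k) 3 +_) (sym quotient3)) (reciprocity (half k) 1 (coprime-sym (3-coprime k)))) ⟩
  (half k * 1 + (16 * c + 5)) % 2              ≡⟨ cong (_% 2) (identity c) ⟩
  (1 + (20 * c + 6) * 2) % 2                   ≡⟨ [m+kn]%n≡m%n 1 (20 * c + 6) 2 ⟩
  1                                            ∎
  where
  open ≡-Reasoning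
  c : ℕ
  c = cofactor k
  identity : ∀ c → (24 * c + 8) * 1 + (16 * c + 5) ≡ 1 + (20 * c + 6) * 2
  identity = solve-∀
  quotient3 : floor-sum 1 (modulus k) ≡ 16 * c + 5
  quotient3 = trans (cong (_/ 3) (division c)) (trans (+-distrib-/-∣ʳ 2 {(16 * c + 5) * 3} (n∣m*n (16 * c + 5))) (m*n/n≡m (16 * c + 5) 3))
    where
    division : ∀ c → suc (24 * c + 8 + (24 * c + 8)) * 1 ≡ 2 + (16 * c + 5) * 3
    division = solve-∀

triangular : ∀ h → ∑ h suc + ∑ h suc ≡ h * suc h
triangular zero    = refl
triangular (suc h) = trans (regroup (∑ h suc) h) (trans (cong (_+ 2 * suc h) (triangular h)) (identity h))
  where
  regroup : ∀ s h → s + suc h + (s + suc h) ≡ s + s + 2 * suc h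
  regroup = solve-∀
  identity : ∀ h → h * suc h + 2 * suc h ≡ suc h * suc (suc h)
  identity = solve-∀

-- Adding `n` to `m` adds 1 + ... + h to the floor sum, which is even because 8 divides `half k`.
floor-sum-periodic : ∀ k m → floor-sum (half k) (m + modulus k) ≡₂ floor-sum (half k) m
floor-sum-periodic k m = begin
  floor-sum h (m + n) % 2                          ≡⟨ cong (_% 2) (trans (∑-cong h λ j _ → shift (suc j)) (∑-distrib h _ _)) ⟩
  (floor-sum h m + ∑ h suc) % 2                    ≡⟨ cong (λ t → (floor-sum h m + t) % 2) even ⟩
  (floor-sum h m + (6 * c + 2) * (24 * c + 9) * 2) % 2   ≡⟨ [m+kn]%n≡m%n (floor-sum h m) ((6 * c + 2) * (24 * c + 9)) 2 ⟩
  floor-sum h m % 2                                ∎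
  where
  open ≡-Reasoning
  h n c : ℕ
  h = half k
  n = modulus k
  c = cofactor k
  shift : ∀ x → (m + n) * x / n ≡ m * x / n + x
  shift x = trans (cong (_/ n) (trans (*-distribʳ-+ x m n) (cong (m * x +_) (*-comm n x))))
    (trans (+-distrib-/-∣ʳ (m * x) (n∣m*n x)) (cong (m * x / n +_) (m*n/n≡m x n)))
  even : ∑ h suc ≡ (6 * c + 2) * (24 * c + 9) * 2
  even = *-cancelˡ-≡ _ _ 2 (trans (cong (∑ h suc +_) (+-identityʳ _)) (trans (triangular h) (identity c)))
    where
    identity : ∀ c → (24 * c + 8) * suc (24 * c + 8) ≡ 2 * ((6 * c + 2) * (24 * c + 9) * 2)
    identity = solve-∀

-- 1 - (m / F (2 + k)), for the Jacobi symbol as given by Gauss' lemma.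
η : ℕ → ℕ → ℕ
η k m = choose (coprime? m (modulus k)) (2 * (floor-sum (half k) m % 2)) 1

η-coprime : ∀ k {m} → Coprime m (modulus k) → η k m ≡ 2 * (floor-sum (half k) m % 2)
η-coprime k {m} cop = choose-yes (coprime? m (modulus k)) cop

η-¬coprime : ∀ k {m} → ¬ Coprime m (modulus k) → η k m ≡ 1
η-¬coprime k {m} ¬cop = choose-no (coprime? m (modulus k)) ¬cop

η-periodic : ∀ k → Periodic (modulus k) (η k)
η-periodic k m = by-cases (coprime? m n)
  where
  n : ℕ
  n = modulus k
  by-cases : Dec (Coprime m n) → η k (m + n) ≡ η k m
  by-cases (yes cop) = trans (η-coprime k λ {d} (d∣m+n , d∣n) → cop (∣m+n∣m⇒∣n (subst (d ∣_) (+-comm m n) d∣m+n) d∣n , d∣n))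
    (trans (cong (2 *_) (floor-sum-periodic k m)) (sym (η-coprime k cop)))
  by-cases (no ¬cop) = trans (η-¬coprime k λ cop → ¬cop λ (d∣m , d∣n) → cop (∣m∣n⇒∣m+n d∣m d∣n , d∣n)) (sym (η-¬coprime k ¬cop))

opposite-parities : ∀ a b → a ≡₂ b + 1 → a % 2 + b % 2 ≡ 1
opposite-parities a b p = trans (cong (_+ b % 2) (trans p (%-distribˡ-+ b 1 2))) (bit (b % 2) (m%n<n b 2))
  where
  bit : ∀ r → r < 2 → (r + 1) % 2 + r ≡ 1
  bit zero          _ = refl
  bit (suc zero)    _ = refl
  bit (suc (suc _)) (s≤s (s≤s ()))

-- (3 / F n) = -1 for n ≥ 2; this is why the symbol has mean zero.
η-3 : ∀ k m → η k (3 * m) + η k m ≡ 2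
η-3 k m = by-cases (coprime? m n)
  where
  n : ℕ
  n = modulus k
  by-cases : Dec (Coprime m n) → η k (3 * m) + η k m ≡ 2
  by-cases (yes cop) = trans (cong₂ _+_ (η-coprime k (coprime-* {3} {m} (3-coprime k) cop)) (η-coprime k cop))
    (trans (sym (*-distribˡ-+ 2 (floor-sum (half k) (3 * m) % 2) _)) (cong (2 *_) (opposite-parities (floor-sum (half k) (3 * m)) (floor-sum (half k) m)
      (trans (HalfSystem.floor-sum-* (half k) {3} {m} refl (3-coprime k) cop)
             (%-+-cong 2 {floor-sum (half k) m} {floor-sum (half k) m} refl (floor-sum-3 k))))))
  by-cases (no ¬cop) = cong₂ _+_ (η-¬coprime k λ cop → ¬cop λ (d∣m , d∣n) → cop (∣n⇒∣m*n 3 d∣m , d∣n)) (η-¬coprime k ¬cop)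

-- Dilation by 3 permutes the residues and turns `η` into 2 - `η`.
∑-η : ∀ k → ∑ (modulus k) (η k) ≡ modulus k
∑-η k = *-cancelˡ-≡ _ _ 2 (begin
  2 * ∑ n (η k)                                ≡⟨ cong (∑ n (η k) +_) (+-identityʳ _) ⟩
  ∑ n (η k) + ∑ n (η k)                        ≡⟨ cong (_+ ∑ n (η k)) (∑-dilate n {η k} (η-periodic k) (3-coprime k)) ⟨
  ∑ n (λ m → η k (3 * m)) + ∑ n (η k)          ≡⟨ ∑-distrib n (λ m → η k (3 * m)) (η k) ⟨
  ∑ n (λ m → η k (3 * m) + η k m)              ≡⟨ ∑-cong n (λ m _ → η-3 k m) ⟩
  ∑ n (λ _ → 2)                                ≡⟨ ∑-const n 2 ⟩
  n * 2                                        ≡⟨ *-comm n 2 ⟩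
  2 * n                                        ∎)
  where
  open ≡-Reasoning
  n : ℕ
  n = modulus k

-- No condition on `δ` is imposed: if it is coprime to the modulus, so is `δ * period k` and all
-- residues are met once; otherwise every term is 1. Both cases give mean exactly one.
∑-η-progression : ∀ k δ r → ∑ (modulus k) (λ i → η k (δ * (i * period k + r))) ≡ modulus k
∑-η-progression k δ r = by-cases (coprime? δ n)
  where
  n P : ℕ
  n = modulus k
  P = period k
  by-cases : Dec (Coprime δ n) → ∑ n (λ i → η k (δ * (i * P + r))) ≡ n
  by-cases (yes cop) = trans (∑-cong n λ i _ → cong (η k) (regroup δ i P r))
    (trans (∑-affine n {η k} (η-periodic k) (coprime-* {δ} {P} cop (period-coprime k)) (δ * r)) (∑-η k))
    where
    regroup : ∀ δ i P r → δ * (i * P + r) ≡ δ * r + δ * P * i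
    regroup = solve-∀
  by-cases (no ¬cop) = trans (∑-cong n λ i _ → η-¬coprime k λ cop → ¬cop λ (d∣δ , d∣n) → cop (∣m⇒∣m*n (i * P + r) d∣δ , d∣n))
    (trans (∑-const n 1) (*-identityʳ n))

twist : ℕ → ℕ → ℕ → ℕ
twist k j m = ∏ j (λ i → η (k + i) m)

-- `period (k + j)` is the product of all Fermat numbers below F (2 + k + j), which include the
-- moduli of all factors.
twist-periodic : ∀ k j δ → Periodic (period (k + j)) (λ t → twist k j (δ * t))
twist-periodic k zero    δ t = refl
twist-periodic k (suc j) δ t = subst (λ P → twist k (suc j) (δ * (t + P)) ≡ twist k (suc j) (δ * t)) (sym P′)
  (cong₂ _*_ (periodic-* {f = λ t → twist k j (δ * t)} (twist-periodic k j δ) (modulus (k + j)) t)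
    (trans (cong (λ s → η (k + j) (δ * (t + s))) (*-comm (modulus (k + j)) (period (k + j))))
      (periodic-* {f = λ t → η (k + j) (δ * t)} (periodic-multiple {f = η (k + j)} (η-periodic (k + j)) δ) (period (k + j)) t)))
  where
  P′ : period (k + suc j) ≡ modulus (k + j) * period (k + j)
  P′ = trans (cong period (+-suc k j)) (period-suc (k + j))

-- Independence of the factors: for t = i P + r the earlier ones depend on r alone, and summing the
-- last one over i gives N whatever r is.
∑-twist : ∀ k j δ → ∑ (period (k + j)) (λ t → twist k j (δ * t)) ≡ period (k + j)
∑-twist k zero    δ = trans (∑-const (period (k + 0)) 1) (*-identityʳ _)
∑-twist k (suc j) δ = begin
  ∑ (period (k + suc j)) f                                           ≡⟨ cong (λ t → ∑ t f) P′ ⟩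
  ∑ (N * P) f                                                        ≡⟨ ∑-block N P f ⟩
  ∑ N (λ i → ∑ P (λ r → g (i * P + r) * η (k + j) (δ * (i * P + r)))) ≡⟨ ∑-cong N (λ i _ → ∑-cong P λ r _ → cong (_* η (k + j) (δ * (i * P + r)))
                                                                          (trans (cong g (+-comm (i * P) r)) (periodic-* {f = g} (twist-periodic k j δ) i r))) ⟩
  ∑ N (λ i → ∑ P (λ r → g r * η (k + j) (δ * (i * P + r))))           ≡⟨ ∑-swap N P _ ⟩
  ∑ P (λ r → ∑ N (λ i → g r * η (k + j) (δ * (i * P + r))))           ≡⟨ ∑-cong P (λ r _ → trans (∑-*ˡ N (g r) _) (trans (cong (g r *_) (∑-η-progression (k + j) δ r)) (*-comm (g r) N))) ⟩
  ∑ P (λ r → N * g r)                                                ≡⟨ ∑-*ˡ P N g ⟩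
  N * ∑ P g                                                          ≡⟨ cong (N *_) (∑-twist k j δ) ⟩
  N * P                                                              ≡⟨ P′ ⟨
  period (k + suc j)                                                 ∎
  where
  open ≡-Reasoning
  N P : ℕ
  N = modulus (k + j)
  P = period (k + j)
  f g : ℕ → ℕ
  f t = twist k (suc j) (δ * t)
  g t = twist k j (δ * t)
  P′ : period (k + suc j) ≡ N * P
  P′ = trans (cong period (+-suc k j)) (period-suc (k + j))

-- Equidistribution of the detecting weight

∑-indicator : ∀ n a → a < n → ∑ n (λ t → ⟦ t ≟ a ⟧) ≡ 1
∑-indicator (suc n) a a<1+n = by-cases (a ≟ n)
  where
  by-cases : Dec (a ≡ n) → ∑ (suc n) (λ t → ⟦ t ≟ a ⟧) ≡ 1
  by-cases (yes refl) = cong₂ _+_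
    (trans (∑-cong n λ t t<n → ⟦⟧-no (t ≟ n) (<⇒≢ t<n)) (∑-zero n)) (⟦⟧-yes (n ≟ n) refl)
  by-cases (no a≢n) = cong₂ _+_ (∑-indicator n a (≤∧≢⇒< (≤-pred a<1+n) a≢n)) (⟦⟧-no (n ≟ a) (a≢n ∘ sym))

module _ (Q : ℕ) .{{_ : NonZero Q}} where

  congruent-1 : ℕ → ℕ
  congruent-1 m = Q * ⟦ m % Q ≟ 1 % Q ⟧

  congruent-1-periodic : Periodic Q congruent-1
  congruent-1-periodic m = cong (λ r → Q * ⟦ r ≟ 1 % Q ⟧) ([m+n]%n≡m%n m Q)

  ∑-congruent-1 : ∀ {δ} → Coprime δ Q → ∑ Q (λ t → congruent-1 (δ * t)) ≡ Q
  ∑-congruent-1 cop = trans (∑-dilate Q {congruent-1} congruent-1-periodic cop)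
    (trans (∑-*ˡ Q Q _) (trans (cong (Q *_) (trans (∑-cong Q λ t t<Q → cong (λ r → ⟦ r ≟ 1 % Q ⟧) (m<n⇒m%n≡m t<Q))
      (∑-indicator Q (1 % Q) (m%n<n 1 Q)))) (*-identityʳ Q)))

odd⇒coprime-2^ : ∀ {δ} k → Odd δ → Coprime δ (2 ^ k)
odd⇒coprime-2^ zero    odd (_ , d∣1) = ∣1⇒≡1 d∣1
odd⇒coprime-2^ (suc k) odd = coprime-sym (coprime-* {2} {2 ^ k} (prime∤⇒coprime prime[2] odd) (coprime-sym (odd⇒coprime-2^ k odd)))

combine-upper : ∀ δ Y Q P X {s t} → s ≤ Y + Q → t ≤ Y + P → δ * Y ≤ X + δ → δ * (s + t) ≤ 2 * X + (Q + P + 2) * δ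
combine-upper δ Y Q P X {s} {t} s≤ t≤ δY≤ = begin
  δ * (s + t)                              ≤⟨ *-monoʳ-≤ δ (+-mono-≤ s≤ t≤) ⟩
  δ * (Y + Q + (Y + P))                    ≡⟨ regroup δ Y Q P ⟩
  2 * (δ * Y) + δ * (Q + P)                ≤⟨ +-monoˡ-≤ (δ * (Q + P)) (*-monoʳ-≤ 2 δY≤) ⟩
  2 * (X + δ) + δ * (Q + P)                ≡⟨ regroup′ δ X Q P ⟩
  2 * X + (Q + P + 2) * δ                  ∎
  where
  open ≤-Reasoning
  regroup : ∀ δ Y Q P → δ * (Y + Q + (Y + P)) ≡ 2 * (δ * Y) + δ * (Q + P)
  regroup = solve-∀
  regroup′ : ∀ δ X Q P → 2 * (X + δ) + δ * (Q + P) ≡ 2 * X + (Q + P + 2) * δ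
  regroup′ = solve-∀

combine-lower : ∀ δ Y Q P X {s t} → Y ≤ s + Q → Y ≤ t + P → X ≤ δ * Y → 2 * X ≤ δ * (s + t) + (Q + P + 2) * δ
combine-lower δ Y Q P X {s} {t} ≤s ≤t X≤ = begin
  2 * X                                    ≤⟨ *-monoʳ-≤ 2 X≤ ⟩
  2 * (δ * Y)                              ≡⟨ regroup δ Y ⟩
  δ * (Y + Y)                              ≤⟨ *-monoʳ-≤ δ (+-mono-≤ ≤s ≤t) ⟩
  δ * (s + Q + (t + P))                    ≤⟨ m≤m+n _ (2 * δ) ⟩
  δ * (s + Q + (t + P)) + 2 * δ            ≡⟨ regroup′ δ s t Q P ⟩
  δ * (s + t) + (Q + P + 2) * δ            ∎
  where
  open ≤-Reasoning
  regroup : ∀ δ Y → 2 * (δ * Y) ≡ δ * (Y + Y)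
  regroup = solve-∀
  regroup′ : ∀ δ s t Q P → δ * (s + Q + (t + P)) + 2 * δ ≡ δ * (s + t) + (Q + P + 2) * δ
  regroup′ = solve-∀

-- Two functions of mean one give the density 2. The error allows one incomplete period for each
-- and, twice, the rounding of `X` / `δ`.
module MeanValue (Q P δ : ℕ) .{{_ : NonZero Q}} .{{_ : NonZero P}} .{{_ : NonZero δ}} (f g : ℕ → ℕ)
  (periodicᶠ : Periodic Q (λ t → f (δ * t))) (meanᶠ : ∑ Q (λ t → f (δ * t)) ≡ Q)
  (periodicᵍ : Periodic P (λ t → g (δ * t))) (meanᵍ : ∑ P (λ t → g (δ * t)) ≡ P) (X : ℕ) where

  private
    Y S : ℕ
    Y = multiples δ X
    S = ∑ X (λ m → ⟦ δ ∣? m ⟧ * (f m + g m))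
    S≡ : S ≡ ∑ Y (λ t → f (δ * t)) + ∑ Y (λ t → g (δ * t))
    S≡ = trans (∑-multiples δ X (λ m → f m + g m)) (∑-distrib Y (λ t → f (δ * t)) (λ t → g (δ * t)))

  mean-upper : δ * S ≤ 2 * X + (Q + P + 2) * δ
  mean-upper = subst (λ t → δ * t ≤ 2 * X + (Q + P + 2) * δ) (sym S≡) (combine-upper δ Y Q P X
    (periodic-∑≤ Q {λ t → f (δ * t)} periodicᶠ meanᶠ Y)
    (periodic-∑≤ P {λ t → g (δ * t)} periodicᵍ meanᵍ Y) (<⇒≤ (proj₂ (multiples-bounds δ X))))

  mean-lower : 2 * X ≤ δ * S + (Q + P + 2) * δ
  mean-lower = subst (λ t → 2 * X ≤ δ * t + (Q + P + 2) * δ) (sym S≡) (combine-lower δ Y Q P X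
    (periodic-≤∑ Q {λ t → f (δ * t)} periodicᶠ meanᶠ Y)
    (periodic-≤∑ P {λ t → g (δ * t)} periodicᵍ meanᵍ Y) (proj₁ (multiples-bounds δ X)))

-- Detects p ≡ 1 (mod 2 ^ K) together with the p at which all Fermat numbers F K, ..., F (2K - 1), K = k + 2, are non-residues.
detector : ℕ → ℕ → ℕ
detector k m = congruent-1 (2 ^ (2 + k)) {{m^n≢0 2 (2 + k)}} m + twist k (2 + k) m


module Density (k X δ : ℕ) .{{_ : NonZero δ}} (odd : Odd δ) where
  private
    Q P : ℕ
    Q = 2 ^ (2 + k)
    P = period (k + (2 + k))
    instance
      Q≢0 : NonZero Q
      Q≢0 = m^n≢0 2 (2 + k)
      P≢0 : NonZero P
      P≢0 = >-nonZero (≤-trans (s≤s z≤n) (m≤n+m 15 (48 * cofactor (k + (2 + k)))))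

  open MeanValue Q P δ (congruent-1 Q) (twist k (2 + k))
    (periodic-multiple {f = congruent-1 Q} (congruent-1-periodic Q) δ) (∑-congruent-1 Q (odd⇒coprime-2^ (2 + k) odd))
    (twist-periodic k (2 + k) δ) (∑-twist k (2 + k) δ) X
    public

-- Elite primes

-- The power of 2 in `q` is below 2^K, so further twos in 2^i are of no help. The induction halves
-- `q` while lowering K, until `q` is odd.
∣2^-reduce : ∀ K {q} i M → ¬ 2 ^ K ∣ q → q ∣ 2 ^ i * M → q ∣ 2 ^ K * M
∣2^-reduce zero    i M ¬2^K∣q _ = contradiction (1∣ _) ¬2^K∣q
∣2^-reduce (suc K) {q} i M ¬2^K∣q q∣ = by-cases (2 ∣? q) i q∣
  where
  by-cases : Dec (2 ∣ q) → ∀ i → q ∣ 2 ^ i * M → q ∣ 2 ^ suc K * M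
  by-cases (no odd)  i q∣ = ∣n⇒∣m*n (2 ^ suc K) (coprime-divisor (odd⇒coprime-2^ i odd) q∣)
  by-cases (yes _) zero q∣ = ∣n⇒∣m*n (2 ^ suc K) (subst (q ∣_) (*-identityˡ M) q∣)
  by-cases (yes (divides q′ q≡)) (suc i) q∣ = subst₂ _∣_ (sym (trans q≡ (*-comm q′ 2))) (sym (*-assoc 2 (2 ^ K) M))
    (*-monoʳ-∣ 2 (∣2^-reduce K {q′} i M (λ 2^K∣q′ → ¬2^K∣q (subst (2 * 2 ^ K ∣_) (sym (trans q≡ (*-comm q′ 2))) (*-monoʳ-∣ 2 2^K∣q′)))
      (*-cancelˡ-∣ 2 (subst₂ _∣_ (trans q≡ (*-comm q′ 2)) (*-assoc 2 (2 ^ i) M) q∣))))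

-- Among the first q + 1 powers of 2 two agree modulo `q`. This covers even `q`, for which 2 is not
-- invertible.
2^-repeats : ∀ q .{{_ : NonZero q}} → ∃₂ λ i t → q ∣ 2 ^ i * (2 ^ suc t ∸ 1)
2^-repeats q = conclude (pigeonhole (n<1+n q) (λ i → fromℕ< (m%n<n (2 ^ toℕ i) q)))
  where
  conclude : (∃₂ λ (i j : Fin (suc q)) → toℕ i < toℕ j × fromℕ< (m%n<n (2 ^ toℕ i) q) ≡ fromℕ< (m%n<n (2 ^ toℕ j) q)) →
             ∃₂ λ i t → q ∣ 2 ^ i * (2 ^ suc t ∸ 1)
  conclude (i , j , i<j , eq) = toℕ i , t , subst (q ∣_) factor (%≡⇒∣∸ q {2 ^ toℕ j} {2 ^ toℕ i}
    (trans (sym (toℕ-fromℕ< _)) (trans (cong toℕ (sym eq)) (toℕ-fromℕ< _))))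
    where
    t : ℕ
    t = toℕ j ∸ suc (toℕ i)
    factor : 2 ^ toℕ j ∸ 2 ^ toℕ i ≡ 2 ^ toℕ i * (2 ^ suc t ∸ 1)
    factor = begin
      2 ^ toℕ j ∸ 2 ^ toℕ i                          ≡⟨ cong (λ s → 2 ^ s ∸ 2 ^ toℕ i) (trans (sym (m+[n∸m]≡n i<j)) (sym (+-suc (toℕ i) t))) ⟩
      2 ^ (toℕ i + suc t) ∸ 2 ^ toℕ i                ≡⟨ cong₂ _∸_ (^-distribˡ-+-* 2 (toℕ i) (suc t)) (sym (*-identityʳ (2 ^ toℕ i))) ⟩
      2 ^ toℕ i * 2 ^ suc t ∸ 2 ^ toℕ i * 1          ≡⟨ *-distribˡ-∸ (2 ^ toℕ i) (2 ^ suc t) 1 ⟨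
      2 ^ toℕ i * (2 ^ suc t ∸ 1)                    ∎
      where open ≡-Reasoning

odd-prime-half : ∀ {p} → Prime p → 2 < p → ∃[ h ] p ≡ suc (h + h)
odd-prime-half {suc q} pr 2<p = by-remainder (q % 2) refl (m%n<n q 2)
  where
  double : ∀ k → k * 2 ≡ k + k
  double = solve-∀
  by-remainder : ∀ r → q % 2 ≡ r → r < 2 → ∃[ h ] suc q ≡ suc (h + h)
  by-remainder 0 eq _ = q / 2 , cong suc (trans (m≡m%n+[m/n]*n q 2) (trans (cong (_+ q / 2 * 2) eq) (double (q / 2))))
  by-remainder 1 eq _ = ⊥-elim (2∣p⇒⊥ (prime⇒irreducible pr (divides (suc (q / 2)) (cong suc (trans (m≡m%n+[m/n]*n q 2) (cong (_+ q / 2 * 2) eq))))))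
    where
    2∣p⇒⊥ : 2 ≡ 1 ⊎ 2 ≡ suc q → ⊥
    2∣p⇒⊥ (inj₁ ())
    2∣p⇒⊥ (inj₂ 2≡p) = <⇒≢ 2<p 2≡p
  by-remainder (suc (suc _)) eq (s≤s (s≤s ()))

odd-modulus : ∀ h → suc (h + h) ≡₂ 1
odd-modulus h = +-double 1 h

module _ (h : ℕ) (prime : Prime (suc (h + h))) where

  open HalfSystem h using (n)
  open Legendre h prime

  -- From index K on, p - 1 divides 2^m (2^(t+1) - 1), so the exponents 2^m and 2^(m+t+1) agree
  -- modulo p - 1 and Fermat's little theorem applies.
  F-periodic : ∀ K → ¬ 2 ^ K ∣ h + h → ∃[ t ] (∀ m → K ≤ m → F (m + suc t) % n ≡ F m % n)
  F-periodic K ¬2^K∣ = conclude (2^-repeats (h + h) {{>-nonZero (≤-trans 0<h (m≤m+n h h))}})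
    where
    2-coprime : Coprime 2 n
    2-coprime = small⇒coprime z<s (s≤s (+-mono-≤ 0<h 0<h))
    conclude : (∃₂ λ i t → h + h ∣ 2 ^ i * (2 ^ suc t ∸ 1)) → ∃[ t ] (∀ m → K ≤ m → F (m + suc t) % n ≡ F m % n)
    conclude (i , t , q∣) = t , λ m K≤m → %-+-cong n {2 ^ (2 ^ (m + suc t))} {2 ^ (2 ^ m)} {1} {1} (repeat m (reduced m K≤m)) refl
      where
      reduced : ∀ m → K ≤ m → h + h ∣ 2 ^ m * (2 ^ suc t ∸ 1)
      reduced m K≤m = subst (h + h ∣_) (trans (sym (*-assoc (2 ^ (m ∸ K)) (2 ^ K) _))
          (cong (_* (2 ^ suc t ∸ 1)) (trans (sym (^-distribˡ-+-* 2 (m ∸ K) K)) (cong (2 ^_) (m∸n+n≡m K≤m)))))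
        (∣n⇒∣m*n (2 ^ (m ∸ K)) (∣2^-reduce K i (2 ^ suc t ∸ 1) ¬2^K∣ q∣))
      repeat : ∀ m → h + h ∣ 2 ^ m * (2 ^ suc t ∸ 1) → 2 ^ (2 ^ (m + suc t)) % n ≡ 2 ^ (2 ^ m) % n
      repeat m (divides c eq) = begin
        2 ^ (2 ^ (m + suc t)) % n                     ≡⟨ cong (λ s → 2 ^ s % n) exponent ⟩
        2 ^ (2 ^ m + (h + h) * c) % n                 ≡⟨ cong (_% n) (trans (^-distribˡ-+-* 2 (2 ^ m) ((h + h) * c)) (cong (2 ^ (2 ^ m) *_) (sym (^-*-assoc 2 (h + h) c)))) ⟩
        (2 ^ (2 ^ m) * (2 ^ (h + h)) ^ c) % n         ≡⟨ %-*-cong n {2 ^ (2 ^ m)} {2 ^ (2 ^ m)} {(2 ^ (h + h)) ^ c} {1 ^ c} refl (%-^-cong n {2 ^ (h + h)} {1} c (fermat 2-coprime)) ⟩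
        (2 ^ (2 ^ m) * 1 ^ c) % n                     ≡⟨ cong (_% n) (trans (cong (2 ^ (2 ^ m) *_) (^-zeroˡ c)) (*-identityʳ (2 ^ (2 ^ m)))) ⟩
        2 ^ (2 ^ m) % n                               ∎
        where
        open ≡-Reasoning
        exponent : 2 ^ (m + suc t) ≡ 2 ^ m + (h + h) * c
        exponent = begin
          2 ^ (m + suc t)                             ≡⟨ ^-distribˡ-+-* 2 m (suc t) ⟩
          2 ^ m * 2 ^ suc t                           ≡⟨ cong (2 ^ m *_) (m+[n∸m]≡n (m^n>0 2 (suc t))) ⟨
          2 ^ m * (1 + (2 ^ suc t ∸ 1))               ≡⟨ *-distribˡ-+ (2 ^ m) 1 _ ⟩
          2 ^ m * 1 + 2 ^ m * (2 ^ suc t ∸ 1)         ≡⟨ cong₂ _+_ (*-identityʳ (2 ^ m)) (trans eq (*-comm c (h + h))) ⟩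
          2 ^ m + (h + h) * c                         ∎

  nonresidues-from : ∀ K N → ¬ 2 ^ K ∣ h + h → (∀ m → N ≤ m → QNR n (F m)) → ∀ m → K ≤ m → QNR n (F m)
  nonresidues-from K N ¬2^K∣ qnr m K≤m (y , y²≡F) = conclude (F-periodic K ¬2^K∣)
    where
    conclude : ∃[ t ] (∀ m → K ≤ m → F (m + suc t) % n ≡ F m % n) → ⊥
    -- A period has length at least 1, so `N` of them lead past `N`, where non-residuosity is known.
    conclude (t , per) = qnr (m + N * suc t) (≤-trans (m≤m*n N (suc t)) (m≤n+m _ m)) (y , trans y²≡F (sym (iterate N)))
      where
      iterate : ∀ j → F (m + j * suc t) % n ≡ F m % n
      iterate zero    = cong (λ s → F s % n) (+-identityʳ m)
      iterate (suc j) = trans (cong (λ s → F s % n) (trans (cong (m +_) (+-comm (suc t) (j * suc t))) (sym (+-assoc m (j * suc t) (suc t)))))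
        (trans (per (m + j * suc t) (≤-trans K≤m (m≤m+n m _))) (iterate j))

  -- `half k` is even, so reciprocity has no sign and (p / F) = (F / p) = -1.
  nonresidue⇒η : ∀ k → QNR n (F (2 + k)) → η k n ≡ 2
  nonresidue⇒η k qnr = trans (η-coprime k (coprime-sym modulus-coprime)) (cong (2 *_) odd)
    where
    M : ℕ
    M = modulus k
    qnr′ : QNR n M
    qnr′ = subst (QNR n) (F-form k) qnr
    modulus-coprime : Coprime M n
    -- `QR` admits the root 0, so a non-residue is not divisible by p.
    modulus-coprime = ∤⇒coprime λ n∣M → qnr′ (0 , sym (n∣m⇒m%n≡0 M n n∣M))
    odd : floor-sum (half k) n ≡₂ 1
    odd = begin
      floor-sum (half k) n % 2
        ≡⟨ %-+-cancelʳ 2 (floor-sum (half k) n) 1 (floor-sum h M) (begin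
             (floor-sum (half k) n + floor-sum h M) % 2    ≡⟨ cong (_% 2) (reciprocity (half k) h modulus-coprime) ⟩
             (half k * h) % 2                              ≡⟨ cong (_% 2) (even (cofactor k) h) ⟩
             (0 + (12 * cofactor k + 4) * h * 2) % 2       ≡⟨ [m+kn]%n≡m%n 0 ((12 * cofactor k + 4) * h) 2 ⟩
             (1 + 1) % 2                                   ≡⟨ %-+-cong 2 {1} {1} {floor-sum h M} {1} refl
                                                                (nonresidue⇒floor-sum-odd modulus-coprime (odd-modulus (half k)) λ y y² → qnr′ (y , y²)) ⟨
             (1 + floor-sum h M) % 2                       ∎) ⟩
      1 % 2 ∎
      where
      open ≡-Reasoning
      even : ∀ c h → (24 * c + 8) * h ≡ 0 + (12 * c + 4) * h * 2
      even = solve-∀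

  detects : ∀ k N → (∀ m → N ≤ m → QNR n (F m)) → 2 ^ (2 + k) ≤ detector k n
  detects k N qnr = by-cases (2 ^ (2 + k) ∣? h + h)
    where
    open ≤-Reasoning
    Q : ℕ
    Q = 2 ^ (2 + k)
    instance
      Q≢0 : NonZero Q
      Q≢0 = m^n≢0 2 (2 + k)
    by-cases : Dec (Q ∣ h + h) → Q ≤ detector k n
    by-cases (yes Q∣) = begin
      Q                                  ≡⟨ *-identityʳ Q ⟨
      Q * 1                              ≡⟨ cong (Q *_) (⟦⟧-yes (n % Q ≟ 1 % Q) (∣∸⇒%≡ Q (s≤s z≤n) Q∣)) ⟨
      congruent-1 Q n                    ≤⟨ m≤m+n _ _ ⟩
      detector k n                       ∎
    by-cases (no ¬Q∣) = begin
      Q                                  ≡⟨ ∏-const (2 + k) 2 ⟨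
      ∏ (2 + k) (λ _ → 2)                ≡⟨ ∏-cong (2 + k) (λ i _ → sym (nonresidue⇒η (k + i) (nonresidues-from (2 + k) N ¬Q∣ qnr (2 + (k + i)) (s≤s (s≤s (m≤m+n k i)))))) ⟩
      twist k (2 + k) n                  ≤⟨ m≤n+m _ (congruent-1 Q n) ⟩
      detector k n                       ∎

elite-detected : ∀ k {p} → 2 < p → Elite p → 2 ^ (2 + k) ≤ detector k p
elite-detected k {suc q} 2<p (pr , N , qnr) = conclude (odd-prime-half pr 2<p) pr qnr
  where
  conclude : ∃[ h ] suc q ≡ suc (h + h) → Prime (suc q) → (∀ m → N ≤ m → QNR (suc q) (F m)) → 2 ^ (2 + k) ≤ detector k (suc q)
  conclude (h , refl) pr qnr = detects h pr k N qnr

-- Choice of parameters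

n<2^n : ∀ n → n < 2 ^ n
n<2^n zero    = z<s
n<2^n (suc n) = begin
  suc (suc n)          ≤⟨ s≤s (n<2^n n) ⟩
  1 + 2 ^ n            ≤⟨ +-monoˡ-≤ (2 ^ n) (m^n>0 2 n) ⟩
  2 ^ n + 2 ^ n        ≡⟨ cong (2 ^ n +_) (+-identityʳ (2 ^ n)) ⟨
  2 ^ suc n            ∎
  where open ≤-Reasoning

2^⌊log₂⌋≤ : ∀ n → 0 < n → 2 ^ ⌊log₂ n ⌋ ≤ n
2^⌊log₂⌋≤ n = bounded n n ≤-refl
  where
  bounded : ∀ b n → n ≤ b → 0 < n → 2 ^ ⌊log₂ n ⌋ ≤ n
  bounded zero    n       n≤b 0<n = contradiction n≤b (<⇒≱ 0<n)
  bounded (suc b) 1       _   _   = ≤-reflexive (cong (2 ^_) (⌊log₂[2^n]⌋≡n 0))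
  bounded (suc b) n@(suc (suc n′)) n≤b _ = begin
    2 ^ ⌊log₂ n ⌋                  ≡⟨ cong (2 ^_) (m+[n∸m]≡n 1≤log) ⟨
    2 * 2 ^ (⌊log₂ n ⌋ ∸ 1)        ≡⟨ cong (λ t → 2 * 2 ^ t) (⌊log₂⌊n/2⌋⌋≡⌊log₂n⌋∸1 n) ⟨
    2 * 2 ^ ⌊log₂ ⌊ n /2⌋ ⌋        ≤⟨ *-monoʳ-≤ 2 (bounded b ⌊ n /2⌋ (≤-trans (s≤s (⌊n/2⌋≤n n′)) (≤-pred n≤b)) z<s) ⟩
    2 * ⌊ n /2⌋                    ≡⟨ cong (⌊ n /2⌋ +_) (+-identityʳ ⌊ n /2⌋) ⟩
    ⌊ n /2⌋ + ⌊ n /2⌋              ≤⟨ +-monoʳ-≤ ⌊ n /2⌋ (⌊n/2⌋≤⌈n/2⌉ n) ⟩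
    ⌊ n /2⌋ + ⌈ n /2⌉              ≡⟨ ⌊n/2⌋+⌈n/2⌉≡n n ⟩
    n                              ∎
    where
    open ≤-Reasoning
    1≤log : 1 ≤ ⌊log₂ n ⌋
    1≤log = subst (_≤ ⌊log₂ n ⌋) (⌊log₂[2^n]⌋≡n 1) (⌊log₂⌋-mono-≤ {2} {n} (s≤s (s≤s z≤n)))

power square : ℕ → ℕ
power k  = 2 ^ (2 + k)
square k = power k * power k

square-suc : ∀ k → square (suc k) ≡ 4 * square k
square-suc k = identity (power k)
  where
  identity : ∀ Q → 2 * Q * (2 * Q) ≡ 4 * (Q * Q)
  identity = solve-∀

-- `square` grows by the factor 4, which accounts for 64 against 16. The search descends from j = L,
-- where `square` is certainly large enough.
scale : ∀ L → 16 * square 0 ≤ L → ∃[ k ] (16 * square k ≤ L × L ≤ 64 * square k)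
scale L 16A≤L = search L (≤-trans (<⇒≤ (n<2^n L)) (≤-trans (m≤n*m (2 ^ L) 4) (≤-trans (≤-reflexive (sym (^-distribˡ-+-* 2 2 L)))
    (≤-trans (m≤n*m (power L) (power L) {{m^n≢0 2 (2 + L)}}) (m≤n*m (square L) 16)))))
  where
  search : ∀ j → L ≤ 16 * square j → ∃[ k ] (16 * square k ≤ L × L ≤ 64 * square k)
  search zero    L≤ = 0 , 16A≤L , ≤-trans L≤ (*-monoˡ-≤ (square 0) {16} {64} (m≤m+n 16 48))
  search (suc j) L≤ with ≤-total L (16 * square j)
  ... | inj₁ L≤′ = search j L≤′
  ... | inj₂ ≤L  = j , ≤L , ≤-trans L≤ (≤-reflexive (trans (cong (16 *_) (square-suc j)) (sym (*-assoc 16 4 (square j)))))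

-- `c` is at most 16 B^3, so the product is at most 4 · 16^2 B^7, and 4 · 16^2 = 1024.
error-small : ∀ {B E z} → 1024 ≤ B → E ≤ 4 * B → z ≡ 2 * B → let c = z * z * suc z in E * (c * c) ≤ B ^ 8
error-small {B} {E} {z} 1024≤B E≤ refl = begin
  E * (c * c)                                ≤⟨ *-mono-≤ E≤ (*-mono-≤ c≤ c≤) ⟩
  4 * B * (16 * (B * B * B) * (16 * (B * B * B)))   ≡⟨ identity B ⟩
  1024 * B ^ 7                               ≤⟨ *-monoˡ-≤ (B ^ 7) 1024≤B ⟩
  B ^ 8                                      ∎
  where
  open ≤-Reasoning
  c : ℕ
  c = 2 * B * (2 * B) * suc (2 * B)
  c≤ : c ≤ 16 * (B * B * B)
  c≤ = begin
    2 * B * (2 * B) * suc (2 * B)            ≤⟨ *-monoʳ-≤ (2 * B * (2 * B)) (+-monoˡ-≤ (2 * B) (≤-trans (s≤s z≤n) (≤-trans 1024≤B (m≤n*m B 2)))) ⟩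
    2 * B * (2 * B) * (2 * B + 2 * B)        ≡⟨ identity′ B ⟩
    16 * (B * B * B)                         ∎
    where
    identity′ : ∀ B → 2 * B * (2 * B) * (2 * B + 2 * B) ≡ 16 * (B * B * B)
    identity′ = solve-∀
  identity : ∀ B → 4 * B * (16 * (B * B * B) * (16 * (B * B * B))) ≡ 1024 * (B * (B * (B * (B * (B * (B * (B * 1)))))))
  identity = solve-∀

small-primes : ∀ {B Q A z} → 1024 ≤ B → Q ≤ B → A ≤ B → z ≡ 2 * B → suc z * (Q * A) ≤ B ^ 8
small-primes {B} {Q} {A} 1024≤B Q≤B A≤B refl = begin
  suc (2 * B) * (Q * A)                      ≤⟨ *-mono-≤ {suc (2 * B)} {4 * B} (≤-trans (+-monoˡ-≤ (2 * B) (≤-trans (s≤s z≤n) (≤-trans 1024≤B (m≤n*m B 2)))) (≤-reflexive (identity B)))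
                                                (*-mono-≤ Q≤B A≤B) ⟩
  4 * B * (B * B)                            ≡⟨ identity′ B ⟩
  4 * B ^ 3                                  ≤⟨ *-monoˡ-≤ (B ^ 3) (≤-trans (m≤m+n 4 1020) 1024≤B) ⟩
  B ^ 4                                      ≤⟨ ^-monoʳ-≤ B {{>-nonZero (≤-trans (s≤s z≤n) 1024≤B)}} (m≤m+n 4 4) ⟩
  B ^ 8                                      ∎
  where
  open ≤-Reasoning
  identity : ∀ B → 2 * B + 2 * B ≡ 4 * B
  identity = solve-∀
  identity′ : ∀ B → 4 * B * (B * B) ≡ 4 * (B * (B * (B * 1)))
  identity′ = solve-∀

-- 21 = 1 + 4 (4 + 1): the small entries cost x, the main term 2 (x + 1) is at most 4 x, and the
-- error at most x.
count-bound : ∀ {x Q A e} ℓ y → 1 ≤ x → (ℓ ∸ y) * Q * A ≤ 4 * (2 * suc x + e) → e ≤ x → y * (Q * A) ≤ x → ℓ * (Q * A) ≤ 21 * x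
count-bound {x} {Q} {A} {e} ℓ y 1≤x sieve e≤x y≤ = begin
  ℓ * (Q * A)                                ≤⟨ *-monoˡ-≤ (Q * A) (m≤n+m∸n ℓ y) ⟩
  (y + (ℓ ∸ y)) * (Q * A)                    ≡⟨ *-distribʳ-+ (Q * A) y (ℓ ∸ y) ⟩
  y * (Q * A) + (ℓ ∸ y) * (Q * A)            ≤⟨ +-mono-≤ y≤ (≤-trans (≤-reflexive (sym (*-assoc (ℓ ∸ y) Q A))) sieve) ⟩
  x + 4 * (2 * suc x + e)                    ≤⟨ +-monoʳ-≤ x (*-monoʳ-≤ 4 (+-mono-≤ (*-monoʳ-≤ 2 (+-monoˡ-≤ x 1≤x)) e≤x)) ⟩
  x + 4 * (2 * (x + x) + x)                  ≡⟨ identity x ⟩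
  21 * x                                     ∎
  where
  open ≤-Reasoning
  identity : ∀ x → x + 4 * (2 * (x + x) + x) ≡ 21 * x
  identity = solve-∀

constant : ℕ
constant = 64 * 64 * 64 * (21 * 21)

-- L^(3/2) is comparable to Q^3; squaring both bounds yields 64^3 from the scale and 21^2 from the
-- count.
squared-bound : ∀ {x Q L} ℓ → ℓ * (Q * (Q * Q)) ≤ 21 * x → L ≤ 64 * (Q * Q) → ℓ * ℓ * L ^ 3 ≤ constant * (x * x)
squared-bound {x} {Q} {L} ℓ ℓ≤ L≤ = begin
  ℓ * ℓ * L ^ 3                                                          ≤⟨ *-monoʳ-≤ (ℓ * ℓ) (^-monoˡ-≤ 3 L≤) ⟩
  ℓ * ℓ * (64 * (Q * Q)) ^ 3                                             ≡⟨ identity ℓ Q 64 ⟩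
  64 * 64 * 64 * (ℓ * (Q * (Q * Q)) * (ℓ * (Q * (Q * Q))))               ≤⟨ *-monoʳ-≤ (64 * 64 * 64) (*-mono-≤ ℓ≤ ℓ≤) ⟩
  64 * 64 * 64 * (21 * x * (21 * x))                                     ≡⟨ identity′ (64 * 64 * 64) 21 x ⟩
  constant * (x * x)                                                     ∎
  where
  open ≤-Reasoning
  identity : ∀ ℓ Q a → ℓ * ℓ * (a * (Q * Q) * (a * (Q * Q) * (a * (Q * Q) * 1))) ≡ a * a * a * (ℓ * (Q * (Q * Q)) * (ℓ * (Q * (Q * Q))))
  identity = solve-∀
  identity′ : ∀ a b x → a * (b * x * (b * x)) ≡ a * (b * b) * (x * x)
  identity′ = solve-∀

elite⇒prime : ∀ {p} → Elite p → Prime p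
elite⇒prime {suc q} = proj₁

module Bound (k x : ℕ) (16A≤L : 16 * square k ≤ ⌊log₂ x ⌋) (1≤x : 1 ≤ x) where

  open ≤-Reasoning

  Q A B z E : ℕ
  -- With K = k + 2 these are Q = 2^K, A = 4^K and B = F (2 K) - 1, one more than the period of the
  -- product in `detector`. The sieve reaches `z` = 2 B; as B^16 ≤ x, the errors fit under B^8,
  -- while log z is still of the order of log x.
  Q = power k
  A = square k
  B = 2 ^ A
  z = 2 ^ suc A
  E = Q + period (k + (2 + k)) + 2

  4≤Q : 4 ≤ Q
  4≤Q = ^-monoʳ-≤ 2 (m≤m+n 2 k)

  16≤A : 16 ≤ A
  16≤A = *-mono-≤ 4≤Q 4≤Q

  Q≤A : Q ≤ A
  Q≤A = m≤n*m Q Q {{m^n≢0 2 (2 + k)}}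

  A≤B : A ≤ B
  A≤B = <⇒≤ (n<2^n A)

  1024≤B : 1024 ≤ B
  1024≤B = ^-monoʳ-≤ 2 (≤-trans (m≤m+n 10 6) 16≤A)

  B⁸≤x : B ^ 8 ≤ x
  B⁸≤x = begin
    B ^ 8                  ≡⟨ ^-*-assoc 2 A 8 ⟩
    2 ^ (A * 8)            ≤⟨ ^-monoʳ-≤ 2 (≤-trans (≤-reflexive (*-comm A 8)) (≤-trans (*-monoˡ-≤ A (m≤m+n 8 8)) 16A≤L)) ⟩
    2 ^ ⌊log₂ x ⌋          ≤⟨ 2^⌊log₂⌋≤ x 1≤x ⟩
    x                      ∎

  period-form : B ≡ suc (period (k + (2 + k)))
  period-form = trans (cong (2 ^_) (sym (^-distribˡ-+-* 2 (2 + k) (2 + k)))) (power-form (k + (2 + k)))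

  E≤4B : E ≤ 4 * B
  E≤4B = begin
    Q + P + 2              ≡⟨ regroup Q P ⟩
    Q + suc P + 1          ≤⟨ +-mono-≤ (+-mono-≤ (≤-trans Q≤A A≤B) (≤-reflexive (sym period-form))) (≤-trans (s≤s z≤n) 1024≤B) ⟩
    B + B + B              ≤⟨ m≤m+n _ B ⟩
    B + B + B + B          ≡⟨ four B ⟩
    4 * B                  ∎
    where
    P : ℕ
    P = period (k + (2 + k))
    regroup : ∀ Q P → Q + P + 2 ≡ Q + suc P + 1
    regroup = solve-∀
    four : ∀ B → B + B + B + B ≡ 4 * B
    four = solve-∀

  free : ∀ {p} → Prime p → z < p → Free z p
  free pr z<p q q≤z (pq , _) q∣p = excluded (prime⇒irreducible pr q∣p)
    where
    excluded : q ≡ 1 ⊎ q ≡ _ → ⊥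
    excluded (inj₁ refl) = ¬prime[1] pq
    excluded (inj₂ refl) = <⇒≱ z<p q≤z

  2<z : 2 < z
  2<z = ≤-trans (m≤m+n 3 1021) (≤-trans 1024≤B (m≤n*m B 2))

  sifted : ∀ {p} → p ≤ x × Elite p → p < suc x × (p ≤ z ⊎ (Q ≤ detector k p × Free z p))
  sifted {p} (p≤x , elite) = s≤s p≤x , by-cases (p ≤? z)
    where
    by-cases : Dec (p ≤ z) → p ≤ z ⊎ (Q ≤ detector k p × Free z p)
    by-cases (yes p≤z) = inj₁ p≤z
    by-cases (no p≰z)  = inj₂ (elite-detected k (<-trans 2<z (≰⇒> p≰z)) elite , free (elite⇒prime elite) (≰⇒> p≰z))

  open Conclusion (suc x) (2 * suc x) E (detector k)
    (λ δ odd → Density.mean-upper k (suc x) δ odd) (λ δ odd → Density.mean-lower k (suc x) δ odd)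

  elite-count : ∀ l → EliteList x l → length l * (Q * A) ≤ 21 * x
  elite-count l (unique , all) = count-bound (length l) (suc z) 1≤x
    (sieve-bound A Q l (≤-trans (m≤m+n 4 12) 16≤A) unique (All.map sifted all))
    (≤-trans (error-small 1024≤B E≤4B refl) B⁸≤x)
    (≤-trans (small-primes 1024≤B (≤-trans Q≤A A≤B) A≤B refl) B⁸≤x)

threshold : ∀ n {x} → 2 ^ n ≤ x → n ≤ ⌊log₂ x ⌋
threshold n {x} 2^n≤x = subst (_≤ ⌊log₂ x ⌋) (⌊log₂[2^n]⌋≡n n) (⌊log₂⌋-mono-≤ {2 ^ n} {x} 2^n≤x)

theorem1 : ∃[ C ] ∃[ N ] ((x : ℕ) → N ≤ x → (l : List ℕ) → EliteList x l →
    (length l * length l) * (⌊log₂ x ⌋ ^ 3) ≤ C * (x * x))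
theorem1 = constant , 2 ^ (16 * square 0) , λ x N≤x l elite → conclude x N≤x l elite (scale ⌊log₂ x ⌋ (threshold (16 * square 0) N≤x))
  where
  conclude : ∀ x → 2 ^ (16 * square 0) ≤ x → ∀ l → EliteList x l → ∃[ k ] (16 * square k ≤ ⌊log₂ x ⌋ × ⌊log₂ x ⌋ ≤ 64 * square k) →
    (length l * length l) * (⌊log₂ x ⌋ ^ 3) ≤ constant * (x * x)
  conclude x N≤x l elite (k , lower , upper) =
    squared-bound {x} {power k} (length l) (Bound.elite-count k x lower (≤-trans (m^n>0 2 (16 * square 0)) N≤x) l elite) upper
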